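{- Assume a machine word holds $w$ characters and word operations (loading $w$ characters, comparison, XOR, leading-zero count) take constant time, $\alpha$ is a constant, $v=2^d-1$ with $v=O(n)$. Then a single step of super scalar string sample sort on a set of $n$ strings with common prefix length $h$, as described in the context, can be implemented on a CREW PRAM with $p$ processors in $O(\frac{n}{p}\log v + \log(pv) + v)$ time and $O(n\log v + pv)$ work.
   Context: For a string $s$, $\mathrm{chars}_h(s)$ denotes the machine word consisting of the $w$ characters $s[h+1..h+w]$ (most significant first, padded with the terminator $0$), compared as integers; $\mathrm{lcp}$ is the longest common prefix length. One step of super scalar string sample sort (S$^5$) on $\mathcal S=\{s_1,\dots,s_n\}$ with common prefix $h$: draw a random sample of $a=\alpha v+\alpha-1$ words $\mathrm{chars}_h(s)$, sort it, choose $v$ splitters $x_0\le\dots\le x_{v-1}$ (every $\alpha$-th sample element), store them as a perfect binary search tree in level order in an array $t$ and also in sorted order, and compute the LCPs of consecutive splitters. Each string $s_j$ is classified by $c=\mathrm{chars}_h(s_j)$: starting with $i=1$, repeat $\log_2(v+1)$ times $i:=2i+[c\le t_i]$; then $i:=i-v+1$ and bucket $m=2i$, incremented by one if $c$ equals splitter $x_i$; the bucket number $o_j\in\{0,\dots,2v\}$ is stored. Then bucket sizes of the $2v+1$ buckets are counted, prefix sums computed, and the strings are redistributed (out of place) into bucket order. In the parallel version each processor handles $n/p$ strings, keeps its own $2v+1$ bucket counters, a global prefix sum over all $p(2v+1)$ counters determines output positions, and each processor redistributes its strings independently.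
   Formalization: The classification is corrected to i:=2i+[c>t_i], then i:=i−(v+1), with equality to x_i tested only for i<v; log v is read as log(v+1) with v≥1; a machine word is assumed large enough to hold addresses of size C(n+pv). -}

module Defs where

open import Data.Bool.Base using (Bool; if_then_else_; _∧_)
open import Data.Fin.Base using (Fin; toℕ; fromℕ<)
import Data.Fin.Properties as Fin
open import Data.List.Base
  using (List; []; _∷_; [_]; _++_; _∷ʳ_; map; foldl; take; drop; replicate;
         length; filter; upTo; allFin)
open import Data.List.Relation.Binary.Permutation.Propositional using (_↭_)
open import Data.Nat.Base
open import Data.Nat.DivMod using (_/_; _%_)
open import Data.Nat.ListAction using (sum)
open import Data.Nat.Logarithm using (⌊log₂_⌋)
open import Data.Nat.Properties using (_≟_; _≤?_; _<?_; m^n≢0; ≤-totalOrder)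
open import Data.List.Relation.Unary.Sorted.TotalOrder ≤-totalOrder using (Sorted)
open import Data.Product.Base using (∃-syntax; _×_)
open import Relation.Binary.PropositionalEquality using (_≡_; _≢_)
open import Relation.Nullary.Decidable using (does; _×-dec_; yes; no)

------------------------------------------------------------------------
-- Word arithmetic

mod2^ : ℕ → ℕ → ℕ
mod2^ B x = _%_ x (2 ^ B) {{m^n≢0 2 B}}

div2^ : ℕ → ℕ → ℕ
div2^ B x = _/_ x (2 ^ B) {{m^n≢0 2 B}}

[_]ᵇ : Bool → ℕ
[ b ]ᵇ = if b then 1 else 0

-- Division by zero yields 0.
quotient : ℕ → ℕ → ℕ
quotient x zero      = 0
quotient x y@(suc _) = x / y

bitXor : (B : ℕ) → ℕ → ℕ → ℕ
bitXor zero    x y = 0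
bitXor (suc B) x y = (x % 2 + y % 2) % 2 + 2 * bitXor B (x / 2) (y / 2)

leadingZeros : (B : ℕ) → ℕ → ℕ
leadingZeros B zero      = B
leadingZeros B x@(suc _) = B ∸ suc ⌊log₂ x ⌋

data Op : Set where
  add sub mul quo xor leq eql : Op

-- Results are reduced modulo 2^B by the machine (see `effect`);
-- subtraction is truncated at 0 and comparisons return 0 or 1.
apply : (B : ℕ) → Op → ℕ → ℕ → ℕ
apply B add x y = x + y
apply B sub x y = x ∸ y
apply B mul x y = x * y
apply B quo x y = quotient x y
apply B xor x y = bitXor B x y
apply B leq x y = [ does (x ≤? y) ]ᵇ
apply B eql x y = [ does (x ≟ y) ]ᵇ

------------------------------------------------------------------------
-- A synchronous CREW PRAM over B-bit words.
--
-- One instruction stream drives p processors in lock step.  The control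
-- unit has its own registers, steers loops and branches, and in each time
-- step either executes one instruction itself or lets the processors
-- 0, …, k-1 execute one instruction simultaneously, for some k ≤ p.
-- Time is the number of steps; work is the number of instructions executed,
-- so a processor that is idle in a step does not contribute to the work.
-- This is the single-instruction form of the PRAM: processors following
-- different instruction streams could only make upper bounds easier.

data Agent : Set where
  control processor : Agent

Reg : Set
Reg = ℕ

data Operand : Agent → Set where
  imm : ∀ {u} → ℕ → Operand u
  ctl : ∀ {u} → Reg → Operand u          -- control register, readable by all
  loc : Reg → Operand processor          -- the processor's own register
  pid : Operand processor

-- `chars r j i` loads the w characters of string j that follow its first i
-- characters; `draw r k` fetches the k-th random number.  `when g c` performs
-- c if g ≠ 0 and nothing otherwise, at unit cost in both cases.  The first
-- argument of the others is a destination register of the executing agent,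
-- except for `store address value`.
data Instr (u : Agent) : Set where
  op    : Reg → Op → Operand u → Operand u → Instr u
  clz   : Reg → Operand u → Instr u
  load  : Reg → Operand u → Instr u
  store : Operand u → Operand u → Instr u
  chars : Reg → Operand u → Operand u → Instr u
  draw  : Reg → Operand u → Instr u
  when  : Operand u → Instr u → Instr u

infixr 5 _⨟_

data Prog : Set where
  skip  : Prog
  exec  : Instr control → Prog
  par   : Operand control → Instr processor → Prog
  _⨟_   : Prog → Prog → Prog
  cond  : Operand control → Prog → Prog → Prog
  while : Operand control → Prog → Prog

record Env : Set where
  field
    width    : ℕ
    procs    : ℕ
    charWord : ℕ → ℕ → ℕ
    random   : ℕ → ℕ

record State : Set where
  constructor ⟨_,_,_⟩
  field
    control-regs : Reg → ℕ
    local-regs   : ℕ → Reg → ℕ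
    memory       : ℕ → ℕ

open State public

data Effect : Set where
  none  : Effect
  toReg : Reg → ℕ → Effect
  toMem : ℕ → ℕ → Effect

_[_↦_] : (ℕ → ℕ) → ℕ → ℕ → (ℕ → ℕ)
(f [ a ↦ x ]) b = if does (a ≟ b) then x else f b

writeReg : Effect → (Reg → ℕ) → (Reg → ℕ)
writeReg (toReg r x) f = f [ r ↦ x ]
writeReg none        f = f
writeReg (toMem _ _) f = f

writeMem : Effect → (ℕ → ℕ) → (ℕ → ℕ)
writeMem (toMem a x) m = m [ a ↦ x ]
writeMem none        m = m
writeMem (toReg _ _) m = m

-- The order of the writes is immaterial when they are exclusive.
writeMems : ℕ → (ℕ → Effect) → (ℕ → ℕ) → (ℕ → ℕ)
writeMems zero    e m = m
writeMems (suc k) e m = writeMem (e k) (writeMems k e m)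

ExclusiveWrites : ℕ → (ℕ → Effect) → Set
ExclusiveWrites k e = ∀ {q q′ a x y} → q < k → q′ < k →
  e q ≡ toMem a x → e q′ ≡ toMem a y → q ≡ q′

module Machine (E : Env) where
  open Env E

  controlValue : State → Operand control → ℕ
  controlValue s (imm x) = mod2^ width x
  controlValue s (ctl r) = control-regs s r

  localValue : State → ℕ → Operand processor → ℕ
  localValue s q (imm x) = mod2^ width x
  localValue s q (ctl r) = control-regs s r
  localValue s q (loc r) = local-regs s q r
  localValue s q pid     = mod2^ width q

  effect : ∀ {u} → (Operand u → ℕ) → (ℕ → ℕ) → Instr u → Effect
  effect val m (op r f x y)  = toReg r (mod2^ width (apply width f (val x) (val y)))
  effect val m (clz r x)     = toReg r (mod2^ width (leadingZeros width (val x)))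
  effect val m (load r a)    = toReg r (m (val a))
  effect val m (store a x)   = toMem (val a) (val x)
  effect val m (chars r j i) = toReg r (mod2^ width (charWord (val j) (val i)))
  effect val m (draw r k)    = toReg r (mod2^ width (random (val k)))
  effect val m (when g c) with val g
  ... | zero  = none
  ... | suc _ = effect val m c

  controlEffect : Instr control → State → Effect
  controlEffect c s = effect (controlValue s) (memory s) c

  localEffect : Instr processor → State → ℕ → Effect
  localEffect c s q = effect (localValue s q) (memory s) c

  controlStep : Instr control → State → State
  controlStep c s = let e = controlEffect c s in
    ⟨ writeReg e (control-regs s) , local-regs s , writeMem e (memory s) ⟩

  parStep : ℕ → Instr processor → State → State
  parStep k c s = let e = localEffect c s in
    ⟨ control-regs s
    , (λ q → if does (q <? k) then writeReg (e q) (local-regs s q)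
                              else local-regs s q)
    , writeMems k e (memory s) ⟩

  -- Run c s s′ t w: started in s, program c halts in s′ after t time steps
  -- and w units of work, and no two processors ever write the same cell in
  -- the same step.
  data Run : Prog → State → State → ℕ → ℕ → Set where
    run-skip : ∀ {s} → Run skip s s 0 0

    run-exec : ∀ {c s} → Run (exec c) s (controlStep c s) 1 1

    run-par : ∀ {k c s} →
      controlValue s k ≤ procs →
      ExclusiveWrites (controlValue s k) (localEffect c s) →
      Run (par k c) s (parStep (controlValue s k) c s) 1 (controlValue s k)

    run-seq : ∀ {c₁ c₂ s s′ s″ t₁ t₂ w₁ w₂} →
      Run c₁ s s′ t₁ w₁ → Run c₂ s′ s″ t₂ w₂ →
      Run (c₁ ⨟ c₂) s s″ (t₁ + t₂) (w₁ + w₂)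

    run-cond-true : ∀ {x c₁ c₂ s s′ t w} →
      controlValue s x ≢ 0 → Run c₁ s s′ t w →
      Run (cond x c₁ c₂) s s′ (suc t) (suc w)

    run-cond-false : ∀ {x c₁ c₂ s s′ t w} →
      controlValue s x ≡ 0 → Run c₂ s s′ t w →
      Run (cond x c₁ c₂) s s′ (suc t) (suc w)

    run-while-true : ∀ {x c s s′ s″ t₁ t₂ w₁ w₂} →
      controlValue s x ≢ 0 → Run c s s′ t₁ w₁ → Run (while x c) s′ s″ t₂ w₂ →
      Run (while x c) s s″ (suc (t₁ + t₂)) (suc (w₁ + w₂))

    run-while-false : ∀ {x c s} →
      controlValue s x ≡ 0 → Run (while x c) s s 1 1

------------------------------------------------------------------------
-- Strings and words of characters

-- The characters are 1, …, σ; 0 is the terminator.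
Str : ℕ → Set
Str σ = List (Fin σ)

codes : ∀ {σ} → Str σ → List ℕ
codes = map (λ c → suc (toℕ c))

-- s[h+1..h+w], padded with the terminator.
window : ∀ {σ} → (w h : ℕ) → Str σ → List ℕ
window w h s = take w (drop h (codes s) ++ replicate w 0)

-- Characters of b bits each, most significant first.
pack : (b : ℕ) → List ℕ → ℕ
pack b = foldl (λ x c → x * 2 ^ b + c) 0

unpack : (b w : ℕ) → ℕ → List ℕ
unpack b zero    x = []
unpack b (suc w) x = unpack b w (div2^ b x) ∷ʳ mod2^ b x

lcp : List ℕ → List ℕ → ℕ
lcp (x ∷ xs) (y ∷ ys) = if does (x ≟ y) then suc (lcp xs ys) else 0
lcp _        _        = 0

------------------------------------------------------------------------
-- Instances of one step of super scalar string sample sort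

record Instance (α : ℕ) : Set where
  field
    n p d h : ℕ
    w σ b B : ℕ      -- characters per word, alphabet size, bits per character and word

  v : ℕ
  v = 2 ^ d ∸ 1

  a : ℕ
  a = α * v + (α ∸ 1)

  -- `draws` is the outcome of the random choices: the k-th sampled string
  -- has index draws k.
  field
    strings : Fin n → Str σ
    draws   : Fin a → Fin n

    ⦃ p≢0 ⦄ : NonZero p
    1≤d     : 1 ≤ d
    1≤w     : 1 ≤ w
    1≤b     : 1 ≤ b
    σ<2^b   : σ < 2 ^ b
    w-fits  : w * b ≤ B
    h-fits  : h < 2 ^ B
    h≤len   : ∀ i → h ≤ length (strings i)
    common  : ∀ i j → take h (strings i) ≡ take h (strings j)

  charsOf : ℕ → Fin n → ℕ
  charsOf i j = pack b (window w i (strings j))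

  env : Env
  env = record
    { width    = B
    ; procs    = p
    ; charWord = charWord′
    ; random   = random′
    }
    where
    charWord′ : ℕ → ℕ → ℕ
    charWord′ j i with j <? n
    ... | yes j<n = charsOf i (fromℕ< j<n)
    ... | no  _   = 0

    random′ : ℕ → ℕ
    random′ k with k <? a
    ... | yes k<a = toℕ (draws (fromℕ< k<a))
    ... | no  _   = 0

  parameters : Reg → ℕ
  parameters 0 = n
  parameters 1 = p
  parameters 2 = d
  parameters 3 = v
  parameters 4 = α
  parameters 5 = h
  parameters 6 = w
  parameters 7 = b
  parameters 8 = B
  parameters _ = 0

  -- The input array of string references occupies the cells 0, …, n-1.
  initial : State
  initial = ⟨ parameters , (λ _ _ → 0) , (λ i → if does (i <? n) then i else 0) ⟩

------------------------------------------------------------------------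
-- The result of the step

-- In-order traversal of the perfect binary tree of depth d rooted at node i
-- of an array in level order.
inorder : (ℕ → ℕ) → (d i : ℕ) → List ℕ
inorder t zero    i = []
inorder t (suc d) i = inorder t d (2 * i) ++ [ t i ] ++ inorder t d (2 * i + 1)

-- The left subtree holds the smaller splitters, so the right child is taken
-- exactly when c exceeds the splitter at the node.
descend : (ℕ → ℕ) → ℕ → (d i : ℕ) → ℕ
descend t c zero    i = i
descend t c (suc d) i = descend t c d (2 * i + [ does (t i <? c) ]ᵇ)

-- After d = log₂ (v + 1) steps i lies in {v + 1, …, 2v + 1}.  There is no
-- splitter x_v, so the last leaf has no equality bucket.
bucket : (x t : ℕ → ℕ) (d v c : ℕ) → ℕ
bucket x t d v c =
  let i = descend t c d 1 ∸ (v + 1)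
  in  2 * i + [ does (i <? v) ∧ does (c ≟ x i) ]ᵇ

module _ {α : ℕ} (I : Instance α) where
  open Instance I

  -- In the final state s, control registers 0, …, 7 hold the addresses of the
  -- result arrays.
  module Result (s : State) where
    array : Reg → ℕ → ℕ
    array r i = memory s (control-regs s r + i)

    sample splitter tree lcps oracle counter prefix output : ℕ → ℕ
    sample   = array 0
    splitter = array 1
    tree     = array 2      -- the root is tree 1
    lcps     = array 3
    oracle   = array 4
    counter  = array 5      -- bucket m of processor q at index m * p + q
    prefix   = array 6      -- indexed like counter
    output   = array 7

    handled : (owner : Fin n → Fin p) → ℕ → Fin p → List (Fin n)
    handled owner m q =
      filter (λ j → (owner j Fin.≟ q) ×-dec (oracle (toℕ j) ≟ m)) (allFin n)

    record StepDone : Set where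
      field
        sample-drawn  : map sample (upTo a) ↭ map (λ k → charsOf h (draws k)) (allFin a)
        sample-sorted : Sorted (map sample (upTo a))

        splitters : ∀ {i} → i < v → splitter i ≡ sample (α * i + (α ∸ 1))

        tree-inorder : inorder tree d 1 ≡ map splitter (upTo v)

        splitter-lcps : ∀ {i} → suc i < v →
          lcps (suc i) ≡ lcp (unpack b w (splitter i)) (unpack b w (splitter (suc i)))

        classified : ∀ j → oracle (toℕ j) ≡ bucket splitter tree d v (charsOf h j)

        -- The distribution of the strings over the processors.
        owner : Fin n → Fin p

        balanced : ∀ q →
          length (filter (λ j → owner j Fin.≟ q) (allFin n)) ≤ (n + (p ∸ 1)) / p

        counted : ∀ {m} → m < 2 * v + 1 → (q : Fin p) →
          counter (m * p + toℕ q) ≡ length (handled owner m q)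

        -- Exclusive prefix sums, bucket by bucket: the output position of the
        -- first string that processor q puts into bucket m.
        prefix-sums : ∀ {k} → k < (2 * v + 1) * p →
          prefix k ≡ sum (map counter (upTo k))

        output-permutes : map output (upTo n) ↭ upTo n

        redistributed : ∀ {m} → m < 2 * v + 1 → (q : Fin p) →
          ∀ {i} → i < counter (m * p + toℕ q) →
          ∃[ j ] output (prefix (m * p + toℕ q) + i) ≡ toℕ j
               × owner j ≡ q × oracle (toℕ j) ≡ m

  -- For the outcome `draws` of the random choices, the program performs the
  -- step on I within the given time and work.
  PerformsStep : Prog → (time work : ℕ) → Set
  PerformsStep c time work =
    ∃[ s ] ∃[ t ] ∃[ u ]
      Machine.Run env c initial s t u × Result.StepDone s × t ≤ time × u ≤ work

{-# OPTIONS --safe #-}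
module Submission where

-- The sample is sorted by bottom-up merging, A / p keys per processor and level;
-- as v = O(n), this takes O((n / p) log v + v) time.  LCPs of splitters are leading
-- zeros of exclusive ors.  Every processor classifies ⌈n / p⌉ consecutive
-- strings, and its output positions come from the prefix sums of all counters:
-- each processor scans 2v + 2 consecutive counters, and a balanced tree over the
-- processors combines their totals in O(log p) time.  String j of key
-- k = (bucket, processor) lands at the number of strings with key below k plus its rank
-- among the strings of key k, which is a bijection.
--
-- Within a block of parallel code every memory cell is either owned by one
-- processor or read-only, so writes are exclusive and a block can be verified for
-- one processor at a time.

open import Defs
open import Data.Bool.Base using (true; false; if_then_else_; _∧_) renaming (T to IsTrue)
open import Data.Fin.Base using (Fin; toℕ; fromℕ<) renaming (zero to fzero; suc to fsuc)
import Data.Fin.Properties as Fin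
open import Data.Fin.Properties using (toℕ<n; toℕ-fromℕ<; fromℕ<-toℕ; toℕ-injective)
open import Data.List.Base
  using (List; []; _∷_; [_]; _++_; _∷ʳ_; length; map; filter; merge; replicate; take; drop; foldl;
         applyUpTo; upTo; allFin; tabulate)
open import Data.List.Membership.Propositional using (_∈_)
open import Data.List.Properties
  using (length-++; length-take; length-replicate; length-filter; ++-identityʳ; filter-++; filter-all;
         filter-none; map-tabulate; tabulate-cong; map-cong; map-id; map-upTo)
open import Data.List.Relation.Binary.Permutation.Propositional
  using (_↭_; ↭-refl; ↭-trans; ↭-sym; ↭-reflexive; prep)
open import Data.List.Relation.Binary.Permutation.Propositional.Properties
  using (++⁺; shift; merge-↭; drop-∷; ↭-length; ∈-resp-↭; All-resp-↭)
open import Data.List.Relation.Unary.All using (All; []; _∷_)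
import Data.List.Relation.Unary.All as All
import Data.List.Relation.Unary.All.Properties as Allₚ
open import Data.List.Relation.Unary.AllPairs using (AllPairs)
open import Data.List.Relation.Unary.Any using (here; there)
import Data.List.Relation.Unary.Linked as Linked
open import Data.List.Relation.Unary.Linked.Properties using (Linked⇒AllPairs)
open import Data.List.Relation.Unary.Sorted.TotalOrder.Properties using (merge⁺)
open import Data.Maybe.Base using (Maybe; just; nothing)
open import Data.Nat.Base
open import Data.Nat.DivMod
  using (_/_; _%_; m≡m%n+[m/n]*n; m%n<n; m<n⇒m%n≡m; m/n*n≤m; m*n/n≡m; m/n≤m; m/n/o≡m/[n*o]; n/1≡n;
         0/n≡0; m<n*o⇒m/o<n; /-congˡ; /-monoˡ-≤)
open import Data.Nat.ListAction using (sum)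
open import Data.Nat.ListAction.Properties using (sum-++)
open import Data.Nat.Logarithm
  using (⌊log₂_⌋; ⌈log₂_⌉; ⌊log₂⌋-mono-≤; ⌊log₂⌊n/2⌋⌋≡⌊log₂n⌋∸1; ⌊log₂[2^n]⌋≡n; ⌈log₂⌉-mono-≤; ⌈log₂2^n⌉≡n)
open import Data.Nat.Properties
open import Data.List.Relation.Unary.Sorted.TotalOrder ≤-totalOrder using (Sorted)
open import Data.Nat.Tactic.RingSolver using (solve-∀)
open import Data.Product.Base using (∃-syntax; _×_; _,_; proj₁; proj₂)
open import Data.Sum.Base using (_⊎_; inj₁; inj₂; [_,_]′)
open import Function.Base using (_∘_; id; case_of_)
open import Relation.Binary.PropositionalEquality hiding ([_])
open import Relation.Nullary using (¬_; Dec; yes; no; does; contradiction)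
open import Relation.Nullary.Decidable using (dec-true; dec-false; _×-dec_)
open import Relation.Unary using (Decidable)

-- Register files and two-dimensional memory

-- One instruction stream drives all processors, so the duration of a block may not depend on data:
-- the only branch is `when`, of unit cost, and loop counts sit in control registers. Uneven loads
-- are therefore padded. Positions beyond the last string get a bucket of their own, missing
-- processors become leaves of sum 0, and surplus merges fill the last round of a level. Runs are
-- merged pair by pair, each pair by one processor, so the late levels of the sort are hardly
-- parallel. Yet the run lengths form a geometric series, which adds only O(A) = O(v) to the time.
-- Rounding n / p up costs one more string per processor, hence O(d) steps, and d ≤ 2 ^ d - 1 = v
-- absorbs them. The machine reduces every result modulo 2 ^ B. Indices, counts and addresses are at
-- most 15 U < 2 ^ B, and words of characters are below 2 ^ (w b), so that no reduction takes
-- effect. Register contents are tracked as lists with symbolic entries at concrete positions.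
-- Lookups and updates then compute, and most obligations of the symbolic execution close by `refl`;
-- what remains are bounds and loop invariants.

get : List ℕ → ℕ → Maybe ℕ
get []       _       = nothing
get (x ∷ σ) zero    = just x
get (x ∷ σ) (suc r) = get σ r

set : List ℕ → ℕ → ℕ → List ℕ
set []      _       z = []
set (x ∷ σ) zero    z = z ∷ σ
set (x ∷ σ) (suc r) z = x ∷ set σ r z

infix 4 _⊩_

-- Partial knowledge: nothing is claimed about registers beyond the length of the list, which leaves
-- room for loop counters above it.
record _⊩_ (ρ : Reg → ℕ) (σ : List ℕ) : Set where
  constructor agree
  field
    at : ∀ r {x} → get σ r ≡ just x → ρ r ≡ x

open _⊩_ public

updated-same : ∀ (f : ℕ → ℕ) a {x} → (f [ a ↦ x ]) a ≡ x
updated-same f a rewrite dec-true (a ≟ a) refl = refl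

updated-other : ∀ (f : ℕ → ℕ) {a b x} → a ≢ b → (f [ a ↦ x ]) b ≡ f b
updated-other f {a} {b} a≢b rewrite dec-false (a ≟ b) a≢b = refl

get-set-same : ∀ σ r {z x} → get (set σ r z) r ≡ just x → x ≡ z
get-set-same (_ ∷ σ) zero    refl = refl
get-set-same (_ ∷ σ) (suc r) eq   = get-set-same σ r eq

get-set-other : ∀ σ r r′ {z} → r ≢ r′ → get (set σ r z) r′ ≡ get σ r′
get-set-other []      _       _        _ = refl
get-set-other (_ ∷ σ) zero    zero     r≢r′ = contradiction refl r≢r′
get-set-other (_ ∷ σ) zero    (suc r′) _ = refl
get-set-other (_ ∷ σ) (suc r) zero     _ = refl
get-set-other (_ ∷ σ) (suc r) (suc r′) r≢r′ = get-set-other σ r r′ (r≢r′ ∘ cong suc)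

⊩-set : ∀ {ρ σ} r z → ρ ⊩ σ → (ρ [ r ↦ z ]) ⊩ set σ r z
⊩-set {ρ} {σ} r z ρ⊩σ .at r′ eq with r ≟ r′
... | yes refl = trans (updated-same ρ r) (sym (get-set-same σ r eq))
... | no r≢r′  = trans (updated-other ρ r≢r′)
                       (ρ⊩σ .at r′ (trans (sym (get-set-other σ r r′ r≢r′)) eq))

get-< : ∀ σ r {x} → get σ r ≡ just x → r < length σ
get-< (_ ∷ σ) zero    _  = z<s
get-< (_ ∷ σ) (suc r) eq = s<s (get-< σ r eq)

Mem : Set
Mem = ℕ → ℕ → ℕ

-- The array number is compared before the index, so that for numerals an update of a different
-- array vanishes by computation.
upd : Mem → ℕ → ℕ → ℕ → Mem
upd M k i x k′ = if does (k ≟ k′) then M k [ i ↦ x ] else M k′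

upd-same : ∀ M k i {x} → upd M k i x k i ≡ x
upd-same M k i rewrite dec-true (k ≟ k) refl = updated-same (M k) i

upd-index : ∀ M k i {x i′} → i ≢ i′ → upd M k i x k i′ ≡ M k i′
upd-index M k i i≢i′ rewrite dec-true (k ≟ k) refl = updated-other (M k) i≢i′

upd-other : ∀ M {k i x k′ i′} → ¬ (k ≡ k′ × i ≡ i′) → upd M k i x k′ i′ ≡ M k′ i′
upd-other M {k} {i} {x} {k′} {i′} ≢ with k ≟ k′
... | yes refl = upd-index M k i (λ eq → ≢ (refl , eq))
... | no k≢k′ rewrite dec-false (k ≟ k′) k≢k′ = refl

-- Uniqueness of quotient and remainder. Besides separating arrays of `U` cells, it is applied with
-- `p` for `U`, to recover bucket and processor from a counter index `m * p + q`.
cell-injective : ∀ {U k i k′ i′} → i < U → i′ < U → k * U + i ≡ k′ * U + i′ → k ≡ k′ × i ≡ i′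
cell-injective {U} {zero} {i} {zero} {i′} _ _ eq = refl , eq
cell-injective {U} {zero} {i} {suc k′} {i′} i<U _ eq = contradiction i<U (≤⇒≯
  (subst (U ≤_) (sym eq) (≤-trans (m≤m+n U (k′ * U)) (m≤m+n _ i′))))
cell-injective {U} {suc k} {i} {zero} {i′} _ i′<U eq = contradiction i′<U (≤⇒≯
  (subst (U ≤_) eq (≤-trans (m≤m+n U (k * U)) (m≤m+n _ i))))
cell-injective {U} {suc k} {i} {suc k′} {i′} i<U i′<U eq
  with cell-injective {U} {k} {i} {k′} {i′} i<U i′<U
         (+-cancelˡ-≡ U _ _ (trans (sym (+-assoc U (k * U) i)) (trans eq (+-assoc U (k′ * U) i′))))
... | refl , refl = refl , refl

-- Simultaneous writes

writeMems-miss : ∀ k (e : ℕ → Effect) m {a} →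
  (∀ {q x} → q < k → e q ≢ toMem a x) → writeMems k e m a ≡ m a
writeMems-miss zero e m _ = refl
writeMems-miss (suc k) e m {a} miss
  with e k in eq | writeMems-miss k e m (λ q<k → miss (m<n⇒m<1+n q<k))
... | none      | ih = ih
... | toReg _ _ | ih = ih
... | toMem b x | ih = trans (updated-other (writeMems k e m) {b} {a} b≢a) ih
  where
  b≢a : b ≢ a
  b≢a refl = miss (n<1+n k) eq

-- The writes are applied in the order of the processors, so a later one could overwrite the cell;
-- exclusivity rules out every other writer.
writeMems-hit : ∀ k (e : ℕ → Effect) m {q a x} → ExclusiveWrites k e →
  q < k → e q ≡ toMem a x → writeMems k e m a ≡ x
writeMems-hit (suc k) e m {q} {a} {x} exclusive q<1+k eq with q ≟ k
... | yes refl rewrite eq = updated-same (writeMems k e m) a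
... | no q≢k with e k in eqk | writeMems-hit k e m {q} {a} {x}
                (λ q<k q′<k → exclusive (m<n⇒m<1+n q<k) (m<n⇒m<1+n q′<k))
                (≤∧≢⇒< (≤-pred q<1+k) q≢k) eq
... | none      | ih = ih
... | toReg _ _ | ih = ih
... | toMem b y | ih = trans (updated-other (writeMems k e m) {b} {a} b≢a) ih
  where
  b≢a : b ≢ a
  b≢a refl = q≢k (exclusive q<1+k (n<1+n k) eq eqk)

mod2^-small : ∀ B {x} → x < 2 ^ B → mod2^ B x ≡ x
mod2^-small B x<2^B = m<n⇒m%n≡m {{m^n≢0 2 B}} x<2^B

toMem-address : ∀ {a b x y} → toMem a x ≡ toMem b y → a ≡ b
toMem-address refl = refl

-- Blocks executed in lock step by N processors

infixr 5 _⨾_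

data Code : Set where
  ins : Instr processor → Code
  _⨾_ : Code → Code → Code
  rep : Reg → Code → Code

-- A loop of nesting depth ℓ counts in its own register, which no block uses;
-- registers 9 and 10 hold 0 and 1.
loopReg : ℕ → Reg
loopReg ℓ = 50 + ℓ

compile : Reg → ℕ → Code → Prog
compile k ℓ (ins i) = par (ctl k) i
compile k ℓ (c ⨾ d) = compile k ℓ c ⨟ compile k ℓ d
compile k ℓ (rep x c) =
  exec (op (loopReg ℓ) add (ctl x) (ctl 9)) ⨟
  while (ctl (loopReg ℓ))
    (compile k (suc ℓ) c ⨟ exec (op (loopReg ℓ) sub (ctl (loopReg ℓ)) (ctl 10)))

count : List ℕ → Reg → ℕ
count K x with get K x
... | just n  = n
... | nothing = 0

count-just : ∀ K x {n} → get K x ≡ just n → n ≡ count K x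
count-just K x eq with get K x | eq
... | just _ | refl = refl

-- A loop pays 2 steps for setting its counter and for the last, failing test, and 2 more per
-- iteration for the test and the decrement.
duration : List ℕ → Code → ℕ
duration K (ins _)   = 1
duration K (c ⨾ d)   = duration K c + duration K d
duration K (rep x c) = 2 + count K x * (duration K c + 2)

iteration-time : ∀ n T → suc ((T + 1) + (1 + n * (T + 2))) ≡ 1 + suc n * (T + 2)
iteration-time = solve-∀

-- A control step costs 1 unit of work rather than `N`. The summand `1 * 2` collects the two control
-- steps of an iteration; as `0 < N`, it may grow to `N * 2`, which yields work at most `N` times
-- the duration.
iteration-work₁ : ∀ N n T →
  suc ((N * T + 1) + N * (1 + n * (T + 2))) ≡ N * T + N * (1 + n * (T + 2)) + 1 * 2
iteration-work₁ = solve-∀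

iteration-work₂ : ∀ N n T →
  N * T + N * (1 + n * (T + 2)) + N * 2 ≡ N * (1 + suc n * (T + 2))
iteration-work₂ = solve-∀

module Simulation (E : Env) (U : ℕ) where
  open Env E
  open Machine E

  cells : State → Mem
  cells s k i = memory s (k * U + i)

  module Lockstep (N : ℕ) (K : List ℕ) (Own : ℕ → ℕ → ℕ → Set) (R : Mem) where

    Shared : ℕ → ℕ → Set
    Shared k i = ∀ {q} → q < N → ¬ Own q k i

    -- An immediate has no value here, since the machine would reduce it modulo 2 ^ width; the
    -- program takes its constants from registers.
    value : ℕ → List ℕ → Operand processor → Maybe ℕ
    value q σ (imm x) = nothing
    value q σ (ctl r) = get K r
    value q σ (loc r) = get σ r
    value q σ pid     = just q

    -- Every cell has at most one owner, which alone may access it, or is shared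
    -- and keeps its initial contents R; hence the processors can be run one by one.
    data Step (q : ℕ) : Instr processor → List ℕ → Mem → List ℕ → Mem → Set where
      op : ∀ {r f x y a b z σ M} → value q σ x ≡ just a → value q σ y ≡ just b →
        apply width f a b ≡ z → z < 2 ^ width → Step q (op r f x y) σ M (set σ r z) M
      clz : ∀ {r x a z σ M} → value q σ x ≡ just a →
        leadingZeros width a ≡ z → z < 2 ^ width → Step q (clz r x) σ M (set σ r z) M
      load-shared : ∀ {r x a k i z σ M} → value q σ x ≡ just a →
        a ≡ k * U + i → i < U → Shared k i → R k i ≡ z → Step q (load r x) σ M (set σ r z) M
      load-own : ∀ {r x a k i z σ M} → value q σ x ≡ just a →
        a ≡ k * U + i → i < U → Own q k i → M k i ≡ z → Step q (load r x) σ M (set σ r z) M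
      store : ∀ {x y a k i z σ M} → value q σ x ≡ just a → value q σ y ≡ just z →
        a ≡ k * U + i → i < U → Own q k i → Step q (store x y) σ M σ (upd M k i z)
      chars : ∀ {r x y j i z σ M} → value q σ x ≡ just j → value q σ y ≡ just i →
        charWord j i ≡ z → z < 2 ^ width → Step q (chars r x y) σ M (set σ r z) M
      draw : ∀ {r x k z σ M} → value q σ x ≡ just k →
        random k ≡ z → z < 2 ^ width → Step q (draw r x) σ M (set σ r z) M
      when-no : ∀ {g c σ M} → value q σ g ≡ just 0 → Step q (when g c) σ M σ M
      when-yes : ∀ {g c n σ M σ′ M′} → value q σ g ≡ just (suc n) →
        Step q c σ M σ′ M′ → Step q (when g c) σ M σ′ M′

    mutual
      data Exec (q : ℕ) : Code → List ℕ → Mem → List ℕ → Mem → Set where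
        ins : ∀ {i σ M σ′ M′} → Step q i σ M σ′ M′ → Exec q (ins i) σ M σ′ M′
        _⨾_ : ∀ {c d σ M σ′ M′ σ″ M″} → Exec q c σ M σ′ M′ → Exec q d σ′ M′ σ″ M″ →
          Exec q (c ⨾ d) σ M σ″ M″
        rep : ∀ {x c n σ M σ′ M′} → get K x ≡ just n → n < 2 ^ width →
          Iter q n c σ M σ′ M′ → Exec q (rep x c) σ M σ′ M′

      data Iter (q : ℕ) : ℕ → Code → List ℕ → Mem → List ℕ → Mem → Set where
        []  : ∀ {c σ M} → Iter q 0 c σ M σ M
        _∷_ : ∀ {n c σ M σ′ M′ σ″ M″} → Exec q c σ M σ′ M′ → Iter q n c σ′ M′ σ″ M″ →
          Iter q (suc n) c σ M σ″ M″

    -- The induction passes to `P ∘ suc`, so that the derivation grows from its first iteration, as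
    -- `Iter` demands, while the invariant still counts upwards.
    iterate : ∀ {q c} n (P : ℕ → List ℕ → Mem → Set) →
      (∀ i σ M → i < n → P i σ M → ∃[ σ′ ] ∃[ M′ ] Exec q c σ M σ′ M′ × P (suc i) σ′ M′) →
      ∀ {σ M} → P 0 σ M → ∃[ σ′ ] ∃[ M′ ] Iter q n c σ M σ′ M′ × P n σ′ M′
    iterate zero    P body p = _ , _ , [] , p
    iterate (suc n) P body {σ} {M} p with body 0 σ M z<s p
    ... | σ′ , M′ , x , p′ with iterate n (P ∘ suc) (λ i σ M i<n → body (suc i) σ M (s<s i<n)) p′
    ... | σ″ , M″ , xs , p″ = σ″ , M″ , x ∷ xs , p″

  record ParallelSetup (N : ℕ) (K : List ℕ) (Own : ℕ → ℕ → ℕ → Set) : Set where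
    field
      N≤procs : N ≤ procs
      N≤2^width : N ≤ 2 ^ width
      0<N : 0 < N
      1<2^width : 1 < 2 ^ width
      zero-reg : get K 9 ≡ just 0
      one-reg : get K 10 ≡ just 1
      length-K : length K ≤ 50
      disjoint : ∀ {q q′ k i} → q < N → q′ < N → i < U → Own q k i → Own q′ k i → q ≡ q′

  module Runs {N : ℕ} {K : List ℕ} {Own : ℕ → ℕ → ℕ → Set} (setup : ParallelSetup N K Own) (R : Mem) where
    open ParallelSetup setup
    open Lockstep N K Own R

    -- Every processor has a private view `M q` of the memory, which is meaningful on its own cells
    -- only. This suffices because all other cells that it may read are shared and still hold `R`.
    record Rel (s : State) (σ : Fin N → List ℕ) (M : Fin N → Mem) : Set where
      field
        regs   : ∀ q → local-regs s (toℕ q) ⊩ σ q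
        own    : ∀ q {k i} → i < U → Own (toℕ q) k i → cells s k i ≡ M q k i
        shared : ∀ {k i} → i < U → Shared k i → cells s k i ≡ R k i
        ctls   : control-regs s ⊩ K
    open Rel

    value-correct : ∀ {s σ M} → Rel s σ M → (q : Fin N) (x : Operand processor) {a : ℕ} →
      value (toℕ q) (σ q) x ≡ just a → localValue s (toℕ q) x ≡ a
    value-correct rel q (ctl r) eq = ctls rel .at r eq
    value-correct rel q (loc r) eq = regs rel q .at r eq
    value-correct rel q pid refl = mod2^-small width (<-≤-trans (toℕ<n q) N≤2^width)

    -- Reduces all instructions to the three kinds of effects, so that the preservation of `Rel`
    -- needs one proof instead of one per instruction.
    data Outcome (q : ℕ) (e : Effect) (σ : List ℕ) (M : Mem) (σ′ : List ℕ) (M′ : Mem) : Set where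
      quiet : e ≡ none → σ′ ≡ σ → M′ ≡ M → Outcome q e σ M σ′ M′
      reg   : ∀ r z → e ≡ toReg r z → σ′ ≡ set σ r z → M′ ≡ M → Outcome q e σ M σ′ M′
      mem   : ∀ k i z → e ≡ toMem (k * U + i) z → i < U → Own q k i →
        σ′ ≡ σ → M′ ≡ upd M k i z → Outcome q e σ M σ′ M′

    outcome : ∀ {s σ M σ′ M′ c} → Rel s σ M → (q : Fin N) →
      Step (toℕ q) c (σ q) (M q) σ′ M′ →
      Outcome (toℕ q) (localEffect c s (toℕ q)) (σ q) (M q) σ′ M′
    outcome rel q (op {x = x} {y = y} vx vy refl z<)
      rewrite value-correct rel q x vx | value-correct rel q y vy
      = reg _ _ (cong (toReg _) (mod2^-small width z<)) refl refl
    outcome rel q (clz {x = x} vx refl z<)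
      rewrite value-correct rel q x vx = reg _ _ (cong (toReg _) (mod2^-small width z<)) refl refl
    outcome rel q (load-shared {x = x} vx refl i<U sh refl)
      rewrite value-correct rel q x vx = reg _ _ (cong (toReg _) (shared rel i<U sh)) refl refl
    outcome rel q (load-own {x = x} vx refl i<U own′ refl)
      rewrite value-correct rel q x vx = reg _ _ (cong (toReg _) (own rel q i<U own′)) refl refl
    outcome rel q (store {x = x} {y = y} vx vy refl i<U own′)
      rewrite value-correct rel q x vx | value-correct rel q y vy = mem _ _ _ refl i<U own′ refl refl
    outcome rel q (chars {x = x} {y = y} vx vy refl z<)
      rewrite value-correct rel q x vx | value-correct rel q y vy
      = reg _ _ (cong (toReg _) (mod2^-small width z<)) refl refl
    outcome rel q (draw {x = x} vx refl z<)
      rewrite value-correct rel q x vx = reg _ _ (cong (toReg _) (mod2^-small width z<)) refl refl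
    outcome {s} rel q (when-no {g = g} vg)
      rewrite value-correct rel q g vg = quiet refl refl refl
    outcome {s} rel q (when-yes {g = g} vg step)
      rewrite value-correct rel q g vg = outcome rel q step

    module _ {s : State} {c : Instr processor} {σ σ′ : Fin N → List ℕ} {M M′ : Fin N → Mem}
      (rel : Rel s σ M)
      (outs : ∀ q → Outcome (toℕ q) (localEffect c s (toℕ q)) (σ q) (M q) (σ′ q) (M′ q))
      where
      private
        e = localEffect c s

        outs< : ∀ {q} (q<N : q < N) →
          Outcome q (e q) (σ (fromℕ< q<N)) (M (fromℕ< q<N)) (σ′ (fromℕ< q<N)) (M′ (fromℕ< q<N))
        outs< q<N = subst (λ r → Outcome r (e r) (σ (fromℕ< q<N)) (M (fromℕ< q<N)) (σ′ (fromℕ< q<N)) (M′ (fromℕ< q<N))) (toℕ-fromℕ< q<N) (outs (fromℕ< q<N))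

      writes-owned : ∀ {q a x} → q < N → e q ≡ toMem a x →
        ∃[ k ] ∃[ i ] a ≡ k * U + i × i < U × Own q k i
      writes-owned q<N eq with outs< q<N
      ... | quiet eq′ _ _ = case trans (sym eq′) eq of λ ()
      ... | reg _ _ eq′ _ _ = case trans (sym eq′) eq of λ ()
      ... | mem k i _ eq′ i<U own′ _ _ with trans (sym eq′) eq
      ... | refl = k , i , refl , i<U , own′

      -- Equal addresses denote equal cells by `cell-injective`, and a cell has at most one owner.
      exclusive : ExclusiveWrites N e
      exclusive q<N q′<N eq eq′ with writes-owned q<N eq | writes-owned q′<N eq′
      ... | k , i , refl , i<U , own₁ | k′ , i′ , same , i′<U , own₂
        with cell-injective {U} {k} {i} {k′} {i′} i<U i′<U same
      ... | refl , refl = disjoint q<N q′<N i<U own₁ own₂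

      untouched : ∀ {k i} → i < U → (∀ {q x} → q < N → Own q k i → e q ≢ toMem (k * U + i) x) →
        cells (parStep N c s) k i ≡ cells s k i
      untouched {k} {i} i<U avoid = writeMems-miss N e (memory s) λ {q} q<N eq →
        case writes-owned q<N eq of λ where
          (k′ , i′ , same , i′<U , own′) → case cell-injective {U} {k} {i} {k′} {i′} i<U i′<U same of λ where
            (refl , refl) → avoid q<N own′ eq

      step-rel : Rel (parStep N c s) σ′ M′
      step-rel .ctls = ctls rel
      step-rel .shared i<U sh = trans (untouched i<U (λ q<N own′ _ → sh q<N own′)) (shared rel i<U sh)
      step-rel .regs q rewrite dec-true (toℕ q <? N) (toℕ<n q) = written (outs q)
        where
        written : Outcome (toℕ q) (e (toℕ q)) (σ q) (M q) (σ′ q) (M′ q) →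
          writeReg (e (toℕ q)) (local-regs s (toℕ q)) ⊩ σ′ q
        written (quiet eq eqσ _) rewrite eq | eqσ = regs rel q
        written (reg r z eq eqσ _) rewrite eq | eqσ = ⊩-set {σ = σ q} r z (regs rel q)
        written (mem _ _ _ eq _ _ eqσ _) rewrite eq | eqσ = regs rel q
      step-rel .own q {k} {i} i<U own′ with outs q
      ... | quiet eq _ eqM = trans (untouched i<U λ q′<N own″ eq′ → silent q′<N own″ eq′)
                             (trans (own rel q i<U own′) (cong (λ m → m k i) (sym eqM)))
        where
        silent : ∀ {q′ a x} → q′ < N → Own q′ k i → e q′ ≢ toMem a x
        silent q′<N own″ eq′ with disjoint (toℕ<n q) q′<N i<U own′ own″
        ... | refl = case trans (sym eq) eq′ of λ ()
      ... | reg r z eq _ eqM = trans (untouched i<U λ q′<N own″ eq′ → silent q′<N own″ eq′)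
                             (trans (own rel q i<U own′) (cong (λ m → m k i) (sym eqM)))
        where
        silent : ∀ {q′ a x} → q′ < N → Own q′ k i → e q′ ≢ toMem a x
        silent q′<N own″ eq′ with disjoint (toℕ<n q) q′<N i<U own′ own″
        ... | refl = case trans (sym eq) eq′ of λ ()
      -- The owner itself writes. Either it hits the observed cell, and its value arrives by
      -- exclusivity, or it writes elsewhere, and then nobody changes the observed cell.
      ... | mem k′ i′ z eq i′<U own″ _ eqM rewrite eqM with k′ ≟ k | i′ ≟ i
      ... | yes refl | yes refl =
        trans (writeMems-hit N e (memory s) exclusive (toℕ<n q) eq) (sym (upd-same (M q) k i))
      ... | no k′≢k | _ = trans (trans (untouched i<U (elsewhere (k′≢k ∘ proj₁))) (own rel q i<U own′))
                                (sym (upd-other (M q) {k′} {i′} (k′≢k ∘ proj₁)))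
        where
        elsewhere : ¬ (k′ ≡ k × i′ ≡ i) →
          ∀ {q′ x} → q′ < N → Own q′ k i → e q′ ≢ toMem (k * U + i) x
        elsewhere ≢ q′<N own‴ eq′ with disjoint (toℕ<n q) q′<N i<U own′ own‴
        ... | refl with trans (sym eq) eq′
        ... | eq″ = ≢ (cell-injective {U} {k′} {i′} {k} {i} i′<U i<U (toMem-address eq″))
      ... | yes refl | no i′≢i = trans (trans (untouched i<U (elsewhere (i′≢i ∘ proj₂))) (own rel q i<U own′))
                                       (sym (upd-other (M q) {k} {i′} (i′≢i ∘ proj₂)))
        where
        elsewhere : ¬ (k′ ≡ k × i′ ≡ i) →
          ∀ {q′ x} → q′ < N → Own q′ k i → e q′ ≢ toMem (k * U + i) x
        elsewhere ≢ q′<N own‴ eq′ with disjoint (toℕ<n q) q′<N i<U own′ own‴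
        ... | refl with trans (sym eq) eq′
        ... | eq″ = ≢ (cell-injective {U} {k′} {i′} {k} {i} i′<U i<U (toMem-address eq″))

    -- A family of derivations indexed by the processors cannot be matched on as a whole; these
    -- projections extract the intermediate states pointwise.
    mid-regs : ∀ {q c d σ M σ″ M″} → Exec q (c ⨾ d) σ M σ″ M″ → List ℕ
    mid-regs (_⨾_ {σ′ = σ′} _ _) = σ′

    mid-mem : ∀ {q c d σ M σ″ M″} → Exec q (c ⨾ d) σ M σ″ M″ → Mem
    mid-mem (_⨾_ {M′ = M′} _ _) = M′

    next-regs : ∀ {q n c σ M σ″ M″} → Iter q (suc n) c σ M σ″ M″ → List ℕ
    next-regs (_∷_ {σ′ = σ′} _ _) = σ′

    next-mem : ∀ {q n c σ M σ″ M″} → Iter q (suc n) c σ M σ″ M″ → Mem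
    next-mem (_∷_ {M′ = M′} _ _) = M′

    Preserves : ℕ → State → State → Set
    Preserves ℓ s s′ = ∀ {r} → r < loopReg ℓ → control-regs s′ r ≡ control-regs s r

    ctl-step : ∀ {s σ M} ℓ f x y → Rel s σ M →
      Rel (controlStep (op (loopReg ℓ) f x y) s) σ M
    ctl-step ℓ f x y rel .regs = regs rel
    ctl-step ℓ f x y rel .own = own rel
    ctl-step ℓ f x y rel .shared = shared rel
    ctl-step {s} ℓ f x y rel .ctls .at r eq = trans
      (updated-other (control-regs s) {loopReg ℓ} {r} λ where
         refl → <⇒≱ (get-< K r eq) (≤-trans length-K (m≤m+n 50 ℓ)))
      (ctls rel .at r eq)

    q₀ : Fin N
    q₀ = fromℕ< 0<N

    first : ∀ {q c d σ M σ″ M″} (x : Exec q (c ⨾ d) σ M σ″ M″) →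
      Exec q c σ M (mid-regs x) (mid-mem x)
    first (x ⨾ y) = x

    second : ∀ {q c d σ M σ″ M″} (x : Exec q (c ⨾ d) σ M σ″ M″) →
      Exec q d (mid-regs x) (mid-mem x) σ″ M″
    second (x ⨾ y) = y

    head-iter : ∀ {q n c σ M σ″ M″} (x : Iter q (suc n) c σ M σ″ M″) →
      Exec q c σ M (next-regs x) (next-mem x)
    head-iter (x ∷ xs) = x

    tail-iter : ∀ {q n c σ M σ″ M″} (x : Iter q (suc n) c σ M σ″ M″) →
      Iter q n c (next-regs x) (next-mem x) σ″ M″
    tail-iter (x ∷ xs) = xs

    no-iter : ∀ {q c σ M σ′ M′} → Iter q 0 c σ M σ′ M′ → σ ≡ σ′ × M ≡ M′
    no-iter [] = refl , refl

    -- The count comes from `K`, which all processors share; hence they all iterate equally often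
    -- and remain in lock step.
    invert : ∀ {q x c σ M σ′ M′} → Exec q (rep x c) σ M σ′ M′ →
      get K x ≡ just (count K x) × count K x < 2 ^ width × Iter q (count K x) c σ M σ′ M′
    invert {x = x} (rep {n = n} gx n< iter) = trans gx (cong just eq) , subst (_< 2 ^ width) eq n<
                                            , subst (λ n → Iter _ n _ _ _ _ _) eq iter
      where
      eq = count-just K x gx

    loop-counter : ∀ {s σ M x ℓ} {A : Set} → Rel s σ M →
      get K x ≡ just (count K x) × count K x < 2 ^ width × A →
      control-regs (controlStep (op (loopReg ℓ) add (ctl x) (ctl 9)) s) (loopReg ℓ) ≡ count K x
    loop-counter {s} {x = x} {ℓ} rel (gx , n< , _) = trans (updated-same (control-regs s) (loopReg ℓ))
      (trans (cong (mod2^ width)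
                (trans (cong₂ _+_ (ctls rel .at x gx) (ctls rel .at 9 zero-reg)) (+-identityʳ (count K x))))
             (mod2^-small width n<))

    mutual
      -- Induction on the code rather than on a derivation: the code and `K` determine the sequence
      -- of machine steps, so the separate executions can be run side by side. `Preserves` protects
      -- the counters of the enclosing loops, whose registers have smaller numbers.
      simulate : ∀ c {k s ℓ σ σ′ M M′} → get K k ≡ just N → Rel s σ M →
        (∀ q → Exec (toℕ q) c (σ q) (M q) (σ′ q) (M′ q)) →
        ∃[ s′ ] ∃[ w ] Run (compile k ℓ c) s s′ (duration K c) w × w ≤ N * duration K c ×
          Rel s′ σ′ M′ × Preserves ℓ s s′
      simulate (ins i) {k} {s} gk rel ex =
        _ , _ , run-par (≤-trans (≤-reflexive active) N≤procs)
                        (subst (λ n → ExclusiveWrites n (localEffect i s)) (sym active)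
                          (exclusive {c = i} rel outs))
          , ≤-reflexive (trans active (sym (*-identityʳ N)))
          , subst (λ n → Rel (parStep n i s) _ _) (sym active) (step-rel {c = i} rel outs)
          , (λ _ → refl)
        where
        active : control-regs s k ≡ N
        active = ctls rel .at k gk
        outs : ∀ q → Outcome (toℕ q) (localEffect i s (toℕ q)) _ _ _ _
        outs q with ex q
        ... | ins step = outcome rel q step
      simulate (c ⨾ d) {k} {s} {ℓ} gk rel ex
        with simulate c {ℓ = ℓ} gk rel (λ q → first (ex q))
      ... | s₁ , w₁ , run₁ , w₁≤ , rel₁ , pre₁
        with simulate d {ℓ = ℓ} gk rel₁ (λ q → second (ex q))
      ... | s₂ , w₂ , run₂ , w₂≤ , rel₂ , pre₂ =
        s₂ , _ , run-seq run₁ run₂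
           , ≤-trans (+-mono-≤ w₁≤ w₂≤) (≤-reflexive (sym (*-distribˡ-+ N (duration K c) (duration K d))))
           , rel₂ , λ r< → trans (pre₂ r<) (pre₁ r<)
      simulate (rep x c) {k} {s} {ℓ} {σ} {σ′} {M} {M′} gk rel ex
        with simulate-iter c {ℓ = ℓ} (count K x) gk (ctl-step {s} ℓ add (ctl x) (ctl 9) rel)
               (loop-counter {s} {ℓ = ℓ} rel (invert (ex q₀))) (proj₁ (proj₂ (invert (ex q₀))))
               (λ q → proj₂ (proj₂ (invert (ex q))))
      ... | s′ , w , run , w≤ , rel′ , pre =
        s′ , _ , run-seq run-exec run
           , ≤-trans (+-mono-≤ 0<N w≤)
               (≤-reflexive (trans (cong (_+ N * (1 + n * (duration K c + 2))) (sym (*-identityʳ N)))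
                                   (sym (*-distribˡ-+ N 1 (1 + n * (duration K c + 2))))))
           , rel′ , λ {r} r< → trans (pre r<)
                                 (updated-other (control-regs s) {loopReg ℓ} {r} λ where refl → <-irrefl refl r<)
        where n = count K x

      simulate-iter : ∀ c {k s ℓ σ σ′ M M′} n → get K k ≡ just N → Rel s σ M →
        control-regs s (loopReg ℓ) ≡ n → n < 2 ^ width →
        (∀ q → Iter (toℕ q) n c (σ q) (M q) (σ′ q) (M′ q)) →
        ∃[ s′ ] ∃[ w ] Run (while (ctl (loopReg ℓ)) (compile k (suc ℓ) c ⨟
            exec (op (loopReg ℓ) sub (ctl (loopReg ℓ)) (ctl 10)))) s s′
            (1 + n * (duration K c + 2)) w ×
          w ≤ N * (1 + n * (duration K c + 2)) ×
          Rel s′ σ′ M′ × Preserves ℓ s s′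
      simulate-iter c {s = s} {ℓ} zero gk rel counter _ iters =
        s , 1 , run-while-false counter , ≤-trans 0<N (≤-reflexive (sym (*-identityʳ N)))
          , rel-end , λ _ → refl
        where
        rel-end : Rel s _ _
        rel-end .regs q = subst (local-regs s (toℕ q) ⊩_) (proj₁ (no-iter (iters q))) (regs rel q)
        rel-end .own q i<U o = trans (own rel q i<U o)
          (cong (λ m → m _ _) (proj₂ (no-iter (iters q))))
        rel-end .shared = shared rel
        rel-end .ctls = ctls rel
      simulate-iter c {k} {s} {ℓ} (suc n) gk rel counter n< iters
        with simulate c {ℓ = suc ℓ} gk rel (λ q → head-iter (iters q))
      ... | s₁ , w₁ , run₁ , w₁≤ , rel₁ , pre₁
        with simulate-iter c {ℓ = ℓ} n gk (ctl-step {s₁} ℓ sub (ctl (loopReg ℓ)) (ctl 10) rel₁)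
               (trans (updated-same (control-regs s₁) (loopReg ℓ))
                 (trans (cong (mod2^ width) (cong₂ _∸_ counter₁ (ctls rel₁ .at 10 one-reg)))
                        (mod2^-small width (<-trans (n<1+n n) n<))))
               (<-trans (n<1+n n) n<) (λ q → tail-iter (iters q))
        where
        counter₁ : control-regs s₁ (loopReg ℓ) ≡ suc n
        counter₁ = trans (pre₁ (n<1+n (loopReg ℓ))) counter
      ... | s₂ , w₂ , run₂ , w₂≤ , rel₂ , pre₂ =
        s₂ , _ , subst (λ t → Run (while (ctl (loopReg ℓ)) (compile k (suc ℓ) c ⨟
                       exec (op (loopReg ℓ) sub (ctl (loopReg ℓ)) (ctl 10)))) s s₂ t (suc ((w₁ + 1) + w₂))) (iteration-time n T)
                   (run-while-true (λ eq → 1+n≢0 (trans (sym counter) eq)) (run-seq run₁ run-exec) run₂)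
           , ≤-trans (s≤s (+-mono-≤ (+-monoˡ-≤ 1 w₁≤) w₂≤))
                     (≤-trans (≤-reflexive (iteration-work₁ N n T))
                       (≤-trans (+-monoʳ-≤ (N * T + N * (1 + n * (T + 2))) (*-monoˡ-≤ 2 0<N))
                         (≤-reflexive (iteration-work₂ N n T))))
           , rel₂ , λ {r} r< → trans (pre₂ r<)
                      (trans (updated-other (control-regs s₁) {loopReg ℓ} {r} λ where refl → <-irrefl refl r<)
                             (pre₁ (m<n⇒m<1+n r<)))
        where
        T = duration K c

-- Rules for control programs with budgets of time and work

sumTo : (ℕ → ℕ) → ℕ → ℕ
sumTo f zero    = 0
sumTo f (suc n) = sumTo f n + f n

sumTo-suc : ∀ f n → sumTo f (suc n) ≡ f 0 + sumTo (λ i → f (suc i)) n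
sumTo-suc f zero    = sym (+-identityʳ (f 0))
sumTo-suc f (suc n) = trans (cong (_+ f (suc n)) (sumTo-suc f n)) (+-assoc (f 0) _ _)

read : (ℕ → ℕ) → ℕ → ℕ → List ℕ
read f i zero    = []
read f i (suc n) = f i ∷ read f (suc i) n

get-read : ∀ f i n r {x} → get (read f i n) r ≡ just x → f (i + r) ≡ x
get-read f i (suc n) zero    refl = cong f (+-identityʳ i)
get-read f i (suc n) (suc r) eq   = trans (cong f (+-suc i r)) (get-read f (suc i) n r eq)

⊩-read : ∀ f n → f ⊩ read f 0 n
⊩-read f n = agree (get-read f 0 n)

file : (ℕ → ℕ) → List ℕ
file f = read f 0 12

block : List (Instr control) → Prog
block []       = skip
block (i ∷ is) = exec i ⨟ block is

for : (x counter : Reg) → Prog → Prog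
for x j c = exec (op j add (ctl x) (ctl 9)) ⨟
            while (ctl j) (c ⨟ exec (op j sub (ctl j) (ctl 10)))

module Outcomes (E : Env) (U : ℕ) where
  open Env E
  open Machine E
  open Simulation E U public

  -- A total correctness triple. Its budgets are fixed before the run, so that the cost of a
  -- composed program is a closed expression, the sum of the budgets of its parts.
  Out : Prog → State → (time work : ℕ) → (State → Set) → Set
  Out c s T W Q = ∃[ s′ ] ∃[ t ] ∃[ w ] Run c s s′ t w × t ≤ T × w ≤ W × Q s′

  infixr 5 _then_
  _then_ : ∀ {c d s T T′ W W′ Q Q′} → Out c s T W Q → (∀ s′ → Q s′ → Out d s′ T′ W′ Q′) →
    Out (c ⨟ d) s (T + T′) (W + W′) Q′
  (s₁ , _ , _ , run₁ , t₁≤ , w₁≤ , q₁) then next with next s₁ q₁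
  ... | s₂ , _ , _ , run₂ , t₂≤ , w₂≤ , q₂ =
    s₂ , _ , _ , run-seq run₁ run₂ , +-mono-≤ t₁≤ t₂≤ , +-mono-≤ w₁≤ w₂≤ , q₂

  weaken : ∀ {c s T T′ W W′ Q Q′} → T ≤ T′ → W ≤ W′ → (∀ s′ → Q s′ → Q′ s′) →
    Out c s T W Q → Out c s T′ W′ Q′
  weaken T≤ W≤ imp (s₁ , _ , _ , run , t≤ , w≤ , q) =
    s₁ , _ , _ , run , ≤-trans t≤ T≤ , ≤-trans w≤ W≤ , imp s₁ q

  data CStep (K : List ℕ) : Instr control → List ℕ → Set where
    op : ∀ {r f x y a b z} → get K x ≡ just a → get K y ≡ just b →
      apply width f a b ≡ z → z < 2 ^ width → CStep K (op r f (ctl x) (ctl y)) (set K r z)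
    clz : ∀ {r x a z} → get K x ≡ just a → leadingZeros width a ≡ z → z < 2 ^ width →
      CStep K (clz r (ctl x)) (set K r z)

  infixr 5 _∷_
  data CExec : List (Instr control) → List ℕ → List ℕ → Set where
    []  : ∀ {K} → CExec [] K K
    _∷_ : ∀ {i is K K′ K″} → CStep K i K′ → CExec is K′ K″ → CExec (i ∷ is) K K″

  infix 4 _⊨_
  _⊨_ : State → List ℕ → Set
  s ⊨ K = control-regs s ⊩ K

  control-op : ∀ {s K r f x y a b z} → s ⊨ K → get K x ≡ just a → get K y ≡ just b →
    apply width f a b ≡ z → z < 2 ^ width →
    controlStep (op r f (ctl x) (ctl y)) s ⊨ set K r z
  control-op {s} {K} {r} {x = x} {y} h gx gy refl z<
    rewrite h .at x gx | h .at y gy | mod2^-small width z< = ⊩-set {σ = K} r _ h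

  control-clz : ∀ {s K r x a z} → s ⊨ K → get K x ≡ just a →
    leadingZeros width a ≡ z → z < 2 ^ width → controlStep (clz r (ctl x)) s ⊨ set K r z
  control-clz {s} {K} {r} {x = x} h gx refl z<
    rewrite h .at x gx | mod2^-small width z< = ⊩-set {σ = K} r _ h

  run-block : ∀ {is K K′ s} → s ⊨ K → CExec is K K′ →
    Out (block is) s (length is) (length is) (λ s′ → s′ ⊨ K′ × cells s′ ≡ cells s)
  run-block h [] = _ , _ , _ , run-skip , z≤n , z≤n , h , refl
  run-block {s = s} h (op {f = f} gx gy eq z< ∷ steps)
    with run-block (control-op {s} {f = f} h gx gy eq z<) steps
  ... | s′ , _ , _ , run , t≤ , w≤ , q = s′ , _ , _ , run-seq run-exec run , s≤s t≤ , s≤s w≤ , q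
  run-block {s = s} h (clz gx eq z< ∷ steps)
    with run-block (control-clz {s} h gx eq z<) steps
  ... | s′ , _ , _ , run , t≤ , w≤ , q = s′ , _ , _ , run-seq run-exec run , s≤s t≤ , s≤s w≤ , q

  module _ {x j : Reg} {c : Prog} {n : ℕ} (Kf : (i count : ℕ) → List ℕ) (J : ℕ → Mem → Set)
    (T W : ℕ → ℕ)
    (zero-reg : ∀ {i r} → get (Kf i r) 9 ≡ just 0) (one-reg : ∀ {i r} → get (Kf i r) 10 ≡ just 1)
    (counter : ∀ {i r} → get (Kf i r) j ≡ just r) (recount : ∀ {i r r′} → set (Kf i r) j r′ ≡ Kf i r′)
    (body : ∀ {s} i r → i + suc r ≡ n → s ⊨ Kf i (suc r) → J i (cells s) →
       Out c s (T i) (W i) (λ s′ → s′ ⊨ Kf (suc i) (suc r) × J (suc i) (cells s′)))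
    where

    -- `Kf i r` lists the registers after `i` iterations with `r` to come. Costs may vary with the
    -- iteration: merge levels take different times, and the levels of the processor tree different
    -- amounts of work.
    run-while : ∀ i r {s} → i + r ≡ n → r < 2 ^ width → s ⊨ Kf i r → J i (cells s) →
      Out (while (ctl j) (c ⨟ exec (op j sub (ctl j) (ctl 10)))) s
        (1 + sumTo (λ k → T (i + k) + 2) r) (1 + sumTo (λ k → W (i + k) + 2) r)
        (λ s′ → s′ ⊨ Kf n 0 × J n (cells s′))
    run-while i zero {s} eq _ h J₀ rewrite +-identityʳ i | eq =
      s , _ , _ , run-while-false (h .at j counter) , ≤-refl , ≤-refl , h , J₀
    run-while i (suc r) {s} eq r< h J₀ with body i r eq h J₀
    ... | s₁ , t₁ , w₁ , run₁ , t₁≤ , w₁≤ , h₁ , J₁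
      with run-while (suc i) r (trans (sym (+-suc i r)) eq) (<-trans (n<1+n r) r<)
             (subst (controlStep (op j sub (ctl j) (ctl 10)) s₁ ⊨_) recount
               (control-op {s₁} {f = sub} h₁ counter one-reg refl (<-trans (n<1+n r) r<))) J₁
    ... | s₂ , t₂ , w₂ , run₂ , t₂≤ , w₂≤ , q =
      s₂ , _ , _ , run-while-true (λ eq → 1+n≢0 (trans (sym (h .at j counter)) eq)) (run-seq run₁ run-exec) run₂
         , total T t₁≤ t₂≤ , total W w₁≤ w₂≤ , q
      where
      total : ∀ (T : ℕ → ℕ) {t₁ t₂} → t₁ ≤ T i → t₂ ≤ 1 + sumTo (λ k → T (suc i + k) + 2) r →
        suc ((t₁ + 1) + t₂) ≤ 1 + sumTo (λ k → T (i + k) + 2) (suc r)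
      total T {t₁} {t₂} t₁≤ t₂≤ = begin
        suc ((t₁ + 1) + t₂)
          ≤⟨ s≤s (+-mono-≤ (+-monoˡ-≤ 1 t₁≤) t₂≤) ⟩
        suc ((T i + 1) + (1 + sumTo (λ k → T (suc i + k) + 2) r))
          ≡⟨ cong suc (arrange (T i) _) ⟩
        suc ((T i + 2) + sumTo (λ k → T (suc i + k) + 2) r)
          ≡⟨ cong suc (cong₂ _+_ (cong (λ k → T k + 2) (sym (+-identityʳ i)))
               (sumTo-cong (λ k → cong (λ k → T k + 2) (sym (+-suc i k))) r)) ⟩
        suc ((T (i + 0) + 2) + sumTo (λ k → T (i + suc k) + 2) r)
          ≡⟨ cong suc (sym (sumTo-suc (λ k → T (i + k) + 2) r)) ⟩
        suc (sumTo (λ k → T (i + k) + 2) (suc r)) ∎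
        where
        open ≤-Reasoning
        arrange : ∀ a b → (a + 1) + (1 + b) ≡ (a + 2) + b
        arrange = solve-∀
        sumTo-cong : ∀ {f g} → (∀ k → f k ≡ g k) → ∀ r → sumTo f r ≡ sumTo g r
        sumTo-cong eq zero = refl
        sumTo-cong eq (suc r) = cong₂ _+_ (sumTo-cong eq r) (eq r)

    run-for : ∀ {K s} → s ⊨ K → get K x ≡ just n → get K 9 ≡ just 0 → set K j n ≡ Kf 0 n →
      n < 2 ^ width → J 0 (cells s) →
      Out (for x j c) s (2 + sumTo (λ k → T k + 2) n) (2 + sumTo (λ k → W k + 2) n)
        (λ s′ → s′ ⊨ Kf n 0 × J n (cells s′))
    run-for {K} {s} h gx gz eq n< J₀
      with run-while 0 n refl n<
             (subst (controlStep (op j add (ctl x) (ctl 9)) s ⊨_) eq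
               (control-op {s} {f = add} h gx gz (+-identityʳ n) n<)) J₀
    ... | s′ , _ , _ , run , t≤ , w≤ , q =
      s′ , _ , _ , run-seq run-exec run , s≤s t≤ , s≤s w≤ , q

  module _ {N : ℕ} {K : List ℕ} {Own : ℕ → ℕ → ℕ → Set} (setup : ParallelSetup N K Own) {s : State} (h : s ⊨ K) where
    open Lockstep N K Own (cells s)
    open Runs setup (cells s)
    open Rel

    -- Local registers hold whatever earlier blocks left in them, so each processor must be verified
    -- for an arbitrary initial content `f`.
    run-parallel : ∀ {k c} → get K k ≡ just N → (Q : ℕ → Mem → Set) →
      (∀ q → q < N → (f : ℕ → ℕ) → ∃[ σ′ ] ∃[ M′ ] Exec q c (file f) (cells s) σ′ M′ × Q q M′) →
      Out (compile k 0 c) s (duration K c) (N * duration K c) λ s′ → s′ ⊨ K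
        × (∀ {q} → q < N → ∃[ M′ ] Q q M′ × (∀ k i → i < U → Own q k i → cells s′ k i ≡ M′ k i))
        × (∀ k i → i < U → Shared k i → cells s′ k i ≡ cells s k i)
    run-parallel {c = c} gk Q ex with simulate c {ℓ = 0} gk rel₀ (λ q → proj₁ (proj₂ (proj₂ (each q))))
      where
      each = λ (q : Fin N) → ex (toℕ q) (toℕ<n q) (local-regs s (toℕ q))
      rel₀ : Rel s (λ q → file (local-regs s (toℕ q))) (λ _ → cells s)
      rel₀ = record { regs = λ q → ⊩-read (local-regs s (toℕ q)) 12
                    ; own = λ _ _ _ → refl ; shared = λ _ _ → refl ; ctls = h }
    ... | s′ , w , run , w≤ , rel , _ =
      s′ , _ , _ , run , ≤-refl , w≤ , ctls rel
         , (λ q<N → _ , subst (λ r → Q r (proj₁ (proj₂ (each (fromℕ< q<N))))) (toℕ-fromℕ< q<N)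
                              (proj₂ (proj₂ (proj₂ (each (fromℕ< q<N)))))
                  , λ k i i<U o → own rel (fromℕ< q<N) i<U (subst (λ r → Own r k i) (sym (toℕ-fromℕ< q<N)) o))
         , λ k i i<U sh → shared rel i<U sh
      where
      each = λ (q : Fin N) → ex (toℕ q) (toℕ<n q) (local-regs s (toℕ q))

-- Register conventions

rn rp rd rv rα rh rw rb rB r0 r1 re rA rU rL rK rλ rΛ ra roff rγ rv1 rα1 : Reg
rn = 0 ; rp = 1 ; rd = 2 ; rv = 3 ; rα = 4 ; rh = 5 ; rw = 6 ; rb = 7 ; rB = 8
r0 = 9 ; r1 = 10 ; re = 11 ; rA = 12 ; rU = 13 ; rL = 14 ; rK = 15 ; rλ = 16 ; rΛ = 17
ra = 18 ; roff = 19 ; rγ = 20 ; rv1 = 21 ; rα1 = 22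

-- Array k occupies the U cells from k U on: 1 and 2 are the buffers of the merge
-- sort, 3 the splitters, 4 their tree, 5 their LCPs, 6 the oracle, 7 the counters,
-- 8 the up-sweep and 9 the down-sweep over the processors, 10 the prefix sums,
-- 11 the output cursors, and 12 the output.
base : ℕ → Reg
base k = 22 + k

rsrc rdst rW rrounds rW2 rtmp rcnt rk rsample rtwo : Reg
rsrc = 35 ; rdst = 36 ; rW = 37 ; rrounds = 38 ; rW2 = 39 ; rtmp = 40 ; rcnt = 41 ; rk = 42
rsample = 43 ; rtwo = 44

-- The program

infix 6 _≔_⟨_⟩_

_≔_⟨_⟩_ : Reg → Operand processor → Op → Operand processor → Code
r ≔ x ⟨ f ⟩ y = ins (op r f x y)

fetch : (r b i : Reg) → Code
fetch r b i = ins (op 0 add (ctl b) (loc i)) ⨾ ins (load r (loc 0))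

put : (b i r : Reg) → Code
put b i r = ins (op 0 add (ctl b) (loc i)) ⨾ ins (store (loc 0) (loc r))

drawStep : Code
drawStep =
  ins (draw 3 (loc 1)) ⨾
  ins (chars 4 (loc 3) (ctl rh)) ⨾
  put (base 1) 2 4 ⨾
  (1 ≔ loc 1 ⟨ add ⟩ ctl r1) ⨾
  (2 ≔ loc 2 ⟨ add ⟩ ctl r1)

drawCode : Code
drawCode =
  (1 ≔ ctl r0 ⟨ add ⟩ ctl r0) ⨾
  (2 ≔ ctl roff ⟨ add ⟩ ctl r0) ⨾
  rep ra drawStep

-- A merge without branches. Register 8 says whether the left element is taken: the comparison
-- proposes, an exhausted right run overrules it to 1, an exhausted left run to 0. The right element
-- is stored in any case and overwritten by the left one if register 8 is 1.
mergeTail mergeStep : Code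
mergeTail =
  put rdst 1 7 ⨾
  ins (when (loc 8) (store (loc 0) (loc 6))) ⨾
  (2 ≔ loc 2 ⟨ add ⟩ loc 8) ⨾
  (4 ≔ loc 4 ⟨ add ⟩ ctl r1) ⨾
  (4 ≔ loc 4 ⟨ sub ⟩ loc 8) ⨾
  (1 ≔ loc 1 ⟨ add ⟩ ctl r1)
mergeStep =
  fetch 6 rsrc 2 ⨾
  fetch 7 rsrc 4 ⨾
  (8 ≔ loc 6 ⟨ leq ⟩ loc 7) ⨾
  (9 ≔ loc 5 ⟨ leq ⟩ loc 4) ⨾
  ins (when (loc 9) (op 8 add (ctl r1) (ctl r0))) ⨾
  (9 ≔ loc 3 ⟨ leq ⟩ loc 2) ⨾
  ins (when (loc 9) (op 8 add (ctl r0) (ctl r0))) ⨾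
  mergeTail

mergeRound : Code
mergeRound =
  (2 ≔ loc 1 ⟨ add ⟩ ctl r0) ⨾
  (3 ≔ loc 1 ⟨ add ⟩ ctl rW) ⨾
  (4 ≔ loc 1 ⟨ add ⟩ ctl rW) ⨾
  (5 ≔ loc 1 ⟨ add ⟩ ctl rW2) ⨾
  rep rW2 mergeStep

mergeCode : Code
mergeCode =
  (1 ≔ pid ⟨ mul ⟩ ctl rrounds) ⨾
  (1 ≔ loc 1 ⟨ mul ⟩ ctl rW2) ⨾
  rep rrounds mergeRound

splitterStep : Code
splitterStep =
  fetch 4 rsrc 2 ⨾
  put (base 3) 1 4 ⨾
  (5 ≔ loc 3 ⟨ xor ⟩ loc 4) ⨾
  ins (clz 5 (loc 5)) ⨾
  -- A word of characters has `w * b` bits; the γ = B - w b bits above them are always zero and are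
  -- discounted before dividing by the bits per character.
  (5 ≔ loc 5 ⟨ sub ⟩ ctl rγ) ⨾
  (5 ≔ loc 5 ⟨ quo ⟩ ctl rb) ⨾
  put (base 5) 1 5 ⨾
  (3 ≔ loc 4 ⟨ add ⟩ ctl r0) ⨾
  (1 ≔ loc 1 ⟨ add ⟩ ctl r1) ⨾
  (2 ≔ loc 2 ⟨ add ⟩ ctl rα)

splitterCode : Code
splitterCode =
  (1 ≔ ctl r0 ⟨ add ⟩ ctl r0) ⨾
  (2 ≔ ctl roff ⟨ add ⟩ ctl rα1) ⨾
  -- 0 stands in for the predecessor of the first splitter; the specification of the LCPs begins at
  -- index 1.
  (3 ≔ ctl r0 ⟨ add ⟩ ctl r0) ⨾
  rep rv splitterStep

-- Node `2 ^ l + r` receives the splitter whose index is its in-order rank,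
-- `(2 * r + 1) * 2 ^ (d ∸ suc l) ∸ 1`. Register 2 holds `2 ^ suc l` and doubles when the node
-- counter reaches the next level.
treeStep : Code
treeStep =
  (3 ≔ loc 1 ⟨ add ⟩ loc 1) ⨾
  (3 ≔ loc 3 ⟨ sub ⟩ loc 2) ⨾
  (3 ≔ loc 3 ⟨ add ⟩ ctl r1) ⨾
  (4 ≔ ctl rv1 ⟨ quo ⟩ loc 2) ⨾
  (3 ≔ loc 3 ⟨ mul ⟩ loc 4) ⨾
  (3 ≔ loc 3 ⟨ sub ⟩ ctl r1) ⨾
  fetch 5 (base 3) 3 ⨾
  put (base 4) 1 5 ⨾
  (1 ≔ loc 1 ⟨ add ⟩ ctl r1) ⨾
  (4 ≔ loc 2 ⟨ leq ⟩ loc 1) ⨾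
  ins (when (loc 4) (op 2 add (loc 2) (loc 2)))

treeCode : Code
treeCode =
  (1 ≔ ctl r1 ⟨ add ⟩ ctl r0) ⨾
  (2 ≔ ctl r1 ⟨ add ⟩ ctl r1) ⨾
  rep rv treeStep

descendStep : Code
descendStep =
  fetch 4 (base 4) 3 ⨾
  (4 ≔ loc 2 ⟨ leq ⟩ loc 4) ⨾
  -- The right child is taken if c exceeds the node: 2 i + 1 - [c ≤ t_i] equals 2 i + [t_i < c].
  (3 ≔ loc 3 ⟨ add ⟩ loc 3) ⨾
  (3 ≔ loc 3 ⟨ add ⟩ ctl r1) ⨾
  (3 ≔ loc 3 ⟨ sub ⟩ loc 4)

classifyString : Code
classifyString =
  ins (chars 2 (loc 1) (ctl rh)) ⨾
  (3 ≔ ctl r1 ⟨ add ⟩ ctl r0) ⨾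
  rep rd descendStep ⨾
  (3 ≔ loc 3 ⟨ sub ⟩ ctl rv1) ⨾
  fetch 4 (base 3) 3 ⨾
  (4 ≔ loc 2 ⟨ eql ⟩ loc 4) ⨾
  -- The last leaf v has no splitter. The cell behind the splitters was read in that case, and the
  -- factor [leaf + 1 ≤ v] suppresses the comparison with it.
  (5 ≔ loc 3 ⟨ add ⟩ ctl r1) ⨾
  (5 ≔ loc 5 ⟨ leq ⟩ ctl rv) ⨾
  (4 ≔ loc 5 ⟨ mul ⟩ loc 4) ⨾
  (6 ≔ loc 3 ⟨ add ⟩ loc 3) ⨾
  (6 ≔ loc 6 ⟨ add ⟩ loc 4) ⨾
  -- Positions from n on are moved to bucket K - 1 = 2 v + 1 only after the ordinary search, so that
  -- they take the same time as strings.
  (5 ≔ ctl rn ⟨ leq ⟩ loc 1) ⨾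
  ins (when (loc 5) (op 6 sub (ctl rK) (ctl r1))) ⨾
  put (base 6) 1 6 ⨾
  (5 ≔ loc 6 ⟨ mul ⟩ ctl rp) ⨾
  (5 ≔ loc 5 ⟨ add ⟩ pid) ⨾
  fetch 4 (base 7) 5 ⨾
  (4 ≔ loc 4 ⟨ add ⟩ ctl r1) ⨾
  put (base 7) 5 4 ⨾
  (1 ≔ loc 1 ⟨ add ⟩ ctl r1)

classifyCode : Code
classifyCode = (1 ≔ pid ⟨ mul ⟩ ctl rL) ⨾ rep rL classifyString

chunkSumStep : Code
chunkSumStep =
  fetch 3 (base 7) 1 ⨾
  (2 ≔ loc 2 ⟨ add ⟩ loc 3) ⨾
  (1 ≔ loc 1 ⟨ add ⟩ ctl r1)

chunkSumCode : Code
chunkSumCode =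
  (1 ≔ pid ⟨ mul ⟩ ctl rK) ⨾
  (2 ≔ ctl r0 ⟨ add ⟩ ctl r0) ⨾
  rep rK chunkSumStep ⨾
  (1 ≔ ctl rΛ ⟨ add ⟩ pid) ⨾
  put (base 8) 1 2

upCode : Code
upCode =
  (1 ≔ ctl rk ⟨ add ⟩ pid) ⨾
  (2 ≔ loc 1 ⟨ add ⟩ loc 1) ⨾
  fetch 3 (base 8) 2 ⨾
  (2 ≔ loc 2 ⟨ add ⟩ ctl r1) ⨾
  fetch 4 (base 8) 2 ⨾
  (3 ≔ loc 3 ⟨ add ⟩ loc 4) ⨾
  put (base 8) 1 3

downCode : Code
downCode =
  (1 ≔ ctl rk ⟨ add ⟩ pid) ⨾
  fetch 3 (base 9) 1 ⨾
  (2 ≔ loc 1 ⟨ add ⟩ loc 1) ⨾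
  put (base 9) 2 3 ⨾
  fetch 4 (base 8) 2 ⨾
  (3 ≔ loc 3 ⟨ add ⟩ loc 4) ⨾
  (2 ≔ loc 2 ⟨ add ⟩ ctl r1) ⨾
  put (base 9) 2 3

prefixStep : Code
prefixStep =
  put (base 10) 1 2 ⨾
  -- A second copy: the redistribution advances these cursors, while the prefix sums themselves
  -- belong to the result.
  put (base 11) 1 2 ⨾
  fetch 3 (base 7) 1 ⨾
  (2 ≔ loc 2 ⟨ add ⟩ loc 3) ⨾
  (1 ≔ loc 1 ⟨ add ⟩ ctl r1)

prefixCode : Code
prefixCode =
  (1 ≔ ctl rΛ ⟨ add ⟩ pid) ⨾
  fetch 2 (base 9) 1 ⨾
  (1 ≔ pid ⟨ mul ⟩ ctl rK) ⨾
  rep rK prefixStep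

redistributeStep : Code
redistributeStep =
  fetch 2 (base 6) 1 ⨾
  (3 ≔ loc 2 ⟨ mul ⟩ ctl rp) ⨾
  (3 ≔ loc 3 ⟨ add ⟩ pid) ⨾
  fetch 4 (base 11) 3 ⨾
  put (base 12) 4 1 ⨾
  (4 ≔ loc 4 ⟨ add ⟩ ctl r1) ⨾
  put (base 11) 3 4 ⨾
  (1 ≔ loc 1 ⟨ add ⟩ ctl r1)

redistributeCode : Code
redistributeCode =
  (1 ≔ pid ⟨ mul ⟩ ctl rL) ⨾
  rep rL redistributeStep

infix 6 _:=_⟨_⟩_

_:=_⟨_⟩_ : Reg → Reg → Op → Reg → Instr control
r := x ⟨ f ⟩ y = op r f (ctl x) (ctl y)

setup₁ setup₂ setup₃ setup₄ : List (Instr control)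
setup₁ =
  -- The constant 1 is the truth value of 0 = 0; register 9 is initially 0.
  r1 := r0 ⟨ eql ⟩ r0 ∷
  re := rd ⟨ add ⟩ rα ∷
  rA := r1 ⟨ add ⟩ r0 ∷
  rΛ := r1 ⟨ add ⟩ r0 ∷
  -- B minus the leading zeros of p is the bit length of p, the least exponent whose power of two
  -- exceeds p.
  clz rλ (ctl rp) ∷
  rλ := rB ⟨ sub ⟩ rλ ∷ []
setup₂ =
  rU := rA ⟨ mul ⟩ rp ∷
  rU := rU ⟨ add ⟩ rU ∷
  rU := rn ⟨ add ⟩ rU ∷
  rL := rp ⟨ sub ⟩ r1 ∷
  rL := rn ⟨ add ⟩ rL ∷
  rL := rL ⟨ quo ⟩ rp ∷
  rv1 := rv ⟨ add ⟩ r1 ∷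
  rK := rv1 ⟨ add ⟩ rv1 ∷
  rα1 := rα ⟨ sub ⟩ r1 ∷
  ra := rα ⟨ mul ⟩ rv ∷
  ra := ra ⟨ add ⟩ rα1 ∷
  roff := rA ⟨ sub ⟩ ra ∷
  rγ := rw ⟨ mul ⟩ rb ∷
  rγ := rB ⟨ sub ⟩ rγ ∷ []
setup₃ =
  base 1 := rU ⟨ add ⟩ r0 ∷
  base 2 := rU ⟨ add ⟩ base 1 ∷
  base 3 := rU ⟨ add ⟩ base 2 ∷
  base 4 := rU ⟨ add ⟩ base 3 ∷
  base 5 := rU ⟨ add ⟩ base 4 ∷
  base 6 := rU ⟨ add ⟩ base 5 ∷
  base 7 := rU ⟨ add ⟩ base 6 ∷
  base 8 := rU ⟨ add ⟩ base 7 ∷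
  base 9 := rU ⟨ add ⟩ base 8 ∷
  base 10 := rU ⟨ add ⟩ base 9 ∷
  base 11 := rU ⟨ add ⟩ base 10 ∷
  base 12 := rU ⟨ add ⟩ base 11 ∷ []
setup₄ =
  rsrc := base 1 ⟨ add ⟩ r0 ∷
  rdst := base 2 ⟨ add ⟩ r0 ∷
  rW := r1 ⟨ add ⟩ r0 ∷
  rtwo := r1 ⟨ add ⟩ r1 ∷ []

-- One round more than A / 2W / p makes up for the rounding; the surplus merges
-- write beyond the first A cells.
sortLevel : Prog
sortLevel =
  block (rW2 := rW ⟨ add ⟩ rW ∷
         rrounds := rA ⟨ quo ⟩ rW2 ∷
         rrounds := rrounds ⟨ quo ⟩ rp ∷
         rrounds := rrounds ⟨ add ⟩ r1 ∷ []) ⨟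
  compile rp 0 mergeCode ⨟
  block (rtmp := rsrc ⟨ add ⟩ r0 ∷
         rsrc := rdst ⟨ add ⟩ r0 ∷
         rdst := rtmp ⟨ add ⟩ r0 ∷
         rW := rW2 ⟨ add ⟩ r0 ∷ [])

upLevel downLevel : Prog
upLevel = block (rk := rk ⟨ quo ⟩ rtwo ∷ []) ⨟ compile rk 0 upCode
downLevel = compile rk 0 downCode ⨟ block (rk := rk ⟨ add ⟩ rk ∷ [])

-- The addresses go into registers 0 to 7, which held parameters until now; therefore this block is
-- the last one.
results : List (Instr control)
results =
  0 := rsample ⟨ add ⟩ r0 ∷
  1 := base 3 ⟨ add ⟩ r0 ∷
  2 := base 4 ⟨ add ⟩ r0 ∷
  3 := base 5 ⟨ add ⟩ r0 ∷
  4 := base 6 ⟨ add ⟩ r0 ∷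
  5 := base 7 ⟨ add ⟩ r0 ∷
  6 := base 10 ⟨ add ⟩ r0 ∷
  7 := base 12 ⟨ add ⟩ r0 ∷ []

splitPhase sweepPhase scanPhase : Prog
splitPhase =
  block (rsample := rsrc ⟨ add ⟩ roff ∷ []) ⨟
  compile r1 0 splitterCode ⨟
  compile r1 0 treeCode
sweepPhase =
  block (rk := rΛ ⟨ add ⟩ r0 ∷ []) ⨟
  for rλ rcnt upLevel ⨟
  block (rk := r1 ⟨ add ⟩ r0 ∷ []) ⨟
  for rλ rcnt downLevel
scanPhase =
  compile rp 0 chunkSumCode ⨟
  sweepPhase ⨟
  compile rp 0 prefixCode

program : Prog
program =
  block setup₁ ⨟
  for re rcnt (block (rA := rA ⟨ add ⟩ rA ∷ [])) ⨟
  for rλ rcnt (block (rΛ := rΛ ⟨ add ⟩ rΛ ∷ [])) ⨟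
  block setup₂ ⨟ block setup₃ ⨟ block setup₄ ⨟
  compile r1 0 drawCode ⨟
  for re rcnt sortLevel ⨟
  splitPhase ⨟
  compile rp 0 classifyCode ⨟
  scanPhase ⨟
  compile rp 0 redistributeCode ⨟
  block results

-- Comparisons as machine words

leq-yes : ∀ {x y} → x ≤ y → [ does (x ≤? y) ]ᵇ ≡ 1
leq-yes {x} {y} x≤y rewrite dec-true (x ≤? y) x≤y = refl

leq-no : ∀ {x y} → y < x → [ does (x ≤? y) ]ᵇ ≡ 0
leq-no {x} {y} y<x rewrite dec-false (x ≤? y) (<⇒≱ y<x) = refl

[]ᵇ≤1 : ∀ b → [ b ]ᵇ ≤ 1
[]ᵇ≤1 true  = ≤-refl
[]ᵇ≤1 false = z≤n

read-cong : ∀ {f g} i n → (∀ k → i ≤ k → k < i + n → f k ≡ g k) → read f i n ≡ read g i n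
read-cong i zero    eq = refl
read-cong i (suc n) eq = cong₂ _∷_
  (eq i ≤-refl (m<m+n i z<s))
  (read-cong (suc i) n λ k i<k k< → eq k (<⇒≤ i<k) (subst (k <_) (sym (+-suc i n)) k<))

-- Chunks of consecutive cells, and memory accesses within the word size

InChunk : ℕ → ℕ → ℕ → Set
InChunk w q i = q * w ≤ i × i < suc q * w

chunk-unique : ∀ {w q q′ i} → InChunk w q i → InChunk w q′ i → q ≡ q′
chunk-unique {w} (l , u) (l′ , u′) = ≤-antisym (below l u′) (below l′ u)
  where
  below : ∀ {q q′ i} → q * w ≤ i → i < suc q′ * w → q ≤ q′
  below {q} {q′} l u = ≤-pred (*-cancelʳ-< w q (suc q′) (≤-<-trans l u))

module Access (E : Env) (U : ℕ) (15U<2^width : 15 * U < 2 ^ Env.width E) where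
  open Env E
  open Outcomes E U public

  fits : ∀ {x} → x ≤ 15 * U → x < 2 ^ width
  fits x≤ = ≤-<-trans x≤ 15U<2^width

  fits-multiple : ∀ {x} k → k ≤ 15 → x ≤ k * U → x < 2 ^ width
  fits-multiple k k≤15 x≤ = fits (≤-trans x≤ (*-monoˡ-≤ U k≤15))

  fits₁ : ∀ {x} → x ≤ U → x < 2 ^ width
  fits₁ x≤U = fits-multiple 1 (s≤s z≤n) (≤-trans x≤U (≤-reflexive (sym (*-identityˡ U))))

  fits₂ : ∀ {x y} → x ≤ U → y ≤ U → x + y < 2 ^ width
  fits₂ x≤U y≤U = fits-multiple 2 (s≤s (s≤s z≤n))
    (+-mono-≤ x≤U (≤-trans y≤U (≤-reflexive (sym (*-identityˡ U)))))

  -- The addresses of array k lie below `suc k * U`; the factor 15 in the bound on `U` thus admits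
  -- array numbers up to 14.
  fits-cell : ∀ {k i} → k ≤ 14 → i < U → k * U + i < 2 ^ width
  fits-cell {k} {i} k≤14 i<U = fits-multiple (suc k) (s≤s k≤14)
    (≤-trans (+-monoʳ-≤ (k * U) (<⇒≤ i<U)) (≤-reflexive (+-comm (k * U) U)))

  module AccessIn (N : ℕ) (K : List ℕ) (Own : ℕ → ℕ → ℕ → Set) (R : Mem) where
    open Lockstep N K Own R public

    fetch-shared : ∀ {q r b k i idx z t σ M} → get K b ≡ just (k * U) → k ≤ 14 →
      get (t ∷ σ) i ≡ just idx → idx < U → Shared k idx → R k idx ≡ z →
      Exec q (fetch r b i) (t ∷ σ) M (set ((k * U + idx) ∷ σ) r z) M
    fetch-shared gb k≤ gi idx<U sh eq =
      ins (op gb gi refl (fits-cell k≤ idx<U)) ⨾ ins (load-shared refl refl idx<U sh eq)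

    fetch-own : ∀ {q r b k i idx z t σ M} → get K b ≡ just (k * U) → k ≤ 14 →
      get (t ∷ σ) i ≡ just idx → idx < U → Own q k idx → M k idx ≡ z →
      Exec q (fetch r b i) (t ∷ σ) M (set ((k * U + idx) ∷ σ) r z) M
    fetch-own gb k≤ gi idx<U own eq =
      ins (op gb gi refl (fits-cell k≤ idx<U)) ⨾ ins (load-own refl refl idx<U own eq)

    put-own : ∀ {q b k i idx r z t σ M} → get K b ≡ just (k * U) → k ≤ 14 →
      get (t ∷ σ) i ≡ just idx → idx < U → Own q k idx →
      get ((k * U + idx) ∷ σ) r ≡ just z →
      Exec q (put b i r) (t ∷ σ) M ((k * U + idx) ∷ σ) (upd M k idx z)
    put-own gb k≤ gi idx<U own gz =
      ins (op gb gi refl (fits-cell k≤ idx<U)) ⨾ ins (store refl gz refl idx<U own)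

-- Bottom-up merge sort on lists

merge-yes : ∀ {x y} xs ys → x ≤ y → merge _≤?_ (x ∷ xs) (y ∷ ys) ≡ x ∷ merge _≤?_ xs (y ∷ ys)
merge-yes {x} {y} xs ys x≤y rewrite dec-true (x ≤? y) x≤y = refl

merge-no : ∀ {x y} xs ys → y < x → merge _≤?_ (x ∷ xs) (y ∷ ys) ≡ y ∷ merge _≤?_ (x ∷ xs) ys
merge-no {x} {y} xs ys y<x rewrite dec-false (x ≤? y) (<⇒≱ y<x) = refl

merge-[]ʳ : ∀ xs → merge _≤?_ xs [] ≡ xs
merge-[]ʳ []       = refl
merge-[]ʳ (x ∷ xs) = refl

read-++ : ∀ f i m n → read f i (m + n) ≡ read f i m ++ read f (i + m) n
read-++ f i zero    n = cong (λ j → read f j n) (sym (+-identityʳ i))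
read-++ f i (suc m) n = cong (f i ∷_)
  (trans (read-++ f (suc i) m n) (cong (λ j → read f (suc i) m ++ read f j n) (sym (+-suc i m))))

applyUpTo≡read : ∀ f i n → applyUpTo (λ k → f (i + k)) n ≡ read f i n
applyUpTo≡read f i zero    = refl
applyUpTo≡read f i (suc n) = cong₂ _∷_ (cong f (+-identityʳ i))
  (trans (applyUpTo-cong (λ k → cong f (+-suc i k)) n) (applyUpTo≡read f (suc i) n))
  where
  applyUpTo-cong : ∀ {g h : ℕ → ℕ} → (∀ k → g k ≡ h k) → ∀ n → applyUpTo g n ≡ applyUpTo h n
  applyUpTo-cong eq zero    = refl
  applyUpTo-cong eq (suc n) = cong₂ _∷_ (eq 0) (applyUpTo-cong (λ k → eq (suc k)) n)

map-upTo≡read : ∀ f i n → map (λ k → f (i + k)) (upTo n) ≡ read f i n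
map-upTo≡read f i n = trans (map-upTo _ n) (applyUpTo≡read f i n)

-- The functional model of the sort: block b of level l after l rounds of merging. The memory is
-- compared with it level by level, and sortedness is inherited from `merge`.
mergedBlock : (ℕ → ℕ) → (l b : ℕ) → List ℕ
mergedBlock f zero    b = [ f b ]
mergedBlock f (suc l) b = merge _≤?_ (mergedBlock f l (2 * b)) (mergedBlock f l (2 * b + 1))

mergedBlock-sorted : ∀ f l b → Sorted (mergedBlock f l b)
mergedBlock-sorted f zero    b = Linked.[-]
mergedBlock-sorted f (suc l) b = merge⁺ ≤-decTotalOrder
  (mergedBlock-sorted f l (2 * b)) (mergedBlock-sorted f l (2 * b + 1))

mergedBlock-↭ : ∀ f l b → mergedBlock f l b ↭ read f (b * 2 ^ l) (2 ^ l)
mergedBlock-↭ f zero    b = ↭-reflexive (cong (λ j → [ f j ]) (sym (*-identityʳ b)))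
mergedBlock-↭ f (suc l) b =
  ↭-trans (merge-↭ _≤?_ (mergedBlock f l (2 * b)) (mergedBlock f l (2 * b + 1)))
 (↭-trans (++⁺ (mergedBlock-↭ f l (2 * b)) (mergedBlock-↭ f l (2 * b + 1)))
          (↭-reflexive (sym split)))
  where
  w = 2 ^ l
  split : read f (b * (2 * w)) (2 * w) ≡ read f (2 * b * w) w ++ read f ((2 * b + 1) * w) w
  split = trans (cong₂ (read f) (left b w) (cong (w +_) (+-identityʳ w)))
         (trans (read-++ f (2 * b * w) w w)
                (cong (λ j → read f (2 * b * w) w ++ read f j w) (right b w)))
    where
    left : ∀ b w → b * (2 * w) ≡ 2 * b * w
    left = solve-∀
    right : ∀ b w → 2 * b * w + w ≡ (2 * b + 1) * w
    right = solve-∀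

-- The head of a sorted list is least, hence 0 if the list contains 0. Cancelling this 0 on both
-- sides leaves one zero less.
drop-zeros : ∀ f i k n {xs} → Sorted (read f i (k + n)) → read f i (k + n) ↭ replicate k 0 ++ xs →
  Sorted (read f (i + k) n) × read f (i + k) n ↭ xs
drop-zeros f i zero n sorted perm rewrite +-identityʳ i = sorted , perm
drop-zeros f i (suc k) n {xs} sorted perm rewrite +-suc i k =
  drop-zeros f (suc i) k n (Linked.tail sorted)
    (drop-∷ (subst (λ x → x ∷ read f (suc i) (k + n) ↭ 0 ∷ replicate k 0 ++ xs) head≡0 perm))
  where
  head-least : ∀ {x xs} → Sorted (x ∷ xs) → ∀ {y} → y ∈ x ∷ xs → x ≤ y
  head-least sorted (here refl) = ≤-refl
  head-least sorted (there y∈) with Linked⇒AllPairs ≤-trans sorted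
  ... | x≤ AllPairs.∷ _ = All.lookup x≤ y∈
  head≡0 : f i ≡ 0
  head≡0 = n≤0⇒n≡0 (head-least sorted (∈-resp-↭ (↭-sym perm) (here refl)))

read-zeros : ∀ f i k → (∀ j → i ≤ j → j < i + k → f j ≡ 0) → read f i k ≡ replicate k 0
read-zeros f i zero    _  = refl
read-zeros f i (suc k) eq = cong₂ _∷_ (eq i ≤-refl (m<m+n i z<s))
  (read-zeros f (suc i) k λ j i<j j< → eq j (<⇒≤ i<j) (subst (j <_) (sym (+-suc i k)) j<))

quotient≡/ : ∀ x y .{{_ : NonZero y}} → quotient x y ≡ x / y
quotient≡/ x (suc y) = refl

m<[1+m/n]*n : ∀ m n .{{_ : NonZero n}} → m < suc (m / n) * n
m<[1+m/n]*n m n = subst (_< suc (m / n) * n) (sym (m≡m%n+[m/n]*n m n))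
  (+-monoˡ-< ((m / n) * n) (m%n<n m n))

-- Both numbers name the chunk of width `n` that contains `m`.
/-unique : ∀ {m n q} .{{_ : NonZero n}} → q * n ≤ m → m < suc q * n → m / n ≡ q
/-unique {m} {n} {q} l u = chunk-unique {n} {m / n} {q} {m} (m/n*n≤m m n , m<[1+m/n]*n m n) (l , u)

-- Logarithms

log-≤ : ∀ k {n} → n < 2 ^ suc k → ⌊log₂ n ⌋ ≤ k
log-≤ zero    {zero}        _ = z≤n
log-≤ zero    {suc zero}    _ = z≤n
log-≤ zero    {suc (suc n)} (s≤s (s≤s ()))
log-≤ (suc k) {n} n< = begin
  ⌊log₂ n ⌋               ≤⟨ m≤n+m∸n ⌊log₂ n ⌋ 1 ⟩
  1 + (⌊log₂ n ⌋ ∸ 1)     ≡⟨ cong suc (sym (⌊log₂⌊n/2⌋⌋≡⌊log₂n⌋∸1 n)) ⟩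
  1 + ⌊log₂ ⌊ n /2⌋ ⌋     ≤⟨ s≤s (log-≤ k half) ⟩
  suc k                   ∎
  where
  open ≤-Reasoning
  double : ∀ n → ⌊ n /2⌋ + ⌊ n /2⌋ ≤ n
  double zero = z≤n
  double (suc zero) = z≤n
  double (suc (suc n)) = s≤s (≤-trans (≤-reflexive (+-suc _ _)) (s≤s (double n)))
  half : ⌊ n /2⌋ < 2 ^ suc k
  half = *-cancelˡ-< 2 ⌊ n /2⌋ (2 ^ suc k)
    (≤-<-trans (≤-trans (≤-reflexive (cong (⌊ n /2⌋ +_) (+-identityʳ ⌊ n /2⌋))) (double n)) n<)

log-unique : ∀ k {n} → 2 ^ k ≤ n → n < 2 ^ suc k → ⌊log₂ n ⌋ ≡ k
log-unique k l u = ≤-antisym (log-≤ k u)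
  (subst (_≤ _) (⌊log₂[2^n]⌋≡n k) (⌊log₂⌋-mono-≤ l))

log-exists : ∀ n → ∃[ k ] 2 ^ k ≤ suc n × suc n < 2 ^ suc k
log-exists zero = 0 , ≤-refl , s≤s (s≤s z≤n)
log-exists (suc n) with log-exists n
... | k , l , u with suc (suc n) <? 2 ^ suc k
... | yes u′ = k , m≤n⇒m≤1+n l , u′
... | no ¬u′ = suc k , ≮⇒≥ ¬u′ , ≤-<-trans u (m<m+n (2 ^ suc k) (≤-trans (m^n>0 2 (suc k)) (m≤m+n _ 0)))

log-bounds : ∀ n .{{_ : NonZero n}} → 2 ^ ⌊log₂ n ⌋ ≤ n × n < 2 ^ suc ⌊log₂ n ⌋
log-bounds (suc n) with log-exists n
... | k , l , u rewrite log-unique k l u = l , u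

-- Exclusive or

parity<2 : ∀ x y → (x % 2 + y % 2) % 2 < 2
parity<2 x y = m%n<n (x % 2 + y % 2) 2

bitXor-< : ∀ B x y → bitXor B x y < 2 ^ B
bitXor-< zero    x y = ≤-refl
bitXor-< (suc B) x y = ≤-trans (+-monoˡ-≤ (2 * z) (parity<2 x y))
  (≤-trans (≤-reflexive (sym (*-suc 2 z))) (*-monoʳ-≤ 2 (bitXor-< B (x / 2) (y / 2))))
  where z = bitXor B (x / 2) (y / 2)

-- `bitXor` works bit by bit from the least significant end, so halving commutes with it; b halvings
-- leave a word of N bits.
bitXor-shift : ∀ b N x y → div2^ b (bitXor (b + N) x y) ≡ bitXor N (div2^ b x) (div2^ b y)
bitXor-shift zero N x y rewrite n/1≡n (bitXor N x y) | n/1≡n x | n/1≡n y = refl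
bitXor-shift (suc b) N x y = begin
  (bit + 2 * z) / (2 * 2 ^ b)             ≡⟨ m/n/o≡m/[n*o] (bit + 2 * z) 2 (2 ^ b) ⟨
  (bit + 2 * z) / 2 / 2 ^ b               ≡⟨ /-congˡ {o = 2 ^ b} half ⟩
  z / 2 ^ b                               ≡⟨ bitXor-shift b N (x / 2) (y / 2) ⟩
  bitXor N (x / 2 / 2 ^ b) (y / 2 / 2 ^ b)
    ≡⟨ cong₂ (bitXor N) (m/n/o≡m/[n*o] x 2 (2 ^ b)) (m/n/o≡m/[n*o] y 2 (2 ^ b)) ⟩
  bitXor N (x / (2 * 2 ^ b)) (y / (2 * 2 ^ b)) ∎
  where
  open ≡-Reasoning
  instance
    2^b≢0 : NonZero (2 ^ b)
    2^b≢0 = m^n≢0 2 b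
    2*2^b≢0 : NonZero (2 * 2 ^ b)
    2*2^b≢0 = m^n≢0 2 (suc b)
  bit = (x % 2 + y % 2) % 2
  z = bitXor (b + N) (x / 2) (y / 2)
  half : (bit + 2 * z) / 2 ≡ z
  half = /-unique (≤-trans (≤-reflexive (*-comm z 2)) (m≤n+m (2 * z) bit))
    (≤-trans (+-monoˡ-≤ (2 * z) (parity<2 x y)) (≤-reflexive (trans (sym (*-suc 2 z)) (*-comm 2 (suc z)))))

bitXor-self : ∀ B x → bitXor B x x ≡ 0
bitXor-self zero    x = refl
bitXor-self (suc B) x rewrite bitXor-self B (x / 2) | +-identityʳ ((x % 2 + x % 2) % 2) = even (x % 2) (m%n<n x 2)
  where
  even : ∀ b → b < 2 → (b + b) % 2 ≡ 0
  even zero       _ = refl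
  even (suc zero) _ = refl
  even (suc (suc b)) (s≤s (s≤s ()))

-- The bounds are essential: bits from position B on are invisible to `bitXor B`.
bitXor-zero : ∀ B {x y} → x < 2 ^ B → y < 2 ^ B → bitXor B x y ≡ 0 → x ≡ y
bitXor-zero zero    {zero} {zero} _ _ _ = refl
bitXor-zero zero    {suc _} (s≤s ()) _ _
bitXor-zero zero    {zero} {suc _} _ (s≤s ()) _
bitXor-zero (suc B) {x} {y} x< y< eq = begin
  x                   ≡⟨ m≡m%n+[m/n]*n x 2 ⟩
  x % 2 + x / 2 * 2   ≡⟨ cong₂ (λ b h → b + h * 2) bits halves ⟩
  y % 2 + y / 2 * 2   ≡⟨ m≡m%n+[m/n]*n y 2 ⟨
  y                   ∎
  where
  open ≡-Reasoning
  half< : ∀ {x} → x < 2 ^ suc B → x / 2 < 2 ^ B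
  half< {x} x< = m<n*o⇒m/o<n {x} {2 ^ B} {2} (subst (x <_) (*-comm 2 (2 ^ B)) x<)
  halves : x / 2 ≡ y / 2
  halves = bitXor-zero B (half< x<) (half< y<)
    (m+n≡0⇒m≡0 _ (m+n≡0⇒n≡0 ((x % 2 + y % 2) % 2) eq))
  bits : x % 2 ≡ y % 2
  bits = same (x % 2) (y % 2) (m%n<n x 2) (m%n<n y 2) (m+n≡0⇒m≡0 _ eq)
    where
    same : ∀ b c → b < 2 → c < 2 → (b + c) % 2 ≡ 0 → b ≡ c
    same zero zero _ _ _ = refl
    same (suc zero) (suc zero) _ _ _ = refl
    same zero (suc zero) _ _ ()
    same (suc zero) zero _ _ ()
    same (suc (suc b)) _ (s≤s (s≤s ())) _ _
    same _ (suc (suc c)) _ (s≤s (s≤s ())) _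

-- Longest common prefixes of packed words

length-unpack : ∀ b w x → length (unpack b w x) ≡ w
length-unpack b zero    x = refl
length-unpack b (suc w) x = trans (length-++ (unpack b w (div2^ b x)))
  (trans (cong (_+ 1) (length-unpack b w (div2^ b x))) (+-comm w 1))

lcp-self : ∀ xs → lcp xs xs ≡ length xs
lcp-self [] = refl
lcp-self (x ∷ xs) rewrite dec-true (x ≟ x) refl = cong suc (lcp-self xs)

lcp-∷ʳ : ∀ xs a c → a ≢ c → lcp (xs ∷ʳ a) (xs ∷ʳ c) ≡ length xs
lcp-∷ʳ [] a c a≢c rewrite dec-false (a ≟ c) a≢c = refl
lcp-∷ʳ (x ∷ xs) a c a≢c rewrite dec-true (x ≟ x) refl = cong suc (lcp-∷ʳ xs a c a≢c)

lcp-∷ʳ-< : ∀ xs ys a c → length xs ≡ length ys → lcp xs ys < length xs →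
  lcp (xs ∷ʳ a) (ys ∷ʳ c) ≡ lcp xs ys
lcp-∷ʳ-< (x ∷ xs) (y ∷ ys) a c len l< with x ≟ y
... | yes refl rewrite dec-true (x ≟ x) refl =
  cong suc (lcp-∷ʳ-< xs ys a c (suc-injective len) (≤-pred l<))
... | no x≢y rewrite dec-false (x ≟ y) x≢y = refl

leadingZeros-pos : ∀ B z .{{_ : NonZero z}} → leadingZeros B z ≡ B ∸ suc ⌊log₂ z ⌋
leadingZeros-pos B (suc z) = refl

leadingZeros-narrow : ∀ {k} B z → k ≤ B → leadingZeros B z ∸ (B ∸ k) ≡ leadingZeros k z
leadingZeros-narrow B zero    k≤B = m∸[m∸n]≡n k≤B
leadingZeros-narrow {k} B (suc z) k≤B = begin
  B ∸ s ∸ (B ∸ k)     ≡⟨ ∸-+-assoc B s (B ∸ k) ⟩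
  B ∸ (s + (B ∸ k))   ≡⟨ cong (B ∸_) (+-comm s (B ∸ k)) ⟩
  B ∸ ((B ∸ k) + s)   ≡⟨ ∸-+-assoc B (B ∸ k) s ⟨
  B ∸ (B ∸ k) ∸ s     ≡⟨ cong (_∸ s) (m∸[m∸n]≡n k≤B) ⟩
  k ∸ s               ∎
  where
  open ≡-Reasoning
  s = suc ⌊log₂ suc z ⌋

-- Induction on the number of characters, splitting off the last one, as `unpack` does. If the words
-- differ before it, dropping it changes neither side; otherwise the last character decides.
-- Dropping b bits also narrows the exclusive or, hence the general width N.
leadingZeros-xor : ∀ b w N {x y} .{{_ : NonZero b}} → w * b ≤ N → x < 2 ^ (w * b) → y < 2 ^ (w * b) →
  leadingZeros (w * b) (bitXor N x y) / b ≡ lcp (unpack b w x) (unpack b w y)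
leadingZeros-xor b zero N {zero} {zero} _ _ _ rewrite bitXor-self N 0 = 0/n≡0 b
leadingZeros-xor b zero N {suc _} _ (s≤s ()) _
leadingZeros-xor b zero N {zero} {suc _} _ _ (s≤s ())
leadingZeros-xor b (suc w) N {x} {y} fits x< y< = split (x′ ≟ y′)
  where
  x′ = div2^ b x
  y′ = div2^ b y
  xs = unpack b w x′
  ys = unpack b w y′
  N′ = N ∸ b
  N≡ : b + N′ ≡ N
  N≡ = m+[n∸m]≡n (≤-trans (m≤m+n b (w * b)) fits)
  high : ∀ {x} → x < 2 ^ (suc w * b) → div2^ b x < 2 ^ (w * b)
  high {x} x< = m<n*o⇒m/o<n {x} {2 ^ (w * b)} {2 ^ b} {{m^n≢0 2 b}}
    (subst (x <_) (trans (^-distribˡ-+-* 2 b (w * b)) (*-comm (2 ^ b) (2 ^ (w * b)))) x<)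
  fits′ : w * b ≤ N′
  fits′ = +-cancelˡ-≤ b _ _ (≤-trans fits (≤-reflexive (sym N≡)))
  z = bitXor N x y
  z′ = bitXor N′ x′ y′
  z/2^b : div2^ b z ≡ z′
  z/2^b = trans (cong (λ N → div2^ b (bitXor N x y)) (sym N≡)) (bitXor-shift b N′ x y)
  z< : z < suc z′ * 2 ^ b
  z< = subst (λ q → z < suc q * 2 ^ b) z/2^b (m<[1+m/n]*n z (2 ^ b) {{m^n≢0 2 b}})

  monus-< : ∀ {k l} → 0 < k → k ∸ suc l < k
  monus-< {suc k} {l} _ = s≤s (m∸n≤m k l)

  0<b : 0 < b
  0<b = >-nonZero⁻¹ b

  differ : x′ ≢ y′ → leadingZeros (suc w * b) z / b ≡ lcp (unpack b (suc w) x) (unpack b (suc w) y)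
  differ x′≢y′ = trans (/-congˡ shifted) (trans IH (sym (lcp-∷ʳ-< xs ys _ _
    (trans (length-unpack b w x′) (sym (length-unpack b w y′)))
    (subst (lcp xs ys <_) (sym (length-unpack b w x′)) lcp<w))))
    where
    IH : leadingZeros (w * b) z′ / b ≡ lcp xs ys
    IH = leadingZeros-xor b w N′ fits′ (high x<) (high y<)
    instance
      z′≢0 : NonZero z′
      z′≢0 = ≢-nonZero λ eq → x′≢y′ (bitXor-zero N′ (<-≤-trans (high x<) (^-monoʳ-≤ 2 fits′))
        (<-≤-trans (high y<) (^-monoʳ-≤ 2 fits′)) eq)
    l′ = ⌊log₂ z′ ⌋
    -- Since `z` divided by `2 ^ b` is `z′`, the leading bit of `z` lies exactly `b` places above
    -- that of `z′`.
    lower : 2 ^ (b + l′) ≤ z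
    lower = ≤-trans (≤-reflexive (trans (^-distribˡ-+-* 2 b l′) (*-comm (2 ^ b) (2 ^ l′))))
      (≤-trans (*-monoˡ-≤ (2 ^ b) (proj₁ (log-bounds z′)))
      (≤-trans (≤-reflexive (cong (_* 2 ^ b) (sym z/2^b))) (m/n*n≤m z (2 ^ b) {{m^n≢0 2 b}})))
    upper : z < 2 ^ suc (b + l′)
    upper = <-≤-trans z<
      (≤-trans (*-monoˡ-≤ (2 ^ b) (proj₂ (log-bounds z′)))
        (≤-reflexive (trans (*-comm (2 ^ suc l′) (2 ^ b))
          (trans (sym (^-distribˡ-+-* 2 b (suc l′))) (cong (2 ^_) (+-suc b l′))))))
    instance
      z≢0 : NonZero z
      z≢0 = >-nonZero (≤-trans (m^n>0 2 (b + l′)) lower)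
    shifted : leadingZeros (suc w * b) z ≡ leadingZeros (w * b) z′
    shifted = begin
      leadingZeros (b + w * b) z          ≡⟨ leadingZeros-pos (b + w * b) z ⟩
      (b + w * b) ∸ suc ⌊log₂ z ⌋         ≡⟨ cong (λ l → (b + w * b) ∸ suc l) (log-unique (b + l′) lower upper) ⟩
      (b + w * b) ∸ suc (b + l′)          ≡⟨ cong ((b + w * b) ∸_) (sym (+-suc b l′)) ⟩
      (b + w * b) ∸ (b + suc l′)          ≡⟨ [m+n]∸[m+o]≡n∸o b (w * b) (suc l′) ⟩
      w * b ∸ suc l′                      ≡⟨ leadingZeros-pos (w * b) z′ ⟨
      leadingZeros (w * b) z′             ∎
      where open ≡-Reasoning
    0<w*b : 0 < w * b
    0<w*b with w * b | high x< | high y<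
    ... | suc _ | _ | _ = z<s
    ... | zero | x′<1 | y′<1 = contradiction (trans (n<1⇒n≡0 x′<1) (sym (n<1⇒n≡0 y′<1))) x′≢y′
    lcp<w : lcp xs ys < w
    lcp<w = subst (_< w) IH (m<n*o⇒m/o<n {leadingZeros (w * b) z′} {w} {b}
      (subst (_< w * b) (sym (leadingZeros-pos (w * b) z′)) (monus-< 0<w*b)))

  alike : x′ ≡ y′ → ∀ ζ → z ≡ ζ → leadingZeros (suc w * b) ζ / b ≡ lcp (unpack b (suc w) x) (unpack b (suc w) y)
  alike x′≡y′ zero eq = trans (m*n/n≡m (suc w) b) (sym (trans (cong (lcp (unpack b (suc w) x) ∘ unpack b (suc w)) (sym x≡y))
    (trans (lcp-self (unpack b (suc w) x)) (length-unpack b (suc w) x))))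
    where
    x≡y : x ≡ y
    x≡y = bitXor-zero N (<-≤-trans x< (^-monoʳ-≤ 2 fits)) (<-≤-trans y< (^-monoʳ-≤ 2 fits)) eq
  -- Only the last character differs, so the exclusive or is positive and lives in the low `b` bits:
  -- its leading zeros are at least `w * b` and fewer than `suc w * b`.
  alike x′≡y′ ζ@(suc _) eq = trans (/-unique {q = w} above below)
    (sym (trans (cong (λ x′ → lcp (xs ∷ʳ mod2^ b x) (unpack b w x′ ∷ʳ mod2^ b y)) (sym x′≡y′))
                (trans (lcp-∷ʳ xs _ _ low≢) (length-unpack b w x′))))
    where
    ζ<2^b : ζ < 2 ^ b
    ζ<2^b = subst₂ _<_ eq (trans (cong (λ q → suc q * 2 ^ b) z′≡0) (*-identityˡ (2 ^ b))) z<
      where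
      z′≡0 : z′ ≡ 0
      z′≡0 = trans (cong (bitXor N′ x′) (sym x′≡y′)) (bitXor-self N′ x′)
    log<b : suc ⌊log₂ ζ ⌋ ≤ b
    log<b = bounded b 0<b ζ<2^b
      where
      bounded : ∀ b → 0 < b → ζ < 2 ^ b → suc ⌊log₂ ζ ⌋ ≤ b
      bounded (suc b) _ ζ< = s≤s (log-≤ b ζ<)
    low≢ : mod2^ b x ≢ mod2^ b y
    low≢ low≡ = 1+n≢0 (trans (sym eq) (trans (cong (bitXor N x) (sym x≡y)) (bitXor-self N x)))
      where
      x≡y : x ≡ y
      x≡y = trans (m≡m%n+[m/n]*n x (2 ^ b) {{m^n≢0 2 b}})
        (trans (cong₂ (λ r q → r + q * 2 ^ b) low≡ x′≡y′) (sym (m≡m%n+[m/n]*n y (2 ^ b) {{m^n≢0 2 b}})))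
    above : w * b ≤ (b + w * b) ∸ suc ⌊log₂ ζ ⌋
    above = ≤-trans (m≤n+m (w * b) (b ∸ suc ⌊log₂ ζ ⌋)) (≤-reflexive (sym (+-∸-comm (w * b) log<b)))
    below : (b + w * b) ∸ suc ⌊log₂ ζ ⌋ < suc w * b
    below = monus-< (≤-trans 0<b (m≤m+n b (w * b)))

  split : Dec (x′ ≡ y′) → leadingZeros (suc w * b) z / b ≡ lcp (unpack b (suc w) x) (unpack b (suc w) y)
  split (yes x′≡y′) = alike x′≡y′ z refl
  split (no x′≢y′)  = differ x′≢y′

xor-lcp : ∀ b w B {x y} .{{_ : NonZero b}} → w * b ≤ B → x < 2 ^ (w * b) → y < 2 ^ (w * b) →
  quotient (leadingZeros B (bitXor B x y) ∸ (B ∸ w * b)) b ≡ lcp (unpack b w x) (unpack b w y)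
xor-lcp b w B {x} {y} fits x< y< = trans (quotient≡/ _ b)
  (trans (/-congˡ (leadingZeros-narrow B (bitXor B x y) fits)) (leadingZeros-xor b w B fits x< y<))

-- Search trees in level order

module _ (t x : ℕ → ℕ) (d : ℕ)
  (tree : ∀ l m r → l + suc m ≡ d → r < 2 ^ l → t (2 ^ l + r) ≡ x ((2 * r + 1) * 2 ^ m ∸ 1))
  where

  -- Generalised from the root to all subtrees. Each of them misses the last of its `2 ^ m`
  -- consecutive indices: that value is stored in an ancestor, or lies beyond the last splitter.
  inorder-subtree : ∀ m l r → l + m ≡ d → r < 2 ^ l →
    inorder t m (2 ^ l + r) ≡ read x (r * 2 ^ m) (2 ^ m ∸ 1)
  inorder-subtree zero    l r eq r< = refl
  inorder-subtree (suc m) l r eq r< = begin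
    inorder t m (2 * (2 ^ l + r)) ++ t (2 ^ l + r) ∷ inorder t m (2 * (2 ^ l + r) + 1)
      ≡⟨ cong₂ (λ i j → inorder t m i ++ t (2 ^ l + r) ∷ inorder t m j) (left (2 ^ l) r) (right (2 ^ l) r) ⟩
    inorder t m (2 ^ suc l + 2 * r) ++ t (2 ^ l + r) ∷ inorder t m (2 ^ suc l + (2 * r + 1))
      ≡⟨ cong₂ _++_ (inorder-subtree m (suc l) (2 * r) eq′ (*-monoʳ-< 2 r<))
           (cong₂ _∷_ (tree l m r eq r<) (inorder-subtree m (suc l) (2 * r + 1) eq′ odd<)) ⟩
    read x (2 * r * w) (w ∸ 1) ++ read x ((2 * r + 1) * w ∸ 1) 1 ++ read x ((2 * r + 1) * w) (w ∸ 1)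
      ≡⟨ glue (2 ^ m) (m^n>0 2 m) ⟩
    read x (r * (2 * w)) (2 * w ∸ 1) ∎
    where
    open ≡-Reasoning
    w = 2 ^ m
    eq′ : suc l + m ≡ d
    eq′ = trans (sym (+-suc l m)) eq
    left : ∀ w r → 2 * (w + r) ≡ 2 * w + 2 * r
    left = solve-∀
    right : ∀ w r → 2 * (w + r) + 1 ≡ 2 * w + (2 * r + 1)
    right = solve-∀
    odd< : 2 * r + 1 < 2 ^ suc l
    odd< = ≤-trans (≤-reflexive (arrange r)) (*-monoʳ-≤ 2 r<)
      where
      arrange : ∀ r → suc (2 * r + 1) ≡ 2 * suc r
      arrange = solve-∀
    glue : ∀ w → 0 < w →
      read x (2 * r * w) (w ∸ 1) ++ read x ((2 * r + 1) * w ∸ 1) 1 ++ read x ((2 * r + 1) * w) (w ∸ 1)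
        ≡ read x (r * (2 * w)) (2 * w ∸ 1)
    -- With `suc c` in place of `2 ^ m` the truncated subtractions disappear, and the middle value
    -- continues the left subtree.
    glue (suc c) _ = begin
      read x (2 * r * suc c) c ++ read x ((2 * r + 1) * suc c ∸ 1) 1 ++ read x ((2 * r + 1) * suc c) c
        ≡⟨ cong₂ (λ i j → read x (2 * r * suc c) c ++ x i ∷ read x j c)
             (cong (_∸ 1) (middle r c)) (middle r c) ⟩
      read x (2 * r * suc c) c ++ read x (2 * r * suc c + c) (suc c)
        ≡⟨ read-++ x (2 * r * suc c) c (suc c) ⟨
      read x (2 * r * suc c) (c + suc c)
        ≡⟨ cong₂ (read x) (start r c) (size c) ⟩
      read x (r * (2 * suc c)) (2 * suc c ∸ 1) ∎
      where
      middle : ∀ r c → (2 * r + 1) * suc c ≡ suc (2 * r * suc c + c)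
      middle = solve-∀
      start : ∀ r c → 2 * r * suc c ≡ r * (2 * suc c)
      start = solve-∀
      size : ∀ c → c + suc c ≡ 2 * suc c ∸ 1
      size c = cong (λ k → c + suc k) (sym (+-identityʳ c))

  inorder-tree : inorder t d 1 ≡ read x 0 (2 ^ d ∸ 1)
  inorder-tree = inorder-subtree d 0 0 refl z<s

descend-< : ∀ t c m i → descend t c m i < 2 ^ m * suc i
descend-< t c zero    i = ≤-reflexive (sym (*-identityˡ (suc i)))
descend-< t c (suc m) i = <-≤-trans (descend-< t c m _)
  (≤-trans (*-monoʳ-≤ (2 ^ m) (s≤s (+-monoʳ-≤ (2 * i) ([]ᵇ≤1 (does (t i <? c))))))
    (≤-reflexive (arrange (2 ^ m) i)))
  where
  arrange : ∀ w i → w * suc (2 * i + 1) ≡ 2 * w * suc i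
  arrange = solve-∀

leaf-≤ : ∀ t c d v → suc v ≡ 2 ^ d → descend t c d 1 ∸ (v + 1) ≤ v
leaf-≤ t c d v eq = m≤n+o⇒m∸n≤o (descend t c d 1) (v + 1) {v}
  (≤-pred (≤-trans (descend-< t c d 1) (≤-reflexive (trans (cong (_* 2) (sym eq)) (arrange v)))))
  where
  arrange : ∀ v → suc v * 2 ≡ suc (v + 1 + v)
  arrange = solve-∀

-- A leaf i < v contributes the buckets 2 i and 2 i + 1, the last leaf only 2 v.
bucket-< : ∀ x t d v c → suc v ≡ 2 ^ d → bucket x t d v c < 2 * v + 1
bucket-< x t d v c eq with descend t c d 1 ∸ (v + 1) | leaf-≤ t c d v eq
... | i | i≤v with i <? v
... | yes i<v rewrite dec-true (i <? v) i<v = begin-strict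
  2 * i + _  ≤⟨ +-monoʳ-≤ (2 * i) ([]ᵇ≤1 _) ⟩
  2 * i + 1  <⟨ n<1+n _ ⟩
  suc (2 * i + 1) ≡⟨ arrange i ⟩
  2 * suc i  ≤⟨ *-monoʳ-≤ 2 i<v ⟩
  2 * v      ≤⟨ m≤m+n (2 * v) 1 ⟩
  2 * v + 1  ∎
  where
  open ≤-Reasoning
  arrange : ∀ i → suc (2 * i + 1) ≡ 2 * suc i
  arrange = solve-∀
... | no i≮v rewrite dec-false (i <? v) i≮v = begin-strict
  2 * i + 0  ≡⟨ +-identityʳ (2 * i) ⟩
  2 * i      ≤⟨ *-monoʳ-≤ 2 i≤v ⟩
  2 * v      <⟨ n<1+n _ ⟩
  suc (2 * v) ≡⟨ +-comm 1 (2 * v) ⟩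
  2 * v + 1  ∎
  where open ≤-Reasoning

-- Ranks within the classes of a classification

module Ranks (key : ℕ → ℕ) where

  rank : ℕ → ℕ → ℕ
  rank k zero    = 0
  rank k (suc j) = rank k j + [ does (key j ≟ k) ]ᵇ

  rank-hit : ∀ j {k} → key j ≡ k → rank k (suc j) ≡ suc (rank k j)
  rank-hit j {k} eq rewrite dec-true (key j ≟ k) eq = +-comm (rank k j) 1

  rank-miss : ∀ j {k} → key j ≢ k → rank k (suc j) ≡ rank k j
  rank-miss j {k} neq rewrite dec-false (key j ≟ k) neq = +-identityʳ (rank k j)

  rank-mono : ∀ {k x y} → x ≤ y → rank k x ≤ rank k y
  rank-mono {k} x≤y = go (≤⇒≤′ x≤y)
    where
    go : ∀ {x y} → x ≤′ y → rank k x ≤ rank k y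
    go (≤′-reflexive refl) = ≤-refl
    go (≤′-step x≤y) = ≤-trans (go x≤y) (m≤m+n _ _)

  rank-< : ∀ {j x} → j < x → rank (key j) j < rank (key j) x
  rank-< {j} j<x = ≤-trans (≤-reflexive (sym (rank-hit j refl))) (rank-mono j<x)

  rank-const : ∀ {k x y} → x ≤ y → (∀ j → x ≤ j → j < y → key j ≢ k) → rank k y ≡ rank k x
  rank-const {k} {x} x≤y = go (≤⇒≤′ x≤y)
    where
    go : ∀ {y} → x ≤′ y → (∀ j → x ≤ j → j < y → key j ≢ k) → rank k y ≡ rank k x
    go (≤′-reflexive refl) _ = refl
    go {suc y} (≤′-step x≤y) miss = trans (rank-miss y (miss y (≤′⇒≤ x≤y) ≤-refl))
      (go x≤y λ j x≤j j<y → miss j x≤j (m<n⇒m<1+n j<y))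

  rank-find : ∀ {k} x {i} → i < rank k x → ∃[ j ] j < x × key j ≡ k × rank k j ≡ i
  rank-find {k} (suc x) {i} i< with key x ≟ k
  ... | no neq with rank-find x (subst (i <_) (rank-miss x neq) i<)
  ... | j , j<x , eqs = j , m<n⇒m<1+n j<x , eqs
  rank-find {k} (suc x) {i} i< | yes eq with i ≟ rank k x
  ... | yes refl = x , n<1+n x , eq , refl
  ... | no i≢ with rank-find x (≤∧≢⇒< (≤-pred (subst (i <_) (rank-hit x eq) i<)) i≢)
  ... | j , j<x , eqs = j , m<n⇒m<1+n j<x , eqs

  -- The induction carries the sharper bound `x ∸ k * w`: the class is empty before its chunk and
  -- gains at most one element per position afterwards. At the last member of the class this is at
  -- most `w`.
  rank-chunk : ∀ {w k} x → (∀ j → key j ≡ k → InChunk w k j) → rank k x ≤ w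
  rank-chunk {w} {k} x chunk = proj₂ (go x)
    where
    go : ∀ x → rank k x ≤ x ∸ k * w × rank k x ≤ w
    go zero = z≤n , z≤n
    go (suc x) with key x ≟ k
    ... | no neq = ≤-trans (≤-reflexive (rank-miss x neq)) (≤-trans (proj₁ (go x)) (∸-monoˡ-≤ (k * w) (n≤1+n x)))
                 , ≤-trans (≤-reflexive (rank-miss x neq)) (proj₂ (go x))
    ... | yes eq = bound , ≤-trans bound (m≤n+o⇒m∸n≤o (suc x) (k * w) {w}
                     (≤-trans (proj₂ (chunk x eq)) (≤-reflexive (+-comm w (k * w)))))
      where
      bound : rank k (suc x) ≤ suc x ∸ k * w
      bound = ≤-trans (≤-reflexive (rank-hit x eq))
        (≤-trans (s≤s (proj₁ (go x))) (≤-reflexive (sym (+-∸-assoc 1 (proj₁ (chunk x eq))))))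

  numbers : ℕ → List ℕ
  numbers = read id 0

  numbers-suc : ∀ x → numbers (suc x) ≡ numbers x ++ [ x ]
  numbers-suc x = trans (cong numbers (+-comm 1 x)) (read-++ id 0 x 1)

  class : ℕ → ℕ → List ℕ
  class k x = filter (λ j → key j ≟ k) (numbers x)

  class-hit : ∀ x {k} → key x ≡ k → class k (suc x) ≡ class k x ++ [ x ]
  class-hit x {k} eq = trans (cong (filter (λ j → key j ≟ k)) (numbers-suc x))
    (trans (filter-++ (λ j → key j ≟ k) (numbers x) [ x ])
           (cong (class k x ++_) (filter-all (λ j → key j ≟ k) (eq ∷ []))))

  class-miss : ∀ x {k} → key x ≢ k → class k (suc x) ≡ class k x
  class-miss x {k} neq = trans (cong (filter (λ j → key j ≟ k)) (numbers-suc x))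
    (trans (filter-++ (λ j → key j ≟ k) (numbers x) [ x ])
      (trans (cong (class k x ++_) (filter-none (λ j → key j ≟ k) (neq ∷ []))) (++-identityʳ _)))

  length-class : ∀ k x → length (class k x) ≡ rank k x
  length-class k zero = refl
  length-class k (suc x) with key x ≟ k
  ... | yes eq = trans (cong length (class-hit x eq)) (trans (length-++ (class k x))
                   (trans (cong (_+ 1) (length-class k x)) (trans (+-comm _ 1) (sym (rank-hit x eq)))))
  ... | no neq = trans (cong length (class-miss x neq)) (trans (length-class k x) (sym (rank-miss x neq)))

  below : ℕ → List ℕ → List ℕ
  below k = filter (λ j → key j <? k)

  below-suc : ∀ k xs → below (suc k) xs ↭ below k xs ++ filter (λ j → key j ≟ k) xs
  below-suc k [] = ↭-refl
  below-suc k (x ∷ xs) with key x ≟ k | key x <? k | key x <? suc k | below-suc k xs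
  ... | yes eq | yes lt | _ | _ = contradiction eq (<⇒≢ lt)
  ... | yes eq | no ≮ | yes lt | ih
    rewrite dec-true (key x ≟ k) eq | dec-false (key x <? k) ≮ | dec-true (key x <? suc k) lt =
    ↭-trans (prep x ih) (↭-sym (shift x (below k xs) _))
  ... | yes eq | no ≮ | no ≮suc | _ = contradiction (s≤s (≤-reflexive eq)) ≮suc
  ... | no neq | yes lt | yes lt′ | ih
    rewrite dec-false (key x ≟ k) neq | dec-true (key x <? k) lt | dec-true (key x <? suc k) lt′ = prep x ih
  ... | no neq | yes lt | no ≮suc | _ = contradiction (m<n⇒m<1+n lt) ≮suc
  ... | no neq | no ≮ | yes lt | _ = contradiction (≤∧≢⇒< (≤-pred lt) neq) ≮
  ... | no neq | no ≮ | no ≮suc | ih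
    rewrite dec-false (key x ≟ k) neq | dec-false (key x <? k) ≮ | dec-false (key x <? suc k) ≮suc = ih

  -- The output position at which class `k` begins; `length-below` identifies it with the number of
  -- elements of smaller key.
  start : ℕ → ℕ → ℕ
  start x = sumTo (λ k → rank k x)

  below-zero : ∀ xs → below 0 xs ≡ []
  below-zero [] = refl
  below-zero (x ∷ xs) = below-zero xs

  length-below : ∀ x k → length (below k (numbers x)) ≡ start x k
  length-below x zero = cong length (below-zero (numbers x))
  length-below x (suc k) = trans (↭-length (below-suc k (numbers x)))
    (trans (length-++ (below k (numbers x))) (cong₂ _+_ (length-below x k) (length-class k x)))

  length-numbers : ∀ i x → length (read id i x) ≡ x
  length-numbers i zero    = refl
  length-numbers i (suc x) = cong suc (length-numbers (suc i) x)

  start-≤ : ∀ x k → start x k ≤ x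
  start-≤ x k = ≤-trans (≤-reflexive (sym (length-below x k)))
    (≤-trans (length-filter (λ j → key j <? k) (numbers x)) (≤-reflexive (length-numbers 0 x)))

  start-mono : ∀ {x k k′} → k ≤ k′ → start x k ≤ start x k′
  start-mono {x} k≤k′ = go (≤⇒≤′ k≤k′)
    where
    go : ∀ {k k′} → k ≤′ k′ → start x k ≤ start x k′
    go (≤′-reflexive refl) = ≤-refl
    go (≤′-step k≤k′) = ≤-trans (go k≤k′) (m≤m+n _ _)

  -- Serves twice: positions are injective, and every output cell has only one owner.
  start-unique : ∀ {x k k′ i} → start x k ≤ i → i < start x (suc k) →
    start x k′ ≤ i → i < start x (suc k′) → k ≡ k′
  start-unique {x} {k} {k′} l u l′ u′ = ≤-antisym (before {k} {k′} l u′) (before {k′} {k} l′ u)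
    where
    before : ∀ {k k′ i} → start x k ≤ i → i < start x (suc k′) → k ≤ k′
    before {k} {k′} l u with k ≤? k′
    ... | yes k≤k′ = k≤k′
    ... | no k≰k′ = contradiction (≤-<-trans (≤-trans (start-mono {x} (≰⇒> k≰k′)) l) u) (<-irrefl refl)

  module _ (x : ℕ) (out : ℕ → ℕ)
    (placed : ∀ j → j < x → out (start x (key j) + rank (key j) j) ≡ j) where

    -- Ranks number a class in increasing order from 0, so its members fill its segment without
    -- gaps.
    segment : ∀ k y → y ≤ x → read out (start x k) (rank k y) ≡ class k y
    segment k zero    _   = refl
    segment k (suc y) y<x with key y ≟ k
    ... | no neq = trans (cong (read out (start x k)) (rank-miss y neq))
                     (trans (segment k y (<⇒≤ y<x)) (sym (class-miss y neq)))
    ... | yes refl = trans (cong (read out (start x k)) (trans (rank-hit y refl) (+-comm 1 (rank k y))))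
                     (trans (read-++ out (start x k) (rank k y) 1)
                     (trans (cong₂ _++_ (segment k y (<⇒≤ y<x)) (cong [_] (placed y y<x)))
                            (sym (class-hit y refl))))

    -- The output is the concatenation of the segments of all classes, so the permutation arises
    -- class by class and no inverse map is constructed.
    placed-↭ : ∀ k → read out 0 (start x k) ↭ below k (numbers x)
    placed-↭ zero = ↭-reflexive (sym (below-zero (numbers x)))
    placed-↭ (suc k) = ↭-trans (↭-reflexive (read-++ out 0 (start x k) (rank k x)))
      (↭-trans (++⁺ (placed-↭ k) (↭-reflexive (segment k x ≤-refl))) (↭-sym (below-suc k (numbers x))))

  -- Separates the strings from the padding, which follows them in position and in key.
  below-prefix : ∀ {k} n x → n ≤ x → (∀ j → j < n → key j < k) → (∀ j → n ≤ j → j < x → k ≤ key j) →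
    below k (numbers x) ≡ numbers n
  below-prefix {k} n x n≤x small large = trans (cong (below k) (trans (cong numbers (sym (m+[n∸m]≡n n≤x)))
      (read-++ id 0 n (x ∸ n))))
    (trans (filter-++ (λ j → key j <? k) (numbers n) (read id n (x ∸ n)))
      (trans (cong₂ _++_
        (filter-all (λ j → key j <? k) (all-read 0 n λ j _ j<n → small j j<n))
        (filter-none (λ j → key j <? k) (all-read n (x ∸ n) λ j n≤j j< →
           ≤⇒≯ (large j n≤j (subst (j <_) (m+[n∸m]≡n n≤x) j<)))))
      (++-identityʳ _)))
    where
    all-read : ∀ {P : ℕ → Set} i n → (∀ j → i ≤ j → j < i + n → P j) → All P (read id i n)
    all-read i zero    _ = []
    all-read i (suc n) p = p i ≤-refl (m<m+n i z<s) ∷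
      all-read (suc i) n λ j i<j j< → p j (<⇒≤ i<j) (subst (j <_) (sym (+-suc i n)) j<)

  length-filter-allFin : ∀ {n k} {P : Fin n → Set} (P? : Decidable P) →
    (∀ j → P j → key (toℕ j) ≡ k) → (∀ j → key (toℕ j) ≡ k → P j) →
    length (filter P? (allFin n)) ≡ rank k n
  length-filter-allFin {n} {k} P? to from = trans (transfer (allFin n))
    (trans (cong (length ∘ filter (λ j → key j ≟ k)) (trans (map-tabulate id toℕ) (tabulate-toℕ n 0)))
           (length-class k n))
    where
    transfer : ∀ xs → length (filter P? xs) ≡ length (filter (λ j → key j ≟ k) (map toℕ xs))
    transfer [] = refl
    transfer (x ∷ xs) with P? x | key (toℕ x) ≟ k
    ... | yes px | yes eq rewrite dec-true (key (toℕ x) ≟ k) eq = cong suc (transfer xs)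
    ... | no ¬px | no neq rewrite dec-false (key (toℕ x) ≟ k) neq = transfer xs
    ... | yes px | no neq = contradiction (to x px) neq
    ... | no ¬px | yes eq = contradiction (from x eq) ¬px
    tabulate-toℕ : ∀ n i → tabulate {n = n} (λ j → i + toℕ j) ≡ read id i n
    tabulate-toℕ zero    i = refl
    tabulate-toℕ (suc n) i = cong₂ _∷_ (+-identityʳ i)
      (trans (tabulate-cong (λ j → +-suc i (toℕ j))) (tabulate-toℕ n (suc i)))

-- Words of characters

-- Generalised over the accumulator of the left fold; a packed word is the case `x = 0`.
pack-< : ∀ b x xs → All (_< 2 ^ b) xs →
  foldl (λ x c → x * 2 ^ b + c) x xs < suc x * 2 ^ (length xs * b)
pack-< b x [] [] = ≤-reflexive (sym (*-identityʳ (suc x)))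
pack-< b x (c ∷ xs) (c< ∷ xs<) = <-≤-trans (pack-< b (x * 2 ^ b + c) xs xs<)
  (≤-trans (*-monoˡ-≤ (2 ^ (length xs * b))
             (≤-trans (≤-reflexive (sym (+-suc (x * 2 ^ b) c)))
             (≤-trans (+-monoʳ-≤ (x * 2 ^ b) c<) (≤-reflexive (+-comm (x * 2 ^ b) (2 ^ b))))))
    (≤-reflexive (trans (*-assoc (suc x) (2 ^ b) _)
      (cong (suc x *_) (sym (^-distribˡ-+-* 2 b (length xs * b)))))))

module _ {α : ℕ} (I : Instance α) where
  open Instance I
  open Env env

  window-bounded : ∀ i j → All (_< 2 ^ b) (window w i (strings j))
  window-bounded i j = Allₚ.take⁺ w (Allₚ.++⁺ (Allₚ.drop⁺ i (Allₚ.map⁺ (bounded (strings j))))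
    (Allₚ.replicate⁺ w (m^n>0 2 b)))
    where
    bounded : ∀ (s : Str σ) → All (λ c → suc (toℕ c) < 2 ^ b) s
    bounded [] = []
    bounded (c ∷ s) = ≤-<-trans (toℕ<n c) σ<2^b ∷ bounded s

  length-window : ∀ i j → length (window w i (strings j)) ≡ w
  length-window i j = trans (length-take w _) (m≤n⇒m⊓n≡m
    (≤-trans (≤-reflexive (sym (length-replicate w)))
      (≤-trans (m≤n+m _ (length (drop i (codes (strings j)))))
        (≤-reflexive (sym (length-++ (drop i (codes (strings j)))))))))

  charsOf-< : ∀ i j → charsOf i j < 2 ^ (w * b)
  charsOf-< i j = subst (λ k → charsOf i j < 2 ^ (k * b)) (length-window i j)
    (<-≤-trans (pack-< b 0 (window w i (strings j)) (window-bounded i j)) (≤-reflexive (*-identityˡ _)))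

  charWord-< : ∀ j i → charWord j i < 2 ^ (w * b)
  charWord-< j i with j <? n
  ... | yes j<n = charsOf-< i (fromℕ< j<n)
  ... | no  _   = m^n>0 2 (w * b)

  charWord-string : ∀ i j → charWord (toℕ j) i ≡ charsOf i j
  charWord-string i j with toℕ j <? n
  ... | yes j<n = cong (charsOf i) (fromℕ<-toℕ j j<n)
  ... | no  j≮n = contradiction (toℕ<n j) j≮n

  random-≤ : ∀ k → random k ≤ n
  random-≤ k with k <? a
  ... | yes k<a = <⇒≤ (toℕ<n (draws (fromℕ< k<a)))
  ... | no  _   = z≤n

  random-draw : ∀ k → random (toℕ k) ≡ toℕ (draws k)
  random-draw k with toℕ k <? a
  ... | yes k<a = cong (toℕ ∘ draws) (fromℕ<-toℕ k k<a)
  ... | no  k≮a = contradiction (toℕ<n k) k≮a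

  sampled : ℕ → ℕ
  sampled i = charWord (random i) h

-- Sizes of the arrays

n<2^n : ∀ n → n < 2 ^ n
n<2^n zero    = z<s
n<2^n (suc n) = ≤-trans (s≤s (n<2^n n)) (≤-trans (+-monoˡ-≤ (2 ^ n) (m^n>0 2 n))
  (≤-reflexive (cong (2 ^ n +_) (sym (+-identityʳ (2 ^ n))))))

-- The sample of size a is sorted at the end of A = off + a cells, a power of two
-- as the merge sort needs it: the zeros in front of it are least and stay there.
record Sized {α : ℕ} (I : Instance α) : Set where
  open Instance I
  field
    U A L K lam Λ off γ : ℕ
    15U<2^B : 15 * U < 2 ^ B
    1≤α     : 1 ≤ α
    0<n     : 0 < n
    A≡      : A ≡ 2 ^ (d + α)
    off≡    : off ≡ A ∸ a
    off+a   : off + a ≡ A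
    U≡      : U ≡ n + (A * p + A * p)
    L≡      : L ≡ (n + (p ∸ 1)) / p
    n≤L*p   : n ≤ L * p
    L*p<U   : L * p < U
    K≡      : K ≡ (v + 1) + (v + 1)
    K*p<U   : K * p < U
    Λ≡      : Λ ≡ 2 ^ lam
    p≤Λ     : p ≤ Λ
    Λ≤2p    : Λ ≤ 2 * p
    lam≡    : lam ≡ suc ⌊log₂ p ⌋
    2Λ<U    : 2 * Λ < U
    merges<U : p * (A + A) < U
    γ≡      : γ ≡ B ∸ w * b

module Sizes {α : ℕ} (I : Instance α) (1≤α : 1 ≤ α) (0<n : 0 < Instance.n I) where
  open Instance I

  -- a < α 2 ^ d ≤ 2 ^ α 2 ^ d, so `A₀` has room for the sample and, for constant α, exceeds v only
  -- by a constant factor; doubling alone computes it. One size `U₀` fits all arrays: 2 A p covers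
  -- the surplus merges, the counters and the processor tree, and n > 0 makes these bounds strict.
  A₀ U₀ : ℕ
  A₀ = 2 ^ (d + α)
  U₀ = n + (A₀ * p + A₀ * p)

  private
    2^d≡suc : 2 ^ d ≡ suc v
    2^d≡suc = sym (m+[n∸m]≡n (m^n>0 2 d))

    1≤p : 0 < p
    1≤p = >-nonZero⁻¹ p

    A*p<U : A₀ * p < U₀
    A*p<U = ≤-trans (s≤s (m≤m+n (A₀ * p) (A₀ * p))) (+-monoˡ-≤ (A₀ * p + A₀ * p) 0<n)

    2*2^d≤A₀ : 2 * 2 ^ d ≤ A₀
    2*2^d≤A₀ = ^-monoʳ-≤ 2 (≤-trans (≤-reflexive (+-comm 1 d)) (+-monoʳ-≤ d 1≤α))

    4≤A : 4 ≤ A₀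
    4≤A = ^-monoʳ-≤ 2 (+-mono-≤ 1≤d 1≤α)

    a<A : a < A₀
    a<A = begin-strict
      α * v + (α ∸ 1)   <⟨ +-monoʳ-< (α * v) (≤-reflexive (m+[n∸m]≡n 1≤α)) ⟩
      α * v + α         ≡⟨ trans (+-comm (α * v) α) (sym (*-suc α v)) ⟩
      α * suc v         ≡⟨ cong (α *_) (sym 2^d≡suc) ⟩
      α * 2 ^ d         ≤⟨ *-monoˡ-≤ (2 ^ d) (<⇒≤ (n<2^n α)) ⟩
      2 ^ α * 2 ^ d     ≡⟨ trans (*-comm (2 ^ α) (2 ^ d)) (sym (^-distribˡ-+-* 2 d α)) ⟩
      A₀                ∎
      where open ≤-Reasoning

    L₀ = (n + (p ∸ 1)) / p

    suc-pred-p : suc (p ∸ 1) ≡ p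
    suc-pred-p = m+[n∸m]≡n 1≤p

    n≤L₀*p : n ≤ L₀ * p
    n≤L₀*p = +-cancelʳ-≤ p n (L₀ * p) (begin
      n + p              ≡⟨ cong (n +_) (sym suc-pred-p) ⟩
      n + suc (p ∸ 1)    ≡⟨ +-suc n (p ∸ 1) ⟩
      suc (n + (p ∸ 1))  ≤⟨ m<[1+m/n]*n (n + (p ∸ 1)) p ⟩
      p + L₀ * p         ≡⟨ +-comm p (L₀ * p) ⟩
      L₀ * p + p         ∎)
      where open ≤-Reasoning

    L₀*p<U : L₀ * p < U₀
    L₀*p<U = begin-strict
      L₀ * p             ≤⟨ m/n*n≤m (n + (p ∸ 1)) p ⟩
      n + (p ∸ 1)        <⟨ +-monoʳ-< n (≤-reflexive suc-pred-p) ⟩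
      n + p              ≤⟨ +-monoʳ-≤ n (≤-trans (m≤n*m p A₀ {{>-nonZero (≤-trans (s≤s z≤n) 4≤A)}}) (m≤m+n (A₀ * p) (A₀ * p))) ⟩
      U₀                 ∎
      where open ≤-Reasoning

    p-bounds = log-bounds p

  lam₀ : ℕ
  lam₀ = suc ⌊log₂ p ⌋

  2^lam≤2p : 2 ^ lam₀ ≤ 2 * p
  2^lam≤2p = *-monoʳ-≤ 2 (proj₁ p-bounds)

  sized : 15 * U₀ < 2 ^ B → Sized I
  sized fits = record
    { U = U₀ ; A = A₀ ; L = L₀ ; K = (v + 1) + (v + 1) ; lam = lam₀ ; Λ = 2 ^ lam₀ ; off = A₀ ∸ a ; γ = B ∸ w * b
    ; 15U<2^B = fits ; 1≤α = 1≤α ; 0<n = 0<n ; A≡ = refl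
    ; off≡ = refl ; off+a = m∸n+n≡m (<⇒≤ a<A)
    ; U≡ = refl
    ; L≡ = refl ; n≤L*p = n≤L₀*p ; L*p<U = L₀*p<U
    ; K≡ = refl
    ; K*p<U = ≤-<-trans (*-monoˡ-≤ p (≤-trans (≤-reflexive K≡) 2*2^d≤A₀)) A*p<U
    ; Λ≡ = refl ; p≤Λ = <⇒≤ (proj₂ p-bounds) ; Λ≤2p = 2^lam≤2p ; lam≡ = refl
    ; 2Λ<U = ≤-<-trans (≤-trans (*-monoʳ-≤ 2 2^lam≤2p) (≤-trans (≤-reflexive (sym (*-assoc 2 2 p))) (*-monoˡ-≤ p 4≤A))) A*p<U
    ; merges<U = ≤-trans (s≤s (≤-reflexive (trans (*-comm p (A₀ + A₀)) (*-distribʳ-+ p A₀ A₀)))) (+-monoˡ-≤ (A₀ * p + A₀ * p) 0<n)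
    ; γ≡ = refl }
    where
    K≡ : (v + 1) + (v + 1) ≡ 2 * 2 ^ d
    K≡ = trans (arrange v) (cong (2 *_) (sym 2^d≡suc))
      where
      arrange : ∀ v → (v + 1) + (v + 1) ≡ 2 * suc v
      arrange = solve-∀

-- Alternating sort buffers, and arithmetic for the invariants

mutual
  -- Mutual recursion makes the arrays of level `suc i` reduce to the swapped arrays of level `i`,
  -- exactly as the control registers are swapped.
  srcArray dstArray : ℕ → ℕ
  srcArray zero    = 1
  srcArray (suc i) = dstArray i
  dstArray zero    = 2
  dstArray (suc i) = srcArray i

alternating : ∀ i → (srcArray i ≡ 1 × dstArray i ≡ 2) ⊎ (srcArray i ≡ 2 × dstArray i ≡ 1)
alternating zero = inj₁ (refl , refl)
alternating (suc i) with alternating i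
... | inj₁ (s≡ , d≡) = inj₂ (d≡ , s≡)
... | inj₂ (s≡ , d≡) = inj₁ (d≡ , s≡)

src≤2 : ∀ i → srcArray i ≤ 2
src≤2 i with alternating i
... | inj₁ (s≡ , _) rewrite s≡ = s≤s z≤n
... | inj₂ (s≡ , _) rewrite s≡ = ≤-refl

dst≤2 : ∀ i → dstArray i ≤ 2
dst≤2 i = src≤2 (suc i)

src≢dst : ∀ i → srcArray i ≢ dstArray i
src≢dst i eq with alternating i
... | inj₁ (s≡ , d≡) = contradiction (trans (sym s≡) (trans eq d≡)) λ ()
... | inj₂ (s≡ , d≡) = contradiction (trans (sym s≡) (trans eq d≡)) λ ()

quotient-≤ : ∀ x y → quotient x y ≤ x
quotient-≤ x zero    = z≤n
quotient-≤ x (suc y) = m/n≤m x (suc y)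

-- The logarithm of a node number is the level of the node.
level-unique : ∀ {l r l′ r′} → r < 2 ^ l → r′ < 2 ^ l′ → 2 ^ l + r ≡ 2 ^ l′ + r′ → l ≡ l′ × r ≡ r′
level-unique {l} {r} {l′} {r′} r< r′< eq = l≡l′ , +-cancelˡ-≡ (2 ^ l) r r′
  (trans eq (cong (λ k → 2 ^ k + r′) (sym l≡l′)))
  where
  log : ∀ {l r} → r < 2 ^ l → ⌊log₂ (2 ^ l + r) ⌋ ≡ l
  log {l} {r} r< = log-unique l (m≤m+n (2 ^ l) r)
    (<-≤-trans (+-monoʳ-< (2 ^ l) r<) (≤-reflexive (cong (2 ^ l +_) (sym (+-identityʳ (2 ^ l))))))
  l≡l′ : l ≡ l′
  l≡l′ = trans (sym (log {l} r<)) (trans (cong ⌊log₂_⌋ eq) (log {l′} r′<))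

right-child : ∀ t c i → (i + i + 1) ∸ [ does (c ≤? t) ]ᵇ ≡ 2 * i + [ does (t <? c) ]ᵇ
right-child t c i with c ≤? t
... | yes c≤t rewrite dec-true (c ≤? t) c≤t | dec-false (t <? c) (≤⇒≯ c≤t) =
  trans (m+n∸n≡m (i + i) 1) (trans (cong (i +_) (trans (sym (+-identityʳ i)) (sym (+-identityʳ (i + 0)))))
    (sym (+-assoc i (i + 0) 0)))
... | no c≰t rewrite dec-false (c ≤? t) c≰t | dec-true (t <? c) (≰⇒> c≰t) =
  cong (λ k → i + k + 1) (sym (+-identityʳ i))

[]ᵇ-∧ : ∀ x y → [ x ]ᵇ * [ y ]ᵇ ≡ [ x ∧ y ]ᵇ
[]ᵇ-∧ false y = refl
[]ᵇ-∧ true  y = +-identityʳ [ y ]ᵇ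

halve : ∀ n → ∃[ q ] (n ≡ 2 * q ⊎ n ≡ suc (2 * q))
halve zero = 0 , inj₁ refl
halve (suc n) with halve n
... | q , inj₁ eq = q , inj₂ (cong suc eq)
... | q , inj₂ eq = suc q , inj₁ (trans (cong suc eq) (sym (*-suc 2 q)))

quotient-2^ : ∀ r → quotient (2 ^ suc r) 2 ≡ 2 ^ r
quotient-2^ r = trans (cong (_/ 2) (*-comm 2 (2 ^ r))) (m*n/n≡m (2 ^ r) 2)

All-read : ∀ {P : ℕ → Set} {f} i n → All P (read f i n) → ∀ j → j < n → P (f (i + j))
All-read {P} {f} i (suc n) (px ∷ _)  zero    _        = subst (P ∘ f) (sym (+-identityʳ i)) px
All-read {P} {f} i (suc n) (_ ∷ pxs) (suc j) (s≤s j<) = subst (P ∘ f) (sym (+-suc i j)) (All-read (suc i) n pxs j j<)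

read-All : ∀ {P : ℕ → Set} {f} i n → (∀ j → j < n → P (f (i + j))) → All P (read f i n)
read-All i zero _ = []
read-All {P} {f} i (suc n) p = subst (P ∘ f) (+-identityʳ i) (p 0 z<s) ∷
  read-All (suc i) n λ j j< → subst (P ∘ f) (+-suc i j) (p (suc j) (s≤s j<))

sum-read : ∀ f k → sum (read f 0 k) ≡ sumTo f k
sum-read f zero    = refl
sum-read f (suc k) = trans (cong sum (trans (cong (read f 0) (+-comm 1 k)) (read-++ f 0 k 1)))
  (trans (sum-++ (read f 0 k) [ f k ]) (cong₂ _+_ (sum-read f k) (+-identityʳ (f k))))

sumTo-cong : ∀ {f g} k → (∀ i → i < k → f i ≡ g i) → sumTo f k ≡ sumTo g k
sumTo-cong zero    eq = refl
sumTo-cong (suc k) eq = cong₂ _+_ (sumTo-cong k λ i i<k → eq i (m<n⇒m<1+n i<k)) (eq k ≤-refl)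

map-allFin≡read : ∀ {n} (g : Fin n → ℕ) f → (∀ j → g j ≡ f (toℕ j)) → map g (allFin n) ≡ read f 0 n
map-allFin≡read {n} g f eq = trans (map-tabulate id g) (go n g 0 eq)
  where
  go : ∀ n (g : Fin n → ℕ) i → (∀ j → g j ≡ f (i + toℕ j)) → tabulate g ≡ read f i n
  go zero    g i eq = refl
  go (suc n) g i eq = cong₂ _∷_ (trans (eq fzero) (cong f (+-identityʳ i)))
    (go n (g ∘ fsuc) (suc i) λ j → trans (eq (fsuc j)) (cong f (+-suc i (toℕ j))))

descend-cong : ∀ {t t′ : ℕ → ℕ} {N} c m i → (∀ j → j < N → t j ≡ t′ j) → 2 ^ m * suc i ≤ N →
  descend t c m i ≡ descend t′ c m i
descend-cong c zero i eq bound = refl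
descend-cong {t} {t′} c (suc m) i eq bound = trans
  (cong (λ y → descend t c m (2 * i + [ does (y <? c) ]ᵇ)) (eq i (<-≤-trans (m≤n*m (suc i) (2 ^ suc m) {{m^n≢0 2 (suc m)}}) bound)))
  (descend-cong c m _ eq (≤-trans (*-monoʳ-≤ (2 ^ m) (s≤s (+-monoʳ-≤ (2 * i) ([]ᵇ≤1 (does (t′ i <? c))))))
    (≤-trans (≤-reflexive (arrange (2 ^ m) i)) bound)))
  where
  arrange : ∀ w i → w * suc (2 * i + 1) ≡ 2 * w * suc i
  arrange = solve-∀

-- Allows the arrays seen by the classification to be replaced by those of the final state, which
-- agree with them only within the bounds of an array.
bucket-cong : ∀ {x x′ t t′ : ℕ → ℕ} d v c → suc v ≡ 2 ^ d → (∀ i → i ≤ v → x i ≡ x′ i) → (∀ i → i < 2 * 2 ^ d → t i ≡ t′ i) →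
  bucket x t d v c ≡ bucket x′ t′ d v c
bucket-cong {x} {x′} {t} {t′} d v c eq x≡ t≡ = trans
  (cong (λ i → 2 * i + [ does (i <? v) ∧ does (c ≟ x i) ]ᵇ)
    (cong (_∸ (v + 1)) (descend-cong c d 1 t≡ (≤-reflexive (*-comm (2 ^ d) 2)))))
  (cong (λ y → 2 * i′ + [ does (i′ <? v) ∧ does (c ≟ y) ]ᵇ) (x≡ i′ (leaf-≤ t′ c d v eq)))
  where i′ = descend t′ c d 1 ∸ (v + 1)

sumTo-linear : ∀ {f g : ℕ → ℕ} c m n → (∀ i → i < n → g i ≤ c + m * f i) → sumTo g n ≤ n * c + m * sumTo f n
sumTo-linear c m zero    _  = z≤n
sumTo-linear {f} {g} c m (suc n) g≤ = ≤-trans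
  (+-mono-≤ (sumTo-linear c m n λ i i<n → g≤ i (m<n⇒m<1+n i<n)) (g≤ n ≤-refl))
  (≤-reflexive (arrange n c m (sumTo f n) (f n)))
  where
  arrange : ∀ n c m s x → (n * c + m * s) + (c + m * x) ≡ suc n * c + m * (s + x)
  arrange = solve-∀

powers-≤ : ∀ n → sumTo (2 ^_) n ≤ 2 ^ n
powers-≤ zero    = z≤n
powers-≤ (suc n) = ≤-trans (+-monoˡ-≤ (2 ^ n) (powers-≤ n)) (≤-reflexive (cong (2 ^ n +_) (sym (+-identityʳ (2 ^ n)))))

reversed-powers-≤ : ∀ n → sumTo (λ i → 2 ^ (n ∸ suc i)) n ≤ 2 ^ n
reversed-powers-≤ zero    = z≤n
reversed-powers-≤ (suc n) = ≤-trans (≤-reflexive (sumTo-suc (λ i → 2 ^ (suc n ∸ suc i)) n))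
  (+-monoʳ-≤ (2 ^ n) (≤-trans (reversed-powers-≤ n) (≤-reflexive (sym (+-identityʳ (2 ^ n))))))

m*n≤o⇒m≤o/n : ∀ m {n o} .{{_ : NonZero n}} → m * n ≤ o → m ≤ o / n
m*n≤o⇒m≤o/n m {n} m*n≤o = ≤-trans (≤-reflexive (sym (m*n/n≡m m n))) (/-monoˡ-≤ n m*n≤o)

n≤2^n∸1 : ∀ n → n ≤ 2 ^ n ∸ 1
n≤2^n∸1 n = ∸-monoˡ-≤ 1 (n<2^n n)

-- Bounds by multiples of a fixed positive number

infix 4 _≤[_]_

-- A record rather than a function, so that the factors can be inferred.
record _≤[_]_ (a y c : ℕ) : Set where
  constructor multiple
  field
    at-most : a ≤ c * y

infixr 5 _⊕_

_⊕_ : ∀ {y a b c c′} → a ≤[ y ] c → b ≤[ y ] c′ → a + b ≤[ y ] c + c′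
_⊕_ {y} {c = c} {c′} (multiple a≤) (multiple b≤) =
  multiple (≤-trans (+-mono-≤ a≤ b≤) (≤-reflexive (sym (*-distribʳ-+ y c c′))))

fixed : ∀ {y} → 1 ≤ y → ∀ k → k ≤[ y ] k
fixed {y} 1≤y k = multiple (m≤m*n k y {{>-nonZero 1≤y}})

times : ∀ {y} k {a c} → a ≤[ y ] c → k * a ≤[ y ] k * c
times {y} k {c = c} (multiple a≤) = multiple (≤-trans (*-monoʳ-≤ k a≤) (≤-reflexive (sym (*-assoc k c y))))

timesʳ : ∀ {y} k {a c} → a ≤[ y ] c → a * k ≤[ y ] k * c
timesʳ {y} k {a} {c} a≤ = subst (_≤[ y ] k * c) (*-comm k a) (times k a≤)

below : ∀ {y a b c} → a ≤ b → b ≤[ y ] c → a ≤[ y ] c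
below a≤b (multiple b≤) = multiple (≤-trans a≤b b≤)

once : ∀ {y a} → a ≤ y → a ≤[ y ] 1
once {y} a≤y = multiple (≤-trans a≤y (≤-reflexive (sym (*-identityˡ y))))

enlarge : ∀ {y z a c} → y ≤ z → a ≤[ y ] c → a ≤[ z ] c
enlarge {c = c} y≤z (multiple a≤) = multiple (≤-trans a≤ (*-monoʳ-≤ c y≤z))

-- The constants

sortFactor : (α κ : ℕ) → ℕ
sortFactor α κ = 2 + (14 * (1 + α) + 26 * ((1 + α) * (2 * 2 ^ α * κ) + 2 * (2 * 2 ^ α)))

-- One summand per phase, nested like `totalTime` and `totalWork`. The two differ only in the loop
-- that computes Λ and in the two sweeps, whose time is logarithmic and whose work is linear in p.
timeFactor workFactor : (α κ : ℕ) → ℕ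
timeFactor α κ = 6 + ((2 + 3 * (1 + α)) + (5 + (14 + (12 + (4 + ((4 + 8 * (2 * 2 ^ α)) +
  (sortFactor α κ + ((1 + (20 + 19)) + (38 + ((31 + ((1 + (15 + (1 + 17))) + 46)) + (17 + 8)))))))))))
workFactor α κ = 6 + ((2 + 3 * (1 + α)) + (8 + (14 + (12 + (4 + ((4 + 8 * (2 * 2 ^ α)) +
  (sortFactor α κ + ((1 + (20 + 19)) + (38 + ((31 + ((1 + (28 + (1 + 32))) + 46)) + (17 + 8)))))))))))

-- Verification of the phases on one instance

module Step {α : ℕ} (I : Instance α) (S : Sized I) where
  open Instance I
  open Sized S

  registers : (src dst W rounds W2 tmp cnt k sample : ℕ) → List ℕ
  registers src dst W rounds W2 tmp cnt k sample =
    n ∷ p ∷ d ∷ v ∷ α ∷ h ∷ w ∷ b ∷ B ∷ 0 ∷ 1 ∷ (d + α) ∷ A ∷ U ∷ L ∷ K ∷ lam ∷ Λ ∷ a ∷ off ∷ γ ∷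
    (v + 1) ∷ (α ∸ 1) ∷ (1 * U) ∷ (2 * U) ∷ (3 * U) ∷ (4 * U) ∷ (5 * U) ∷ (6 * U) ∷ (7 * U) ∷
    (8 * U) ∷ (9 * U) ∷ (10 * U) ∷ (11 * U) ∷ (12 * U) ∷
    src ∷ dst ∷ W ∷ rounds ∷ W2 ∷ tmp ∷ cnt ∷ k ∷ sample ∷ 2 ∷ []

  open Access env U 15U<2^B public

  n≤U : n ≤ U
  n≤U = ≤-trans (m≤m+n n _) (≤-reflexive (sym U≡))

  0<p : 0 < p
  0<p = >-nonZero⁻¹ p

  2^d≡ : 2 ^ d ≡ suc v
  2^d≡ = sym (m+[n∸m]≡n (m^n>0 2 d))

  1≤v : 1 ≤ v
  1≤v = ≤-pred (≤-trans (^-monoʳ-≤ 2 1≤d) (≤-reflexive 2^d≡))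

  A+A<U : A + A < U
  A+A<U = ≤-<-trans (≤-trans (≤-reflexive (sym (*-identityˡ (A + A)))) (*-monoˡ-≤ (A + A) 0<p)) merges<U

  A<U : A < U
  A<U = ≤-<-trans (m≤m+n A A) A+A<U

  2*2^d≤A : 2 * 2 ^ d ≤ A
  2*2^d≤A = ≤-trans (^-monoʳ-≤ 2 (≤-trans (≤-reflexive (+-comm 1 d)) (+-monoʳ-≤ d 1≤α))) (≤-reflexive (sym A≡))

  v<A : v < A
  v<A = ≤-trans (≤-reflexive (sym 2^d≡)) (≤-trans (m≤m+n (2 ^ d) (2 ^ d + 0)) 2*2^d≤A)

  v<U : v < U
  v<U = <-trans v<A A<U

  α≤A : α ≤ A
  α≤A = ≤-trans (<⇒≤ (n<2^n α)) (≤-trans (^-monoʳ-≤ 2 (m≤n+m α d)) (≤-reflexive (sym A≡)))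

  d<U : d < U
  d<U = ≤-<-trans (<⇒≤ (n<2^n d)) (≤-<-trans (≤-reflexive 2^d≡) (≤-<-trans v<A A<U))

  p≤U : p ≤ U
  p≤U = ≤-trans p≤Λ (≤-trans (m≤m+n Λ (Λ + 0)) (<⇒≤ 2Λ<U))

  a≤A : a ≤ A
  a≤A = ≤-trans (m≤n+m a off) (≤-reflexive off+a)

  off≤A : off ≤ A
  off≤A = ≤-trans (m≤m+n off a) (≤-reflexive off+a)

  0<U : 0 < U
  0<U = ≤-<-trans z≤n A<U

  word-fits : ∀ {x} → x < 2 ^ (w * b) → x < 2 ^ B
  word-fits x< = <-≤-trans x< (^-monoʳ-≤ 2 w-fits)

  multiple-fits : ∀ k → IsTrue (k ≤ᵇ 15) → k * U < 2 ^ B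
  multiple-fits k k≤15 = fits-multiple k (≤ᵇ⇒≤ k 15 k≤15) ≤-refl

  bit-fits : ∀ b → [ b ]ᵇ < 2 ^ B
  bit-fits b = fits₁ (≤-trans ([]ᵇ≤1 b) 0<U)

  solo : ∀ {K} → get K 9 ≡ just 0 → get K 10 ≡ just 1 → length K ≤ 50 → ∀ Own → ParallelSetup 1 K Own
  solo gz go len Own = record
    { N≤procs = 0<p ; N≤2^width = <⇒≤ (fits₁ 0<U) ; 0<N = z<s ; 1<2^width = fits₁ 0<U
    ; zero-reg = gz ; one-reg = go ; length-K = len
    ; disjoint = λ { (s≤s z≤n) (s≤s z≤n) _ _ _ → refl } }

  everyone : ∀ {K Own} → get K 9 ≡ just 0 → get K 10 ≡ just 1 → length K ≤ 50 →
    (∀ {q q′ k i} → q < p → q′ < p → i < U → Own q k i → Own q′ k i → q ≡ q′) → ParallelSetup p K Own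
  everyone gz go len dis = record
    { N≤procs = ≤-refl ; N≤2^width = <⇒≤ (fits₁ p≤U) ; 0<N = 0<p ; 1<2^width = fits₁ 0<U
    ; zero-reg = gz ; one-reg = go ; length-K = len ; disjoint = dis }

  -- Drawing the sample

  module _ (src dst W rounds W2 tmp cnt k′ sample : ℕ) where
    private Kr = registers src dst W rounds W2 tmp cnt k′ sample

    module Drawing (s : State) where
      Own : ℕ → ℕ → ℕ → Set
      Own q k i = k ≡ 1 × off ≤ i

      open AccessIn 1 Kr Own (cells s)

      data Inv (i : ℕ) : List ℕ → Mem → Set where
        inv : ∀ {z x y r₀ r₁ r₂ r₃ r₄ r₅ r₆ M} → (∀ {j} → j < i → M 1 (off + j) ≡ sampled I j) →
          Inv i (z ∷ i ∷ (off + i) ∷ x ∷ y ∷ r₀ ∷ r₁ ∷ r₂ ∷ r₃ ∷ r₄ ∷ r₅ ∷ r₆ ∷ []) M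

      body : ∀ i σ M → i < a → Inv i σ M → ∃[ σ′ ] ∃[ M′ ]
        Exec 0 drawStep σ M σ′ M′ × Inv (suc i) σ′ M′
      body i _ M i<a (inv {y = y} done) = _ , _ ,
        ( ins (draw refl refl (fits₁ (≤-trans (random-≤ I i) n≤U))) ⨾
          ins (chars refl refl refl (word-fits (charWord-< I _ h))) ⨾
          put-own {k = 1} refl (s≤s z≤n) refl cell<U (refl , m≤m+n off i) refl ⨾
          ins (op refl refl (+-comm i 1) (fits₁ (≤-trans i<a (≤-trans a≤A (<⇒≤ A<U))))) ⨾
          ins (op refl refl (trans (+-assoc off i 1) (cong (off +_) (+-comm i 1))) (fits₁ (<⇒≤ (next<U)))) )
        , inv done′
        where
        next≤A : off + suc i ≤ A
        next≤A = ≤-trans (+-monoʳ-≤ off i<a) (≤-reflexive off+a)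
        next<U : off + suc i < U
        next<U = ≤-<-trans next≤A A<U
        cell<U : off + i < U
        cell<U = <-trans (+-monoʳ-< off (n<1+n i)) next<U
        done′ : ∀ {j} → j < suc i → upd M 1 (off + i) (sampled I i) 1 (off + j) ≡ sampled I j
        done′ {j} j< with j ≟ i
        ... | yes refl = upd-same M 1 (off + i)
        ... | no j≢i = trans (upd-index M 1 (off + i) (≢-sym (j≢i ∘ +-cancelˡ-≡ off j i)))
                             (done (≤∧≢⇒< (≤-pred j<) j≢i))

      run : ∀ f → ∃[ σ′ ] ∃[ M′ ] Exec 0 drawCode (file f) (cells s) σ′ M′ ×
        (∀ j → j < a → M′ 1 (off + j) ≡ sampled I j)
      run f with iterate a Inv body {M = cells s}
        (inv {z = f 0} {f 3} {f 4} {f 5} {f 6} {f 7} {f 8} {f 9} {f 10} {f 11} λ ())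
      ... | _ , _ , iter , inv done = _ , _ ,
        ( ins (op refl refl refl (fits₁ z≤n)) ⨾
          ins (op refl refl refl (fits₁ (≤-trans (≤-reflexive (+-identityʳ off)) (≤-trans off≤A (<⇒≤ A<U))))) ⨾
          rep refl (fits₁ (≤-trans a≤A (<⇒≤ A<U))) iter )
        , λ j → done

    run-draw : ∀ s → s ⊨ Kr → Out (compile r1 0 drawCode) s (duration Kr drawCode) (1 * duration Kr drawCode)
      λ s′ → s′ ⊨ Kr × (∀ j → j < a → cells s′ 1 (off + j) ≡ sampled I j) ×
        (∀ k i → i < U → ¬ (k ≡ 1 × off ≤ i) → cells s′ k i ≡ cells s k i)
    run-draw s h′ = weaken ≤-refl ≤-refl (λ s′ (h″ , own , frame) → h″ , drawn s′ own , (λ k i i<U ¬own → frame k i i<U λ _ → ¬own))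
      (run-parallel {Own = Own} (solo refl refl (≤ᵇ⇒≤ 45 50 _) _) h′ refl
        (λ _ M′ → ∀ j → j < a → M′ 1 (off + j) ≡ sampled I j) λ { zero _ → run ; (suc _) (s≤s ()) })
      where
      open Drawing s
      drawn : ∀ s′ → (∀ {q} → q < 1 → ∃[ M′ ] (∀ j → j < a → M′ 1 (off + j) ≡ sampled I j) ×
          (∀ k i → i < U → Own q k i → cells s′ k i ≡ M′ k i)) →
        ∀ j → j < a → cells s′ 1 (off + j) ≡ sampled I j
      drawn s′ own j j<a with own z<s
      ... | M′ , done , agrees = trans (agrees 1 (off + j)
        (<-trans (<-≤-trans (+-monoʳ-< off j<a) (≤-reflexive off+a)) A<U) (refl , m≤m+n off j)) (done j j<a)

  -- Computing sizes and addresses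

  early : (A Λ cnt : ℕ) → List ℕ
  early A Λ cnt =
    n ∷ p ∷ d ∷ v ∷ α ∷ h ∷ w ∷ b ∷ B ∷ 0 ∷ 1 ∷ (d + α) ∷ A ∷ 0 ∷ 0 ∷ 0 ∷ lam ∷ Λ ∷ 0 ∷ 0 ∷ 0 ∷
    0 ∷ 0 ∷ 0 ∷ 0 ∷ 0 ∷ 0 ∷ 0 ∷ 0 ∷ 0 ∷ 0 ∷ 0 ∷ 0 ∷ 0 ∷ 0 ∷ 0 ∷ 0 ∷ 0 ∷ 0 ∷ 0 ∷ 0 ∷ cnt ∷ 0 ∷ 0 ∷ 0 ∷ []

  A≤U : A ≤ U
  A≤U = <⇒≤ A<U

  Λ≤U : Λ ≤ U
  Λ≤U = ≤-trans (m≤m+n Λ (Λ + 0)) (<⇒≤ 2Λ<U)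

  below-A : ∀ {i} → i ≤ d + α → 2 ^ i ≤ U
  below-A i≤ = ≤-trans (^-monoʳ-≤ 2 i≤) (≤-trans (≤-reflexive (sym A≡)) A≤U)

  e≤U : d + α ≤ U
  e≤U = ≤-trans (<⇒≤ (n<2^n (d + α))) (≤-trans (≤-reflexive (sym A≡)) A≤U)

  -- p fits into a word, so its bit length is at most B. This makes both truncated subtractions
  -- exact, that inside `leadingZeros` and that in `setup₁`.
  lam≤B : lam ≤ B
  lam≤B = ≤-trans (≤-reflexive lam≡) (≰⇒> λ B≤log →
    <⇒≱ (≤-<-trans (^-monoʳ-≤ 2 B≤log) (≤-<-trans (proj₁ (log-bounds p)) (fits₁ p≤U))) ≤-refl)

  lam≤U′ : lam ≤ U
  lam≤U′ = ≤-trans (<⇒≤ (n<2^n lam)) (≤-trans (≤-reflexive (sym Λ≡)) Λ≤U)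

  leadingZeros-p : leadingZeros B p ≡ B ∸ lam
  leadingZeros-p = trans (leadingZeros-pos B p) (cong (B ∸_) (sym lam≡))

  run-setup₁ : Out (block setup₁) initial 6 6 (λ s → s ⊨ early 1 1 0 × cells s ≡ cells initial)
  run-setup₁ = run-block {K = read parameters 0 45} (⊩-read parameters 45)
    ( op refl refl refl (fits₁ 0<U) ∷
      op refl refl refl (fits₁ e≤U) ∷
      op refl refl refl (fits₁ 0<U) ∷
      op refl refl refl (fits₁ 0<U) ∷
      clz refl leadingZeros-p (≤-<-trans (m∸n≤m B lam) (n<2^n B)) ∷
      op refl refl (m∸[m∸n]≡n lam≤B) (fits₁ lam≤U′) ∷ [] )

  double : ∀ i → 2 ^ i + 2 ^ i ≡ 2 ^ suc i
  double i = cong (2 ^ i +_) (sym (+-identityʳ (2 ^ i)))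

  run-powerA : ∀ M s → s ⊨ early 1 1 0 → cells s ≡ M →
    Out (for re rcnt (block (rA := rA ⟨ add ⟩ rA ∷ []))) s (2 + sumTo (λ _ → 1 + 2) (d + α)) (2 + sumTo (λ _ → 1 + 2) (d + α))
      (λ s′ → s′ ⊨ early A 1 0 × cells s′ ≡ M)
  run-powerA M s h₀ eq = weaken ≤-refl ≤-refl
    (λ s′ (h′ , eq′) → subst (λ A → s′ ⊨ early A 1 0) (sym A≡) h′ , eq′) (run-for (λ i → early (2 ^ i) 1) (λ _ M′ → M′ ≡ M) (λ _ → 1) (λ _ → 1) refl refl refl refl
    (λ i r i+r≡ h₁ eq₁ → weaken ≤-refl ≤-refl (λ s′ (h′ , eq′) → h′ , trans eq′ eq₁)
      (run-block h₁ (op refl refl (double i) (fits₁ (below-A (≤-trans (m≤m+n (suc i) r)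
        (≤-reflexive (trans (sym (+-suc i r)) i+r≡))))) ∷ [])))
    h₀ refl refl refl (fits₁ e≤U) eq)

  run-powerΛ : ∀ M s → s ⊨ early A 1 0 → cells s ≡ M →
    Out (for rλ rcnt (block (rΛ := rΛ ⟨ add ⟩ rΛ ∷ []))) s (2 + sumTo (λ _ → 1 + 2) lam) (2 + sumTo (λ _ → 1 + 2) lam)
      (λ s′ → s′ ⊨ early A Λ 0 × cells s′ ≡ M)
  run-powerΛ M s h₀ eq = weaken ≤-refl ≤-refl
    (λ s′ (h′ , eq′) → subst (λ Λ → s′ ⊨ early A Λ 0) (sym Λ≡) h′ , eq′) (run-for (λ i → early A (2 ^ i)) (λ _ M′ → M′ ≡ M) (λ _ → 1) (λ _ → 1) refl refl refl refl
    (λ i r i+r≡ h₁ eq₁ → weaken ≤-refl ≤-refl (λ s′ (h′ , eq′) → h′ , trans eq′ eq₁)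
      (run-block h₁ (op refl refl (double i) (fits₁ (≤-trans (^-monoʳ-≤ 2 (≤-trans (m≤m+n (suc i) r)
        (≤-reflexive (trans (sym (+-suc i r)) i+r≡)))) (≤-trans (≤-reflexive (sym Λ≡)) Λ≤U))) ∷ [])))
    h₀ refl refl refl (fits₁ lam≤U′) eq)

  middle : List ℕ
  middle =
    n ∷ p ∷ d ∷ v ∷ α ∷ h ∷ w ∷ b ∷ B ∷ 0 ∷ 1 ∷ (d + α) ∷ A ∷ U ∷ L ∷ K ∷ lam ∷ Λ ∷ a ∷ off ∷ γ ∷
    (v + 1) ∷ (α ∸ 1) ∷ 0 ∷ 0 ∷ 0 ∷ 0 ∷ 0 ∷ 0 ∷ 0 ∷ 0 ∷ 0 ∷ 0 ∷ 0 ∷ 0 ∷ 0 ∷ 0 ∷ 0 ∷ 0 ∷ 0 ∷ 0 ∷ 0 ∷ 0 ∷ 0 ∷ 0 ∷ []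

  run-setup₂ : ∀ {s} → s ⊨ early A Λ 0 → Out (block setup₂) s 14 14 (λ s′ → s′ ⊨ middle × cells s′ ≡ cells s)
  run-setup₂ h₀ = run-block h₀
    ( op refl refl refl (fits₁ (≤-trans (m≤m+n (A * p) (A * p)) 2Ap≤U)) ∷
      op refl refl refl (fits₁ 2Ap≤U) ∷
      op refl refl (sym U≡) (fits₁ ≤-refl) ∷
      op refl refl refl (fits₁ (≤-trans (m∸n≤m p 1) p≤U)) ∷
      op refl refl refl (fits₂ n≤U (≤-trans (m∸n≤m p 1) p≤U)) ∷
      op refl refl (trans (quotient≡/ (n + (p ∸ 1)) p) (sym L≡)) (fits₁ (≤-trans (m≤m*n L p) (<⇒≤ L*p<U))) ∷
      op refl refl refl (fits₁ v+1≤U) ∷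
      op refl refl (sym K≡) (subst (_< 2 ^ B) (sym K≡) (fits₂ v+1≤U v+1≤U)) ∷
      op refl refl refl (fits₁ (≤-trans (m∸n≤m α 1) (≤-trans α≤A A≤U))) ∷
      op refl refl refl (fits₁ (≤-trans (m≤m+n (α * v) (α ∸ 1)) (≤-trans a≤A A≤U))) ∷
      op refl refl refl (fits₁ (≤-trans a≤A A≤U)) ∷
      op refl refl (sym off≡) (fits₁ (≤-trans off≤A A≤U)) ∷
      op refl refl refl (≤-<-trans w-fits (n<2^n B)) ∷
      op refl refl (sym γ≡) (subst (_< 2 ^ B) (sym γ≡) (≤-<-trans (m∸n≤m B (w * b)) (n<2^n B))) ∷ [] )
    where
    2Ap≤U : A * p + A * p ≤ U
    2Ap≤U = ≤-trans (m≤n+m (A * p + A * p) n) (≤-reflexive (sym U≡))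
    v+1≤U : v + 1 ≤ U
    v+1≤U = ≤-trans (≤-reflexive (+-comm v 1)) v<U

  based : List ℕ
  based =
    n ∷ p ∷ d ∷ v ∷ α ∷ h ∷ w ∷ b ∷ B ∷ 0 ∷ 1 ∷ (d + α) ∷ A ∷ U ∷ L ∷ K ∷ lam ∷ Λ ∷ a ∷ off ∷ γ ∷
    (v + 1) ∷ (α ∸ 1) ∷ (1 * U) ∷ (2 * U) ∷ (3 * U) ∷ (4 * U) ∷ (5 * U) ∷ (6 * U) ∷ (7 * U) ∷
    (8 * U) ∷ (9 * U) ∷ (10 * U) ∷ (11 * U) ∷ (12 * U) ∷ 0 ∷ 0 ∷ 0 ∷ 0 ∷ 0 ∷ 0 ∷ 0 ∷ 0 ∷ 0 ∷ 0 ∷ []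

  run-setup₃ : ∀ {s} → s ⊨ middle → Out (block setup₃) s 12 12 (λ s′ → s′ ⊨ based × cells s′ ≡ cells s)
  run-setup₃ h₀ = run-block h₀
    ( op refl refl refl (multiple-fits 1 _) ∷ op refl refl refl (multiple-fits 2 _) ∷ op refl refl refl (multiple-fits 3 _) ∷
      op refl refl refl (multiple-fits 4 _) ∷ op refl refl refl (multiple-fits 5 _) ∷ op refl refl refl (multiple-fits 6 _) ∷
      op refl refl refl (multiple-fits 7 _) ∷ op refl refl refl (multiple-fits 8 _) ∷ op refl refl refl (multiple-fits 9 _) ∷
      op refl refl refl (multiple-fits 10 _) ∷ op refl refl refl (multiple-fits 11 _) ∷ op refl refl refl (multiple-fits 12 _) ∷ [] )

  run-setup₄ : ∀ {s} → s ⊨ based → Out (block setup₄) s 4 4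
    (λ s′ → s′ ⊨ registers (1 * U) (2 * U) 1 0 0 0 0 0 0 × cells s′ ≡ cells s)
  run-setup₄ h₀ = run-block h₀
    ( op refl refl (+-identityʳ (1 * U)) (fits-multiple 1 (s≤s z≤n) ≤-refl) ∷
      op refl refl (+-identityʳ (2 * U)) (fits-multiple 2 (s≤s (s≤s z≤n)) ≤-refl) ∷
      op refl refl refl (fits₁ 0<U) ∷
      op refl refl refl (fits₂ 0<U 0<U) ∷ [] )

  -- Merge sort of the sample

  module Merging (W rounds src dst : ℕ) (Kr : List ℕ) (R : Mem)
    (zero-reg : get Kr r0 ≡ just 0) (one-reg : get Kr r1 ≡ just 1)
    (reg-W : get Kr rW ≡ just W) (reg-W2 : get Kr rW2 ≡ just (W + W))
    (reg-rounds : get Kr rrounds ≡ just rounds)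
    (reg-src : get Kr rsrc ≡ just (src * U)) (reg-dst : get Kr rdst ≡ just (dst * U))
    (src≤14 : src ≤ 14) (dst≤14 : dst ≤ 14) (src≢dst : src ≢ dst)
    -- Strict, because the cursor of an exhausted run still loads the cell behind that run.
    (in-range : p * (rounds * (W + W)) < U) (0<W : 0 < W) (0<rounds : 0 < rounds)
    where
    span : ℕ
    span = rounds * (W + W)

    Own : ℕ → ℕ → ℕ → Set
    Own q k i = k ≡ dst × InChunk span q i

    disjoint : ∀ {q q′ k i} → q < p → q′ < p → i < U → Own q k i → Own q′ k i → q ≡ q′
    disjoint _ _ _ (_ , c) (_ , c′) = chunk-unique c c′

    open AccessIn p Kr Own R

    shared-src : ∀ {i} → Shared src i
    shared-src _ (eq , _) = src≢dst eq

    module _ {q : ℕ} (q<p : q < p) where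

      chunk<U : ∀ {o} → o < suc q * span → o < U
      chunk<U o< = <-trans (<-≤-trans o< (*-monoˡ-≤ span q<p)) in-range

      tail-right : ∀ {z o i ie j je x y u r s M} →
        q * span ≤ o → o < suc q * span → i ≤ U → j < U →
        Exec q mergeTail (z ∷ o ∷ i ∷ ie ∷ j ∷ je ∷ x ∷ y ∷ 0 ∷ u ∷ r ∷ s ∷ []) M
          ((dst * U + o) ∷ suc o ∷ i ∷ ie ∷ suc j ∷ je ∷ x ∷ y ∷ 0 ∷ u ∷ r ∷ s ∷ []) (upd M dst o y)
      tail-right {o = o} {i} {j = j} l o< i≤ j< =
        put-own reg-dst dst≤14 refl (chunk<U o<) (refl , l , o<) refl ⨾
        ins (when-no refl) ⨾
        ins (op refl refl (+-identityʳ i) (fits₁ i≤)) ⨾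
        ins (op refl one-reg (+-comm j 1) (fits₁ j<)) ⨾
        ins (op refl refl refl (fits₁ j<)) ⨾
        ins (op refl one-reg (+-comm o 1) (fits₁ (chunk<U o<)))

      tail-left : ∀ {z o i ie j je x y u r s M} →
        q * span ≤ o → o < suc q * span → i < U → j < U →
        Exec q mergeTail (z ∷ o ∷ i ∷ ie ∷ j ∷ je ∷ x ∷ y ∷ 1 ∷ u ∷ r ∷ s ∷ []) M
          ((dst * U + o) ∷ suc o ∷ suc i ∷ ie ∷ j ∷ je ∷ x ∷ y ∷ 1 ∷ u ∷ r ∷ s ∷ [])
          (upd (upd M dst o y) dst o x)
      tail-left {o = o} {i} {j = j} l o< i< j< =
        put-own reg-dst dst≤14 refl (chunk<U o<) (refl , l , o<) refl ⨾
        ins (when-yes refl (store refl refl refl (chunk<U o<) (refl , l , o<))) ⨾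
        ins (op refl refl (+-comm i 1) (fits₁ i<)) ⨾
        ins (op refl one-reg (+-comm j 1) (fits₁ j<)) ⨾
        ins (op refl refl refl (fits₁ (<⇒≤ j<))) ⨾
        ins (op refl one-reg (+-comm o 1) (fits₁ (chunk<U o<)))

      -- The cells below `o` are recorded as unchanged, so that elements written earlier survive the
      -- remaining iterations.
      data Merged (M : Mem) (o n : ℕ) (xs : List ℕ) (ie je : ℕ) : List ℕ → Mem → Set where
        merged : ∀ {z o′ i j x y t u r s M′} → o′ ≡ o + n →
          read (M′ dst) o n ≡ xs → (∀ {k} → k < o → M′ dst k ≡ M dst k) →
          Merged M o n xs ie je (z ∷ o′ ∷ i ∷ ie ∷ j ∷ je ∷ x ∷ y ∷ t ∷ u ∷ r ∷ s ∷ []) M′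

      extend : ∀ {M M′ o n xs v ie je σ M″} → Merged M′ (suc o) n xs ie je σ M″ →
        M′ dst o ≡ v → (∀ {k} → k < o → M′ dst k ≡ M dst k) →
        Merged M o (suc n) (v ∷ xs) ie je σ M″
      extend {o = o} {n} (merged eq seg low) eqv low′ = merged (trans eq (sym (+-suc o n)))
        (cong₂ _∷_ (trans (low (n<1+n o)) eqv) seg) (λ k<o → trans (low (m<n⇒m<1+n k<o)) (low′ k<o))

      -- The cases are those of `merge`. `lx` and `ly` are the lengths still unread; each iteration
      -- consumes one element, so their sum is the fixed number of iterations.
      merge-loop : ∀ n {z o i ie j je x y t u r s M} lx ly → lx + ly ≡ n →
        q * span ≤ o → o + n ≤ suc q * span → i + lx ≡ ie → ie < U → j + ly ≡ je → je < U →
        ∃[ σ ] ∃[ M′ ] Iter q n mergeStep (z ∷ o ∷ i ∷ ie ∷ j ∷ je ∷ x ∷ y ∷ t ∷ u ∷ r ∷ s ∷ []) M σ M′ ×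
          Merged M o n (merge _≤?_ (read (R src) i lx) (read (R src) j ly)) ie je σ M′
      merge-loop zero {o = o} zero zero refl l o≤ i≤ ie< j≤ je< =
        _ , _ , [] , merged (sym (+-identityʳ o)) refl (λ _ → refl)
      -- The left run is exhausted: the comparison uses a stray value, and register 8 is overruled
      -- to 0 whatever it says.
      merge-loop (suc n) {o = o} {i} {ie} {j} {je} {M = M} zero (suc ly) refl l o≤ i≤ ie< j≤ je<
        with merge-loop n {i = i} {M = upd M dst o (R src j)} zero ly refl (≤-trans l (n≤1+n o))
               (≤-trans (≤-reflexive (sym (+-suc o n))) o≤) i≤ ie<
               (trans (sym (+-suc j ly)) j≤) je<
      ... | σ , M′ , iter , result = σ , M′ ,
        ( fetch-shared reg-src src≤14 refl i<U shared-src refl ⨾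
          fetch-shared reg-src src≤14 refl j<U shared-src refl ⨾
          ins (op refl refl refl (bit-fits _)) ⨾
          ins (op refl refl (leq-no j<je) (fits₁ z≤n)) ⨾
          ins (when-no refl) ⨾
          ins (op refl refl (leq-yes (≤-reflexive (trans (sym i≤) (+-identityʳ i)))) (fits₁ 0<U)) ⨾
          ins (when-yes refl (op zero-reg zero-reg refl (fits₁ z≤n))) ⨾
          tail-right l o< (<⇒≤ i<U) j<U ) ∷ iter
        , extend result (upd-same M dst o) (λ k<o → upd-index M dst o (≢-sym (<⇒≢ k<o)))
        where
        j<je : j < je
        j<je = subst (j <_) j≤ (m<m+n j z<s)
        j<U : j < U
        j<U = <-trans j<je je<
        i<U : i < U
        i<U = ≤-<-trans (≤-trans (m≤m+n i 0) (≤-reflexive i≤)) ie<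
        o< : o < suc q * span
        o< = ≤-trans (m<m+n o z<s) o≤
      merge-loop (suc n) {o = o} {i} {ie} {j} {je} {M = M} (suc lx) zero eq l o≤ i≤ ie< j≤ je<
        with merge-loop n {j = j} {M = upd (upd M dst o (R src j)) dst o (R src i)} lx zero
               (suc-injective eq) (≤-trans l (n≤1+n o))
               (≤-trans (≤-reflexive (sym (+-suc o n))) o≤) (trans (sym (+-suc i lx)) i≤) ie< j≤ je<
      ... | σ , M′ , iter , result = σ , M′ ,
        ( fetch-shared reg-src src≤14 refl i<U shared-src refl ⨾
          fetch-shared reg-src src≤14 refl j<U shared-src refl ⨾
          ins (op refl refl refl (bit-fits _)) ⨾
          ins (op refl refl (leq-yes (≤-reflexive (trans (sym j≤) (+-identityʳ j)))) (fits₁ 0<U)) ⨾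
          ins (when-yes refl (op one-reg zero-reg refl (fits₁ 0<U))) ⨾
          ins (op refl refl (leq-no i<ie) (fits₁ z≤n)) ⨾
          ins (when-no refl) ⨾
          tail-left l o< i<U j<U ) ∷ iter
        , extend (subst (λ xs → Merged _ _ _ xs _ _ _ _) (merge-[]ʳ (read (R src) (suc i) lx)) result)
            (upd-same (upd M dst o (R src j)) dst o)
            (λ k<o → trans (upd-index (upd M dst o (R src j)) dst o (≢-sym (<⇒≢ k<o)))
                           (upd-index M dst o (≢-sym (<⇒≢ k<o))))
        where
        i<ie : i < ie
        i<ie = subst (i <_) i≤ (m<m+n i z<s)
        i<U : i < U
        i<U = <-trans i<ie ie<
        j<U : j < U
        j<U = ≤-<-trans (≤-trans (m≤m+n j 0) (≤-reflexive j≤)) je<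
        o< : o < suc q * span
        o< = ≤-trans (m<m+n o z<s) o≤
      merge-loop (suc n) {o = o} {i} {ie} {j} {je} {M = M} (suc lx) (suc ly) eq l o≤ i≤ ie< j≤ je<
        with R src i ≤? R src j
      ... | yes x≤y
        with merge-loop n {j = j} {M = upd (upd M dst o (R src j)) dst o (R src i)} lx (suc ly)
               (suc-injective eq) (≤-trans l (n≤1+n o))
               (≤-trans (≤-reflexive (sym (+-suc o n))) o≤) (trans (sym (+-suc i lx)) i≤) ie< j≤ je<
      ... | σ , M′ , iter , result = σ , M′ ,
        ( fetch-shared reg-src src≤14 refl (<-trans i<ie ie<) shared-src refl ⨾
          fetch-shared reg-src src≤14 refl (<-trans j<je je<) shared-src refl ⨾
          ins (op refl refl (leq-yes x≤y) (fits₁ 0<U)) ⨾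
          ins (op refl refl (leq-no j<je) (fits₁ z≤n)) ⨾
          ins (when-no refl) ⨾
          ins (op refl refl (leq-no i<ie) (fits₁ z≤n)) ⨾
          ins (when-no refl) ⨾
          tail-left l o< (<-trans i<ie ie<) (<-trans j<je je<) ) ∷ iter
        , subst (λ xs → Merged _ _ _ xs _ _ _ _)
            (sym (merge-yes (read (R src) (suc i) lx) (read (R src) (suc j) ly) x≤y))
            (extend result (upd-same (upd M dst o (R src j)) dst o)
              (λ k<o → trans (upd-index (upd M dst o (R src j)) dst o (≢-sym (<⇒≢ k<o)))
                             (upd-index M dst o (≢-sym (<⇒≢ k<o)))))
        where
        i<ie : i < ie
        i<ie = subst (i <_) i≤ (m<m+n i z<s)
        j<je : j < je
        j<je = subst (j <_) j≤ (m<m+n j z<s)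
        o< : o < suc q * span
        o< = ≤-trans (m<m+n o z<s) o≤
      merge-loop (suc n) {o = o} {i} {ie} {j} {je} {M = M} (suc lx) (suc ly) eq l o≤ i≤ ie< j≤ je<
          | no x≰y
        with merge-loop n {i = i} {M = upd M dst o (R src j)} (suc lx) ly
               (trans (sym (+-suc lx ly)) (suc-injective eq)) (≤-trans l (n≤1+n o))
               (≤-trans (≤-reflexive (sym (+-suc o n))) o≤) i≤ ie<
               (trans (sym (+-suc j ly)) j≤) je<
      ... | σ , M′ , iter , result = σ , M′ ,
        ( fetch-shared reg-src src≤14 refl (<-trans i<ie ie<) shared-src refl ⨾
          fetch-shared reg-src src≤14 refl (<-trans j<je je<) shared-src refl ⨾
          ins (op refl refl (leq-no (≰⇒> x≰y)) (fits₁ z≤n)) ⨾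
          ins (op refl refl (leq-no j<je) (fits₁ z≤n)) ⨾
          ins (when-no refl) ⨾
          ins (op refl refl (leq-no i<ie) (fits₁ z≤n)) ⨾
          ins (when-no refl) ⨾
          tail-right l o< (<⇒≤ (<-trans i<ie ie<)) (<-trans j<je je<) ) ∷ iter
        , subst (λ xs → Merged _ _ _ xs _ _ _ _)
            (sym (merge-no (read (R src) (suc i) lx) (read (R src) (suc j) ly) (≰⇒> x≰y)))
            (extend result (upd-same M dst o) (λ k<o → upd-index M dst o (≢-sym (<⇒≢ k<o))))
        where
        i<ie : i < ie
        i<ie = subst (i <_) i≤ (m<m+n i z<s)
        j<je : j < je
        j<je = subst (j <_) j≤ (m<m+n j z<s)
        o< : o < suc q * span
        o< = ≤-trans (m<m+n o z<s) o≤

      Run-merged : Mem → ℕ → Set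
      Run-merged M o = read (M dst) o (W + W) ≡ merge _≤?_ (read (R src) o W) (read (R src) (o + W) W)

      data Rounds (k : ℕ) : List ℕ → Mem → Set where
        rounds-done : ∀ {z o i ie j je x y t u r s M} → o ≡ q * span + k * (W + W) →
          (∀ {k′} → k′ < k → Run-merged M (q * span + k′ * (W + W))) →
          Rounds k (z ∷ o ∷ i ∷ ie ∷ j ∷ je ∷ x ∷ y ∷ t ∷ u ∷ r ∷ s ∷ []) M

      chunk-end : ∀ {k} → k < rounds → q * span + k * (W + W) + (W + W) ≤ suc q * span
      chunk-end {k} k< = ≤-trans (≤-reflexive (arrange (q * span) k (W + W)))
        (+-monoˡ-≤ (q * span) (*-monoˡ-≤ (W + W) k<))
        where
        arrange : ∀ a k w → a + k * w + w ≡ suc k * w + a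
        arrange = solve-∀

      chunk-end<U : ∀ {k} → k < rounds → q * span + k * (W + W) + (W + W) < U
      chunk-end<U k< = ≤-<-trans (≤-trans (chunk-end k<) (*-monoˡ-≤ span q<p)) in-range

      round : ∀ k σ M → k < rounds → Rounds k σ M → ∃[ σ′ ] ∃[ M′ ]
        Exec q mergeRound σ M σ′ M′ × Rounds (suc k) σ′ M′
      round k _ M k< (rounds-done {o = o} refl done)
        with merge-loop (W + W) {M = M} W W refl (m≤m+n (q * span) (k * (W + W))) (chunk-end k<)
               refl (≤-<-trans (+-monoʳ-≤ o (m≤m+n W W)) (chunk-end<U k<))
               (+-assoc o W W) (chunk-end<U k<)
      ... | _ , M′ , iter , merged {o′ = o′} eq seg low = _ , M′ ,
        ( ins (op refl zero-reg (+-identityʳ o) (fits₁ o≤U)) ⨾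
          ins (op refl reg-W refl (fits₁ (<⇒≤ (≤-<-trans (+-monoʳ-≤ o (m≤m+n W W)) (chunk-end<U k<))))) ⨾
          ins (op refl reg-W refl (fits₁ (<⇒≤ (≤-<-trans (+-monoʳ-≤ o (m≤m+n W W)) (chunk-end<U k<))))) ⨾
          ins (op refl reg-W2 refl (fits₁ (<⇒≤ (chunk-end<U k<)))) ⨾
          rep reg-W2 (fits₁ (<⇒≤ (≤-<-trans (m≤n+m (W + W) o) (chunk-end<U k<)))) iter )
        , rounds-done (trans eq (arrange (q * span) k (W + W))) done′
        where
        o≤U : o ≤ U
        o≤U = <⇒≤ (≤-<-trans (m≤m+n o (W + W)) (chunk-end<U k<))
        arrange : ∀ a k w → a + k * w + w ≡ a + suc k * w
        arrange = solve-∀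
        done′ : ∀ {k′} → k′ < suc k → Run-merged M′ (q * span + k′ * (W + W))
        done′ {k′} k′<1+k with k′ ≟ k
        ... | yes refl = seg
        ... | no k′≢k = trans
          (read-cong (q * span + k′ * (W + W)) (W + W) λ i _ i< → low (<-≤-trans i<
            (≤-trans (≤-reflexive (arrange (q * span) k′ (W + W)))
                     (+-monoʳ-≤ (q * span) (*-monoˡ-≤ (W + W) k′<k)))))
          (done k′<k)
          where
          k′<k : k′ < k
          k′<k = ≤∧≢⇒< (≤-pred k′<1+k) k′≢k

      merge-chunk : ∀ f M → ∃[ σ′ ] ∃[ M′ ] Exec q mergeCode (file f) M σ′ M′ ×
        (∀ k → k < rounds → Run-merged M′ (q * span + k * (W + W)))
      merge-chunk f M with iterate rounds Rounds round
          {σ = f 0 ∷ q * rounds * (W + W) ∷ f 2 ∷ f 3 ∷ f 4 ∷ f 5 ∷ f 6 ∷ f 7 ∷ f 8 ∷ f 9 ∷ f 10 ∷ f 11 ∷ []}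
          {M = M} (rounds-done (trans (*-assoc q rounds (W + W)) (sym (+-identityʳ (q * span)))) λ ())
      ... | _ , M′ , iter , rounds-done _ done = _ , M′ ,
        ( ins (op refl reg-rounds refl (fits₁ (≤-trans (≤-trans (m≤m*n (q * rounds) (W + W)) start≤) end≤))) ⨾
          ins (op refl reg-W2 refl (fits₁ (≤-trans start≤ end≤))) ⨾
          rep reg-rounds (fits₁ (≤-trans (m≤m*n rounds (W + W)) (≤-trans (m≤m+n span (q * span)) end≤))) iter )
        , λ k → done
        where
        instance
          W≢0 : NonZero (W + W)
          W≢0 = >-nonZero (≤-trans 0<W (m≤m+n W W))
        end≤ : suc q * span ≤ U
        end≤ = <⇒≤ (≤-<-trans (*-monoˡ-≤ span q<p) in-range)
        start≤ : q * rounds * (W + W) ≤ suc q * span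
        start≤ = ≤-trans (≤-reflexive (*-assoc q rounds (W + W))) (m≤n+m (q * span) span)

  merge-pairs : ∀ (W rounds src dst : ℕ) (Kr : List ℕ) →
    get Kr r0 ≡ just 0 → get Kr r1 ≡ just 1 → get Kr rp ≡ just p → get Kr rW ≡ just W → get Kr rW2 ≡ just (W + W) →
    get Kr rrounds ≡ just rounds → get Kr rsrc ≡ just (src * U) → get Kr rdst ≡ just (dst * U) →
    src ≤ 14 → dst ≤ 14 → src ≢ dst → p * (rounds * (W + W)) < U → 0 < W → 0 < rounds → length Kr ≤ 50 →
    ∀ s → s ⊨ Kr →
    Out (compile rp 0 mergeCode) s (duration Kr mergeCode) (p * duration Kr mergeCode) λ s′ → s′ ⊨ Kr ×
      (∀ b → b < p * rounds → read (cells s′ dst) (b * (W + W)) (W + W)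
         ≡ merge _≤?_ (read (cells s src) (b * (W + W)) W) (read (cells s src) (b * (W + W) + W) W)) ×
      (∀ k i → i < U → k ≢ dst → cells s′ k i ≡ cells s k i)
  merge-pairs W rounds src dst Kr gz go gp gW gW2 gr gs gd s≤ d≤ s≢d range 0<W 0<r len s h =
    weaken ≤-refl ≤-refl (λ s′ (h′ , own , frame) → h′ , pair s′ own , λ k i i<U k≢dst → frame k i i<U λ _ → k≢dst ∘ proj₁)
      (run-parallel (everyone gz go len disjoint) h gp _ (λ q q<p f → merge-chunk q<p f (cells s)))
    where
    open Merging W rounds src dst Kr (cells s) gz go gW gW2 gr gs gd s≤ d≤ s≢d range 0<W 0<r
    instance
      r≢0 : NonZero rounds
      r≢0 = >-nonZero 0<r
      w≢0 : NonZero (rounds * (W + W))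
      w≢0 = m*n≢0 rounds (W + W) {{r≢0}} {{>-nonZero (≤-trans 0<W (m≤m+n W W))}}
    pair : ∀ s′ → (∀ {q} → q < p → ∃[ M′ ] (∀ k → k < rounds → _) ×
             (∀ k i → i < U → Own q k i → cells s′ k i ≡ M′ k i)) →
      ∀ b → b < p * rounds → read (cells s′ dst) (b * (W + W)) (W + W)
         ≡ merge _≤?_ (read (cells s src) (b * (W + W)) W) (read (cells s src) (b * (W + W) + W) W)
    pair s′ own b b< with own (m<n*o⇒m/o<n {b} b<)
    ... | M′ , merged′ , agrees = subst (λ o → read (cells s′ dst) o (W + W)
         ≡ merge _≤?_ (read (cells s src) o W) (read (cells s src) (o + W) W)) start
         (trans (read-cong _ (W + W) λ i l u → agrees dst i
                  (chunk<U q<p (<-≤-trans u (chunk-end q<p (m%n<n b rounds))))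
                  (refl , ≤-trans (m≤m+n (q * span) _) l , <-≤-trans u (chunk-end q<p (m%n<n b rounds))))
                (merged′ (b % rounds) (m%n<n b rounds)))
      where
      q = b / rounds
      q<p : q < p
      q<p = m<n*o⇒m/o<n {b} b<
      start : q * span + b % rounds * (W + W) ≡ b * (W + W)
      start = trans (arrange q rounds (b % rounds) (W + W))
                    (cong (_* (W + W)) (sym (m≡m%n+[m/n]*n b rounds)))
        where
        arrange : ∀ q r k w → q * (r * w) + k * w ≡ (k + q * r) * w
        arrange = solve-∀

  module SortLoop where
    levels : ℕ
    levels = d + α

    rounds : ℕ → ℕ
    rounds i = quotient (quotient A (2 ^ i + 2 ^ i)) p + 1

    oldRounds oldW2 oldTmp : ℕ → ℕ
    oldRounds zero    = 0
    oldRounds (suc i) = rounds i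
    oldW2 zero    = 0
    oldW2 (suc i) = 2 ^ i + 2 ^ i
    oldTmp zero    = 0
    oldTmp (suc i) = srcArray i * U

    before during : ℕ → ℕ → List ℕ
    before i cnt = registers (srcArray i * U) (dstArray i * U) (2 ^ i) (oldRounds i) (oldW2 i) (oldTmp i) cnt 0 0
    during i cnt = registers (srcArray i * U) (dstArray i * U) (2 ^ i) (rounds i) (2 ^ i + 2 ^ i) (oldTmp i) cnt 0 0

    mergeTime : ℕ → ℕ
    mergeTime i = duration (during i 0) mergeCode

    module _ (M₀ : Mem) where
      Inv : ℕ → Mem → Set
      Inv i M = (∀ b → b < 2 ^ (levels ∸ i) → read (M (srcArray i)) (b * 2 ^ i) (2 ^ i) ≡ mergedBlock (M₀ 1) i b) ×
                (∀ k j → j < U → k ≢ 1 → k ≢ 2 → M k j ≡ M₀ k j)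

      body : ∀ {s} i r → i + suc r ≡ levels → s ⊨ before i (suc r) → Inv i (cells s) →
        Out sortLevel s (4 + (mergeTime i + 4)) (4 + (p * mergeTime i + 4))
          (λ s′ → s′ ⊨ before (suc i) (suc r) × Inv (suc i) (cells s′))
      body {s} i r eq h₀ (blocks , same) =
        run-block h₀
          ( op refl refl refl (fits₁ w₂≤U) ∷
            op refl refl refl (fits₁ (≤-trans (quotient-≤ A w₂) (<⇒≤ A<U))) ∷
            op refl refl refl (fits₁ (≤-trans (quotient-≤ (quotient A w₂) p) (≤-trans (quotient-≤ A w₂) (<⇒≤ A<U)))) ∷
            op refl refl refl (fits₁ (≤-trans (+-monoˡ-≤ 1 (≤-trans (quotient-≤ (quotient A w₂) p) (quotient-≤ A w₂)))
              (≤-trans (≤-reflexive (+-comm A 1)) A<U))) ∷ [] )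
        then λ s₁ (h₁ , eq₁) →
        merge-pairs W (rounds i) (srcArray i) (dstArray i) (during i (suc r))
          refl refl refl refl refl refl refl refl
          (≤-trans (src≤2 i) (s≤s (s≤s z≤n))) (≤-trans (dst≤2 i) (s≤s (s≤s z≤n))) (src≢dst i)
          range (m^n>0 2 i) (≤-trans (s≤s z≤n) (≤-reflexive (+-comm 1 _))) (≤ᵇ⇒≤ 45 50 _) s₁ h₁
        then λ s₂ (h₂ , merged′ , frame) → weaken ≤-refl ≤-refl
          (λ s′ (h′ , eq′) → h′ , subst (Inv (suc i)) (sym eq′) (blocks′ s₁ eq₁ s₂ merged′ , same′ s₁ eq₁ s₂ frame))
          (run-block h₂
            ( op refl refl (+-identityʳ (srcArray i * U)) (array-fits (src≤2 i)) ∷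
              op refl refl (+-identityʳ (dstArray i * U)) (array-fits (dst≤2 i)) ∷
              op refl refl (+-identityʳ (srcArray i * U)) (array-fits (src≤2 i)) ∷
              op refl refl (trans (+-identityʳ w₂) W+W≡) (fits₁ (≤-trans (≤-reflexive (sym W+W≡)) w₂≤U)) ∷ [] ))
        where
        W = 2 ^ i
        w₂ = W + W
        W+W≡ : w₂ ≡ 2 ^ suc i
        W+W≡ = cong (W +_) (sym (+-identityʳ W))
        height : r + suc i ≡ levels
        height = trans (trans (+-suc r i) (+-comm (suc r) i)) eq
        A≡′ : A ≡ 2 ^ r * w₂
        A≡′ = trans A≡ (trans (cong (2 ^_) (sym height)) (trans (^-distribˡ-+-* 2 r (suc i)) (cong (2 ^ r *_) (sym W+W≡))))
        w₂≤A : w₂ ≤ A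
        w₂≤A = ≤-trans (m≤n*m w₂ (2 ^ r) {{m^n≢0 2 r}}) (≤-reflexive (sym A≡′))
        w₂≤U : w₂ ≤ U
        w₂≤U = ≤-trans w₂≤A (<⇒≤ A<U)
        array-fits : ∀ {k} → k ≤ 2 → k * U < 2 ^ B
        array-fits {k} k≤2 = fits-multiple k (≤-trans k≤2 (s≤s (s≤s z≤n))) ≤-refl
        instance
          w₂≢0 : NonZero w₂
          w₂≢0 = >-nonZero (≤-trans (m^n>0 2 i) (m≤m+n W W))
        pairs≡ : quotient A w₂ ≡ 2 ^ r
        pairs≡ = trans (quotient≡/ A w₂) (trans (cong (_/ w₂) A≡′) (m*n/n≡m (2 ^ r) w₂))
        rounds≡ : rounds i ≡ 2 ^ r / p + 1
        rounds≡ = cong (_+ 1) (trans (quotient≡/ (quotient A w₂) p) (cong (_/ p) pairs≡))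
        -- The rounds obtained by division cover at most `A` cells altogether; the added round costs
        -- each processor one further pair, again at most `A` cells.
        range : p * (rounds i * w₂) < U
        range = ≤-<-trans (begin
          p * (rounds i * w₂)                 ≡⟨ cong (λ k → p * (k * w₂)) rounds≡ ⟩
          p * ((2 ^ r / p + 1) * w₂)          ≡⟨ arrange p (2 ^ r / p) w₂ ⟩
          2 ^ r / p * p * w₂ + p * w₂         ≤⟨ +-mono-≤ (*-monoˡ-≤ w₂ (m/n*n≤m (2 ^ r) p)) (*-monoʳ-≤ p w₂≤A) ⟩
          2 ^ r * w₂ + p * A                  ≡⟨ cong (_+ p * A) (sym A≡′) ⟩
          A + p * A                           ≤⟨ +-monoˡ-≤ (p * A) (m≤n*m A p) ⟩
          p * A + p * A                       ≡⟨ *-distribˡ-+ p A A ⟨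
          p * (A + A)                         ∎) merges<U
          where
          open ≤-Reasoning
          arrange : ∀ p x w → p * ((x + 1) * w) ≡ x * p * w + p * w
          arrange = solve-∀
        remaining₀ : levels ∸ i ≡ suc r
        remaining₀ = trans (cong (_∸ i) (sym eq)) (m+n∸m≡n i (suc r))
        remaining₁ : levels ∸ suc i ≡ r
        remaining₁ = trans (cong (_∸ suc i) (trans (sym height) (+-comm r (suc i)))) (m+n∸m≡n (suc i) r)
        enough : ∀ {b} → b < 2 ^ r → b < p * rounds i
        enough {b} b< = <-≤-trans b< (≤-trans (<⇒≤ (m<[1+m/n]*n (2 ^ r) p))
          (≤-reflexive (trans (*-comm (suc (2 ^ r / p)) p) (cong (p *_) (trans (+-comm 1 _) (sym rounds≡))))))
        blocks′ : ∀ s₁ → cells s₁ ≡ cells s → ∀ s₂ →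
          (∀ b → b < p * rounds i → read (cells s₂ (dstArray i)) (b * w₂) w₂ ≡
            merge _≤?_ (read (cells s₁ (srcArray i)) (b * w₂) W) (read (cells s₁ (srcArray i)) (b * w₂ + W) W)) →
          ∀ b → b < 2 ^ (levels ∸ suc i) →
          read (cells s₂ (dstArray i)) (b * 2 ^ suc i) (2 ^ suc i) ≡ mergedBlock (M₀ 1) (suc i) b
        blocks′ s₁ eq₁ s₂ merged′ b b< = begin
          read (cells s₂ (dstArray i)) (b * 2 ^ suc i) (2 ^ suc i)
            ≡⟨ cong (λ k → read (cells s₂ (dstArray i)) (b * k) k) (sym W+W≡) ⟩
          read (cells s₂ (dstArray i)) (b * w₂) w₂
            ≡⟨ merged′ b (enough b<2^r) ⟩
          merge _≤?_ (read (cells s₁ (srcArray i)) (b * w₂) W) (read (cells s₁ (srcArray i)) (b * w₂ + W) W)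
            ≡⟨ cong (λ M → merge _≤?_ (read (M (srcArray i)) (b * w₂) W) (read (M (srcArray i)) (b * w₂ + W) W)) eq₁ ⟩
          merge _≤?_ (read (cells s (srcArray i)) (b * w₂) W) (read (cells s (srcArray i)) (b * w₂ + W) W)
            ≡⟨ cong₂ (λ j k → merge _≤?_ (read (cells s (srcArray i)) j W) (read (cells s (srcArray i)) k W))
                 (even b W) (odd b W) ⟩
          merge _≤?_ (read (cells s (srcArray i)) (2 * b * W) W) (read (cells s (srcArray i)) ((2 * b + 1) * W) W)
            ≡⟨ cong₂ (merge _≤?_) (blocks (2 * b) (<-trans (n<1+n _) 2b+1<)) (blocks (2 * b + 1) (subst (_< 2 ^ (levels ∸ i)) (+-comm 1 (2 * b)) 2b+1<)) ⟩
          mergedBlock (M₀ 1) (suc i) b ∎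
          where
          open ≡-Reasoning
          b<2^r : b < 2 ^ r
          b<2^r = subst (λ k → b < 2 ^ k) remaining₁ b<
          2b+1< : suc (2 * b) < 2 ^ (levels ∸ i)
          2b+1< = subst (λ k → suc (2 * b) < 2 ^ k) (sym remaining₀)
            (≤-trans (≤-reflexive (sym (*-suc 2 b))) (*-monoʳ-≤ 2 b<2^r))
          even : ∀ b w → b * (w + w) ≡ 2 * b * w
          even = solve-∀
          odd : ∀ b w → b * (w + w) + w ≡ (2 * b + 1) * w
          odd = solve-∀
        same′ : ∀ s₁ → cells s₁ ≡ cells s → ∀ s₂ → (∀ k j → j < U → k ≢ dstArray i → cells s₂ k j ≡ cells s₁ k j) →
          ∀ k j → j < U → k ≢ 1 → k ≢ 2 → cells s₂ k j ≡ M₀ k j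
        same′ s₁ eq₁ s₂ frame k j j<U k≢1 k≢2 = trans (frame k j j<U k≢dst) (trans (cong (λ M → M k j) eq₁) (same k j j<U k≢1 k≢2))
          where
          k≢dst : k ≢ dstArray i
          k≢dst eq with alternating i
          ... | inj₁ (_ , d≡) = k≢2 (trans eq d≡)
          ... | inj₂ (_ , d≡) = k≢1 (trans eq d≡)

    run-sort : ∀ s → s ⊨ registers (1 * U) (2 * U) 1 0 0 0 0 0 0 →
      Out (for re rcnt sortLevel) s (2 + sumTo (λ i → 4 + (mergeTime i + 4) + 2) levels)
        (2 + sumTo (λ i → 4 + (p * mergeTime i + 4) + 2) levels)
      λ s′ → s′ ⊨ before levels 0 × read (cells s′ (srcArray levels)) 0 A ≡ mergedBlock (cells s 1) levels 0 ×
        (∀ k j → j < U → k ≢ 1 → k ≢ 2 → cells s′ k j ≡ cells s k j)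
    run-sort s h₀ = weaken ≤-refl ≤-refl
      (λ s′ (h′ , blocks , same) → h′
        , trans (cong (read (cells s′ (srcArray levels)) 0) A≡)
            (blocks 0 (≤-trans (s≤s z≤n) (m^n>0 2 (levels ∸ levels)))) , same)
      (run-for before (Inv (cells s)) (λ i → 4 + (mergeTime i + 4)) (λ i → 4 + (p * mergeTime i + 4)) refl refl refl refl
        (λ {s₁} → body (cells s) {s₁}) h₀ refl refl refl (fits₁ (≤-trans (<⇒≤ (n<2^n levels)) (≤-trans (≤-reflexive (sym A≡)) (<⇒≤ A<U))))
        ((λ b _ → cong (λ j → cells s 1 j ∷ []) (*-identityʳ b)) , λ _ _ _ _ _ → refl))

    sorted-sample : ∀ {M M₀ : Mem} {k} → read (M k) 0 A ≡ mergedBlock (M₀ 1) levels 0 →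
      (∀ j → j < off → M₀ 1 j ≡ 0) →
      Sorted (read (M k) off a) × read (M k) off a ↭ read (M₀ 1) off a
    sorted-sample {M} {M₀} {k} eq zeros = drop-zeros (M k) 0 off a
      (subst Sorted (trans (sym eq) (cong (read (M k) 0) (sym off+a))) (mergedBlock-sorted (M₀ 1) levels 0))
      (↭-trans (↭-reflexive (trans (cong (read (M k) 0) off+a) eq))
      (↭-trans (mergedBlock-↭ (M₀ 1) levels 0)
               (↭-reflexive (trans (cong (read (M₀ 1) 0) (trans (sym A≡) (sym off+a)))
                 (trans (read-++ (M₀ 1) 0 off a)
                        (cong (_++ read (M₀ 1) off a) (read-zeros (M₀ 1) 0 off λ j _ j< → zeros j j<)))))))

  -- Splitters and their longest common prefixes

  splitterIndex : ℕ → ℕ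
  splitterIndex i = α * i + (α ∸ 1)

  splitterIndex-< : ∀ {i} → i < v → splitterIndex i < a
  splitterIndex-< {i} i<v = <-≤-trans
    (≤-trans (+-monoʳ-< (α * i) (≤-reflexive (m+[n∸m]≡n 1≤α)))
      (≤-reflexive (trans (+-comm (α * i) α) (sym (*-suc α i)))))
    (≤-trans (*-monoʳ-≤ α i<v) (m≤m+n (α * v) (α ∸ 1)))

  module _ (src dst W rounds W2 tmp cnt k′ sample : ℕ) where
    private Kr = registers (src * U) dst W rounds W2 tmp cnt k′ sample

    module Splitting (s : State) (smp : ℕ → ℕ) (src≤14 : src ≤ 14) (src≢3 : src ≢ 3) (src≢5 : src ≢ 5)
      (smp≡ : ∀ j → j < a → cells s src (off + j) ≡ smp j) (smp< : ∀ j → j < a → smp j < 2 ^ (w * b)) where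

      x : ℕ → ℕ
      x i = smp (splitterIndex i)

      Own : ℕ → ℕ → ℕ → Set
      Own q k i = k ≡ 3 ⊎ k ≡ 5

      open AccessIn 1 Kr Own (cells s)

      Lcp : ℕ → ℕ
      Lcp i = lcp (unpack b w (x i)) (unpack b w (x (suc i)))

      data Inv (i : ℕ) : List ℕ → Mem → Set where
        inv : ∀ {z prev y u r₀ r₁ r₂ r₃ r₄ r₅ M} → prev < 2 ^ (w * b) →
          -- Vacuous for `i = 0`, where `prev` is the stand-in 0.
          (∀ j → suc j ≡ i → prev ≡ x j) →
          (∀ j → j < i → M 3 j ≡ x j) → (∀ j → suc j < i → M 5 (suc j) ≡ Lcp j) →
          Inv i (z ∷ i ∷ (off + splitterIndex i) ∷ prev ∷ y ∷ u ∷ r₀ ∷ r₁ ∷ r₂ ∷ r₃ ∷ r₄ ∷ r₅ ∷ []) M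

      next-index : ∀ i → off + splitterIndex i + α ≡ off + splitterIndex (suc i)
      next-index i = trans (arrange off (α * i) (α ∸ 1) α) (cong (λ k → off + (k + (α ∸ 1))) (sym (*-suc α i)))
        where
        arrange : ∀ o x y z → o + (x + y) + z ≡ o + (z + x + y)
        arrange = solve-∀

      body : ∀ i σ M → i < v → Inv i σ M → ∃[ σ′ ] ∃[ M′ ] Exec 0 splitterStep σ M σ′ M′ × Inv (suc i) σ′ M′
      body i _ M i<v (inv {prev = prev} prev< prev≡ done₃ done₅) = _ , _ ,
        ( fetch-shared {k = src} refl src≤14 refl (<-≤-trans (+-monoʳ-< off (splitterIndex-< i<v)) (≤-trans (≤-reflexive off+a) (<⇒≤ A<U)))
            (λ _ → [ src≢3 , src≢5 ]′) (smp≡ _ (splitterIndex-< i<v)) ⨾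
          put-own {k = 3} refl (≤ᵇ⇒≤ 3 14 _) refl i<U (inj₁ refl) refl ⨾
          ins (op refl refl refl (bitXor-< B prev (x i))) ⨾
          ins (clz refl refl (≤-<-trans (clz-≤ (bitXor B prev (x i))) (n<2^n B))) ⨾
          ins (op refl refl (cong (leadingZeros B (bitXor B prev (x i)) ∸_) γ≡)
            (≤-<-trans (≤-trans (m∸n≤m _ (B ∸ w * b)) (clz-≤ (bitXor B prev (x i)))) (n<2^n B))) ⨾
          ins (op refl refl refl (≤-<-trans (≤-trans (quotient-≤ _ b)
            (≤-trans (m∸n≤m _ (B ∸ w * b)) (clz-≤ (bitXor B prev (x i))))) (n<2^n B))) ⨾
          put-own {k = 5} refl (≤ᵇ⇒≤ 5 14 _) refl i<U (inj₂ refl) refl ⨾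
          ins (op refl refl (+-identityʳ (x i)) (word-fits (smp< _ (splitterIndex-< i<v)))) ⨾
          ins (op refl refl (+-comm i 1) (fits₁ i<U)) ⨾
          ins (op refl refl (next-index i) (fits₁ next≤U)) )
        , inv (smp< _ (splitterIndex-< i<v)) (λ { j refl → refl }) done₃′ done₅′
        where
        i<U : i < U
        i<U = <-trans i<v v<U
        next≤U : off + splitterIndex (suc i) ≤ U
        next≤U = ≤-trans (+-monoʳ-≤ off (+-monoˡ-≤ (α ∸ 1) (*-monoʳ-≤ α i<v)))
          (≤-trans (≤-reflexive off+a) (<⇒≤ A<U))
        clz-≤ : ∀ z → leadingZeros B z ≤ B
        clz-≤ zero = ≤-refl
        clz-≤ (suc z) = m∸n≤m B (suc ⌊log₂ suc z ⌋)
        instance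
          b≢0 : NonZero b
          b≢0 = >-nonZero 1≤b
        done₃′ : ∀ j → j < suc i → (M 3 [ i ↦ x i ]) j ≡ x j
        done₃′ j j< with j ≟ i
        ... | yes refl = updated-same (M 3) i
        ... | no j≢i = trans (updated-other (M 3) (≢-sym j≢i)) (done₃ j (≤∧≢⇒< (≤-pred j<) j≢i))
        done₅′ : ∀ j → suc j < suc i →
          (M 5 [ i ↦ quotient (leadingZeros B (bitXor B prev (x i)) ∸ (B ∸ w * b)) b ]) (suc j) ≡ Lcp j
        done₅′ j j< with suc j ≟ i
        ... | yes refl = trans (updated-same (M 5) (suc j))
          (trans (xor-lcp b w B w-fits prev< (smp< _ (splitterIndex-< i<v)))
                 (cong (λ y → lcp (unpack b w y) (unpack b w (x (suc j)))) (prev≡ j refl)))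
        ... | no j≢i = trans (updated-other (M 5) (≢-sym j≢i)) (done₅ j (≤∧≢⇒< (≤-pred j<) j≢i))

      Post : Mem → Set
      Post M = (∀ j → j < v → M 3 j ≡ x j) × (∀ j → suc j < v → M 5 (suc j) ≡ Lcp j)

      run : ∀ f → ∃[ σ′ ] ∃[ M′ ] Exec 0 splitterCode (file f) (cells s) σ′ M′ × Post M′
      run f with iterate v Inv body {M = cells s}
        (inv {z = f 0} {0} {f 4} {f 5} {f 6} {f 7} {f 8} {f 9} {f 10} {f 11} (m^n>0 2 (w * b)) (λ _ ()) (λ _ ()) (λ _ ()))
      ... | _ , _ , iter , inv _ _ done₃ done₅ = _ , _ ,
        ( ins (op refl refl refl (fits₁ z≤n)) ⨾
          ins (op refl refl (cong (λ k → off + (k + (α ∸ 1))) (sym (*-zeroʳ α)))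
            (fits₁ (≤-trans (+-monoʳ-≤ off (+-monoˡ-≤ (α ∸ 1) (*-monoʳ-≤ α {0} {v} z≤n)))
              (≤-trans (≤-reflexive off+a) (<⇒≤ A<U))))) ⨾
          ins (op refl refl refl (fits₁ z≤n)) ⨾
          rep refl (fits₁ (<⇒≤ v<U)) iter )
        , done₃ , done₅

    run-splitters : ∀ s smp → src ≤ 14 → src ≢ 3 → src ≢ 5 → s ⊨ Kr →
      (∀ j → j < a → cells s src (off + j) ≡ smp j) → (∀ j → j < a → smp j < 2 ^ (w * b)) →
      Out (compile r1 0 splitterCode) s (duration Kr splitterCode) (1 * duration Kr splitterCode)
      λ s′ → s′ ⊨ Kr × (∀ j → j < v → cells s′ 3 j ≡ smp (splitterIndex j)) ×
        (∀ j → suc j < v → cells s′ 5 (suc j) ≡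
           lcp (unpack b w (smp (splitterIndex j))) (unpack b w (smp (splitterIndex (suc j))))) ×
        (∀ k i → i < U → ¬ (k ≡ 3 ⊎ k ≡ 5) → cells s′ k i ≡ cells s k i)
    run-splitters s smp src≤ src≢3 src≢5 h′ smp≡ smp< = weaken ≤-refl ≤-refl
      (λ s′ (h″ , own , frame) → h″
        , (λ j j<v → trans (proj₂ (proj₂ (own z<s)) 3 j (<-trans j<v v<U) (inj₁ refl)) (proj₁ (proj₁ (proj₂ (own z<s))) j j<v))
        , (λ j j<v → trans (proj₂ (proj₂ (own z<s)) 5 (suc j) (<-trans j<v v<U) (inj₂ refl)) (proj₂ (proj₁ (proj₂ (own z<s))) j j<v))
        , (λ k i i<U ¬own → frame k i i<U λ _ → ¬own))
      (run-parallel {Own = Own} (solo refl refl (≤ᵇ⇒≤ 45 50 _) _) h′ refl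
        (λ _ → Post) λ { zero _ → run ; (suc _) (s≤s ()) })
      where open Splitting s smp src≤ src≢3 src≢5 smp≡ smp<

    -- The search tree of the splitters

    module Planting (s : State) where
      Own : ℕ → ℕ → ℕ → Set
      Own q k i = k ≡ 4

      open AccessIn 1 Kr Own (cells s)

      Planted : (ℕ → ℕ) → ℕ → Set
      Planted t i = ∀ l m r → l + suc m ≡ d → r < 2 ^ l → 2 ^ l + r < i →
        t (2 ^ l + r) ≡ cells s 3 ((2 * r + 1) * 2 ^ m ∸ 1)

      data Inv (i : ℕ) : List ℕ → Mem → Set where
        inv : ∀ {z w₂ r₀ r₁ r₂ r₃ r₄ r₅ r₆ r₇ r₈ M} l → w₂ ≡ 2 ^ suc l → 2 ^ l ≤ suc i → suc i < 2 ^ suc l →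
          Planted (M 4) (suc i) →
          Inv i (z ∷ suc i ∷ w₂ ∷ r₀ ∷ r₁ ∷ r₂ ∷ r₃ ∷ r₄ ∷ r₅ ∷ r₆ ∷ r₇ ∷ r₈ ∷ []) M

      body : ∀ i σ M → i < v → Inv i σ M → ∃[ σ′ ] ∃[ M′ ] Exec 0 treeStep σ M σ′ M′ × Inv (suc i) σ′ M′
      body i _ M i<v (inv {z} {r₂ = r₂} {r₃} {r₄} {r₅} {r₆} {r₇} {r₈} l refl lower upper planted) = step (2 ^ suc l ≤? suc (suc i))
        where
        r = suc i ∸ 2 ^ l
        r≡ : 2 ^ l + r ≡ suc i
        r≡ = m+[n∸m]≡n lower
        r< : r < 2 ^ l
        r< = +-cancelˡ-< (2 ^ l) r (2 ^ l) (subst₂ _<_ (sym r≡) (cong (2 ^ l +_) (+-identityʳ (2 ^ l))) upper)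
        l<d : l < d
        l<d = ≰⇒> λ d≤l → <⇒≱ (≤-<-trans lower (s≤s i<v)) (≤-trans (≤-reflexive (sym 2^d≡)) (^-monoʳ-≤ 2 d≤l))
        m = d ∸ suc l
        l+m≡ : l + suc m ≡ d
        l+m≡ = trans (+-suc l m) (m+[n∸m]≡n l<d)
        width≡ : 2 ^ m * 2 ^ suc l ≡ v + 1
        width≡ = trans (sym (^-distribˡ-+-* 2 m (suc l)))
          (trans (cong (2 ^_) (trans (+-comm m (suc l)) (m+[n∸m]≡n l<d))) (trans 2^d≡ (+-comm 1 v)))
        twice : suc i + suc i ∸ 2 ^ suc l ≡ 2 * r
        twice = trans (cong (_∸ 2 ^ suc l) (trans (cong (λ k → k + k) (sym r≡)) (arrange (2 ^ l) r)))
          (m+n∸m≡n (2 ^ suc l) (2 * r))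
          where
          arrange : ∀ w r → (w + r) + (w + r) ≡ 2 * w + 2 * r
          arrange = solve-∀
        step-width : quotient (v + 1) (2 ^ suc l) ≡ 2 ^ m
        step-width = trans (quotient≡/ (v + 1) (2 ^ suc l) {{m^n≢0 2 (suc l)}})
          (trans (cong (λ x → _/_ x (2 ^ suc l) {{m^n≢0 2 (suc l)}}) (sym width≡)) (m*n/n≡m (2 ^ m) (2 ^ suc l) {{m^n≢0 2 (suc l)}}))
        index = (2 * r + 1) * 2 ^ m
        odd≤ : 2 * r + 1 ≤ 2 ^ suc l
        odd≤ = ≤-trans (≤-reflexive (+-comm (2 * r) 1)) (*-monoʳ-< 2 r<)
        index≤ : index ≤ v + 1
        index≤ = ≤-trans (*-monoˡ-≤ (2 ^ m) odd≤) (≤-reflexive (trans (*-comm (2 ^ suc l) (2 ^ m)) width≡))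
        v+1≤U : v + 1 ≤ U
        v+1≤U = ≤-trans (≤-reflexive (+-comm v 1)) v<U
        index<U : index ∸ 1 < U
        index<U = ≤-<-trans (≤-trans (∸-monoˡ-≤ 1 index≤) (≤-reflexive (m+n∸n≡m v 1))) v<U
        2i≤U : suc i + suc i ≤ U
        2i≤U = ≤-trans (+-mono-≤ (≤-trans i<v (<⇒≤ v<A)) (≤-trans i<v (<⇒≤ v<A))) (<⇒≤ A+A<U)
        2r≤U : 2 * r ≤ U
        2r≤U = ≤-trans (<⇒≤ (*-monoʳ-< 2 r<)) (≤-trans (≤-trans (*-monoʳ-≤ 2 lower)
          (≤-reflexive (cong (suc i +_) (+-identityʳ (suc i))))) 2i≤U)
        2^l+1≤U : 2 ^ suc l ≤ U
        2^l+1≤U = ≤-trans (^-monoʳ-≤ 2 l<d) (≤-trans (≤-reflexive 2^d≡) v<U)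
        i<U : suc i < U
        i<U = ≤-<-trans i<v v<U
        planted′ : Planted (M 4 [ suc i ↦ cells s 3 (index ∸ 1) ]) (suc (suc i))
        planted′ l′ m′ r′ eq r′< lt with suc i ≟ 2 ^ l′ + r′
        ... | no ≢ = trans (updated-other (M 4) ≢) (planted l′ m′ r′ eq r′< (≤∧≢⇒< (≤-pred lt) (≢-sym ≢)))
        -- Node number and depth determine level, place and height, so the required splitter is the
        -- one just stored.
        ... | yes same with level-unique {l} {r} {l′} {r′} r< r′< (trans r≡ same)
        ... | refl , r≡r′ rewrite sym r≡r′ | sym (suc-injective (+-cancelˡ-≡ l _ _ (trans l+m≡ (sym eq)))) | r≡ =
          updated-same (M 4) (suc i)
        step : Dec (2 ^ suc l ≤ suc (suc i)) → ∃[ σ′ ] ∃[ M′ ] Exec 0 treeStep _ M σ′ M′ × Inv (suc i) σ′ M′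
        step (yes grow) = _ , _ ,
          ( ins (op refl refl refl (fits₁ 2i≤U)) ⨾
            ins (op refl refl twice (fits₁ 2r≤U)) ⨾
            ins (op refl refl refl (fits₁ (≤-trans odd≤ 2^l+1≤U))) ⨾
            ins (op refl refl step-width (fits₁ (≤-trans (^-monoʳ-≤ 2 (m∸n≤m d (suc l))) (≤-trans (≤-reflexive 2^d≡) v<U)))) ⨾
            ins (op refl refl refl (fits₁ (≤-trans index≤ v+1≤U))) ⨾
            ins (op refl refl refl (fits₁ (<⇒≤ index<U))) ⨾
            fetch-shared {k = 3} refl (≤ᵇ⇒≤ 3 14 _) refl index<U (λ _ ()) refl ⨾
            put-own {k = 4} refl (≤ᵇ⇒≤ 4 14 _) refl i<U refl refl ⨾
            ins (op refl refl (+-comm (suc i) 1) (fits₁ i<U)) ⨾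
            ins (op refl refl (leq-yes grow) (fits₁ 0<U)) ⨾
            ins (when-yes refl (op refl refl (cong (2 ^ suc l +_) (sym (+-identityʳ (2 ^ suc l)))) (fits₁ (≤-trans
               (*-monoʳ-≤ 2 (^-monoʳ-≤ 2 l<d)) (≤-trans 2*2^d≤A (<⇒≤ A<U))))) ))
          , inv (suc l) refl grow (≤-<-trans upper (m<m+n (2 ^ suc l) (≤-trans (m^n>0 2 (suc l)) (m≤m+n _ 0)))) planted′
        step (no keep) = _ , _ ,
          ( ins (op refl refl refl (fits₁ 2i≤U)) ⨾
            ins (op refl refl twice (fits₁ 2r≤U)) ⨾
            ins (op refl refl refl (fits₁ (≤-trans odd≤ 2^l+1≤U))) ⨾
            ins (op refl refl step-width (fits₁ (≤-trans (^-monoʳ-≤ 2 (m∸n≤m d (suc l))) (≤-trans (≤-reflexive 2^d≡) v<U)))) ⨾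
            ins (op refl refl refl (fits₁ (≤-trans index≤ v+1≤U))) ⨾
            ins (op refl refl refl (fits₁ (<⇒≤ index<U))) ⨾
            fetch-shared {k = 3} refl (≤ᵇ⇒≤ 3 14 _) refl index<U (λ _ ()) refl ⨾
            put-own {k = 4} refl (≤ᵇ⇒≤ 4 14 _) refl i<U refl refl ⨾
            ins (op refl refl (+-comm (suc i) 1) (fits₁ i<U)) ⨾
            ins (op refl refl (leq-no (≰⇒> keep)) (fits₁ z≤n)) ⨾
            ins (when-no refl) )
          , inv l refl (≤-trans lower (n≤1+n (suc i))) (≰⇒> keep) planted′

      run : ∀ f → ∃[ σ′ ] ∃[ M′ ] Exec 0 treeCode (file f) (cells s) σ′ M′ × Planted (M′ 4) (suc v)
      run f with iterate v Inv body {M = cells s}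
        (inv {z = f 0} {r₀ = f 3} {f 4} {f 5} {f 6} {f 7} {f 8} {f 9} {f 10} {f 11} 0 refl ≤-refl ≤-refl
          (λ l m r _ _ lt → contradiction lt (≤⇒≯ (≤-trans (m^n>0 2 l) (m≤m+n (2 ^ l) r)))))
      ... | _ , _ , iter , inv _ _ _ _ planted = _ , _ ,
        ( ins (op refl refl refl (fits₁ 0<U)) ⨾
          ins (op refl refl refl (fits₁ (≤-trans (s≤s (s≤s z≤n)) (≤-trans (+-mono-≤ (≤-trans 1≤v (<⇒≤ v<A)) (≤-trans 1≤v (<⇒≤ v<A))) (<⇒≤ A+A<U))))) ⨾
          rep refl (fits₁ (<⇒≤ v<U)) iter )
        , planted

    run-tree : ∀ s → s ⊨ Kr → Out (compile r1 0 treeCode) s (duration Kr treeCode) (1 * duration Kr treeCode)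
      λ s′ → s′ ⊨ Kr × (∀ l m r → l + suc m ≡ d → r < 2 ^ l → cells s′ 4 (2 ^ l + r) ≡ cells s 3 ((2 * r + 1) * 2 ^ m ∸ 1)) ×
        (∀ k i → i < U → k ≢ 4 → cells s′ k i ≡ cells s k i)
    run-tree s h′ = weaken ≤-refl ≤-refl
      (λ s′ (h″ , own , frame) → h″ , (λ l m r eq r< → trans
          (proj₂ (proj₂ (own z<s)) 4 (2 ^ l + r) (<-trans (node< l m r eq r<) (≤-<-trans v<A A<U)) refl)
          (proj₁ (proj₂ (own z<s)) l m r eq r< (node< l m r eq r<)))
        , (λ k i i<U ¬own → frame k i i<U λ _ → ¬own))
      (run-parallel {Own = Own} (solo refl refl (≤ᵇ⇒≤ 45 50 _) _) h′ refl
        (λ _ M → Planted (M 4) (suc v)) λ { zero _ → run ; (suc _) (s≤s ()) })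
      where
      open Planting s
      node< : ∀ l m r → l + suc m ≡ d → r < 2 ^ l → 2 ^ l + r < suc v
      node< l m r eq r< = <-≤-trans (+-monoʳ-< (2 ^ l) r<) (≤-trans
        (≤-reflexive (cong (2 ^ l +_) (sym (+-identityʳ (2 ^ l)))))
        (≤-trans (^-monoʳ-≤ 2 (subst (suc l ≤_) eq (≤-trans (s≤s (m≤m+n l m)) (≤-reflexive (sym (+-suc l m))))))
                 (≤-reflexive 2^d≡)))

  -- Buckets, owners and output positions

  module Classes (x t : ℕ → ℕ) where
    open Env env using (charWord)

    0<L : 0 < L
    0<L with L | n≤L*p
    ... | suc _ | _ = z<s
    ... | zero  | n≤0 = contradiction (<-≤-trans 0<n n≤0) (λ ())

    instance
      L≢0 : NonZero L
      L≢0 = >-nonZero 0<L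

    -- Positions beyond the last string get a bucket of their own, so that all
    -- processors handle the same number of strings.
    bucketOf : ℕ → ℕ
    bucketOf j = if does (n ≤? j) then K ∸ 1 else bucket x t d v (charWord j h)

    owner : ℕ → ℕ
    owner j = j / L

    -- A key is at once the index of a counter. Hence final counters are ranks, and their prefix
    -- sums are the values of `start`.
    key : ℕ → ℕ
    key j = bucketOf j * p + owner j

    open Ranks key public

    bucketOf-string : ∀ {j} → j < n → bucketOf j ≡ bucket x t d v (charWord j h)
    bucketOf-string {j} j<n rewrite dec-false (n ≤? j) (<⇒≱ j<n) = refl

    bucketOf-surplus : ∀ {j} → n ≤ j → bucketOf j ≡ K ∸ 1
    bucketOf-surplus {j} n≤j rewrite dec-true (n ≤? j) n≤j = refl

    K≡suc : K ≡ suc (2 * v + 1)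
    K≡suc = trans K≡ (arrange v)
      where
      arrange : ∀ v → (v + 1) + (v + 1) ≡ suc (2 * v + 1)
      arrange = solve-∀

    bucketOf-< : ∀ j → bucketOf j < K
    bucketOf-< j with n ≤? j
    ... | yes n≤j = ≤-reflexive (trans (cong suc (trans (bucketOf-surplus n≤j) (cong (_∸ 1) K≡suc))) (sym K≡suc))
    ... | no n≰j = subst (bucketOf j <_) (sym K≡suc) (≤-trans
      (≤-reflexive (cong suc (bucketOf-string (≰⇒> n≰j)))) (≤-trans (bucket-< x t d v _ (sym 2^d≡)) (n≤1+n _)))

    owner-chunk : ∀ {q j} → InChunk L q j → owner j ≡ q
    owner-chunk (l , u) = /-unique l u

    chunk-owner : ∀ j → InChunk L (owner j) j
    chunk-owner j = m/n*n≤m j L , m<[1+m/n]*n j L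

    owner-< : ∀ {j} → j < L * p → owner j < p
    owner-< {j} j< = m<n*o⇒m/o<n {j} {p} {L} (subst (j <_) (*-comm L p) j<)

    key-owner : ∀ {j m q} → j < L * p → q < p → key j ≡ m * p + q → owner j ≡ q
    key-owner {j} {m} {q} j< q<p eq = proj₂ (cell-injective {p} {bucketOf j} {owner j} {m} {q} (owner-< j<) q<p eq)

    cell-< : ∀ {m q N} → m < N → q < p → m * p + q < N * p
    cell-< {m} {q} m<N q<p = <-≤-trans (+-monoʳ-< (m * p) q<p)
      (≤-trans (≤-reflexive (+-comm (m * p) p)) (*-monoˡ-≤ p m<N))

    chunk-< : ∀ {q i} → q < p → i < L → q * L + i < L * p
    chunk-< {q} {i} q<p i<L = <-≤-trans (+-monoʳ-< (q * L) i<L)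
      (≤-trans (≤-reflexive (+-comm (q * L) L)) (≤-trans (*-monoˡ-≤ L q<p) (≤-reflexive (*-comm p L))))

    -- Positions before the chunk of `q` have other owners. Together with `rank-after`, this turns a
    -- count within one chunk into a count over all positions.
    rank-before : ∀ {m q} → q < p → rank (m * p + q) (q * L) ≡ 0
    rank-before {m} {q} q<p = rank-const z≤n λ j _ j<qL eq → contradiction
      (≤-trans (≤-reflexive (cong (_* L) (sym (key-owner {j} {m} (<-≤-trans j<qL
         (≤-trans (*-monoˡ-≤ L (<⇒≤ q<p)) (≤-reflexive (*-comm p L)))) q<p eq)))) (proj₁ (chunk-owner j)))
      (<⇒≱ j<qL)

    rank-after : ∀ {m q} → q < p → rank (m * p + q) (L * p) ≡ rank (m * p + q) (suc q * L)
    rank-after {m} {q} q<p = rank-const (≤-trans (*-monoˡ-≤ L q<p) (≤-reflexive (*-comm p L))) λ j ≤j j< eq →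
      contradiction (subst (λ q → j < suc q * L) (key-owner {j} {m} j< q<p eq) (proj₂ (chunk-owner j))) (≤⇒≯ ≤j)

    OwnCounters : ℕ → ℕ → Set
    OwnCounters q i = ∃[ m ] i ≡ m * p + q

    counters-unique : ∀ {q q′ i} → q < p → q′ < p → OwnCounters q i → OwnCounters q′ i → q ≡ q′
    counters-unique {q} {q′} q<p q′<p (m , refl) (m′ , eq) = proj₂ (cell-injective {p} {m} {q} {m′} {q′} q<p q′<p eq)

    total : ℕ
    total = L * p

    position : ℕ → ℕ
    position j = start total (key j) + rank (key j) j

    position-< : ∀ {j} → j < total → position j < start total (suc (key j))
    position-< {j} j< = +-monoʳ-< (start total (key j)) (rank-< j<)

    -- A common position forces a common key by `start-unique`, and within a class the rank
    -- increases strictly.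
    position-≢ : ∀ {i j} → i < j → j < total → position i ≢ position j
    position-≢ {i} {j} i<j j< eq = <⇒≢ rank< (+-cancelˡ-≡ (start total (key i)) _ _
      (trans eq (cong (λ k → start total k + rank k j) (sym keys))))
      where
      keys : key i ≡ key j
      keys = start-unique {total} {key i} {key j} {position i} (m≤m+n (start total (key i)) _) (position-< (<-trans i<j j<))
        (≤-trans (m≤m+n (start total (key j)) _) (≤-reflexive (sym eq))) (≤-<-trans (≤-reflexive eq) (position-< j<))
      rank< : rank (key i) i < rank (key i) j
      rank< = rank-< i<j

    position<U : ∀ {j} → j < total → position j < U
    position<U j< = <-≤-trans (position-< j<) (≤-trans (start-≤ total _) (<⇒≤ L*p<U))

    ranks≤U : ∀ k → sumTo (λ k → rank k total) k ≤ U
    ranks≤U k = ≤-trans (start-≤ total k) (<⇒≤ L*p<U)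

  -- Classification and counting

  module ClassRuns (x t : ℕ → ℕ) where
    open Env env using (charWord)
    open Classes x t

    module _ (src dst W rounds W2 tmp cnt k′ sample : ℕ) where
      private Kr = registers src dst W rounds W2 tmp cnt k′ sample

      module Classifying (s : State) (x≡ : ∀ i → i < U → cells s 3 i ≡ x i) (t≡ : ∀ i → i < U → cells s 4 i ≡ t i)
        (no-strings : ∀ i → i < U → cells s 7 i ≡ 0) where

        Own : ℕ → ℕ → ℕ → Set
        Own q k i = (k ≡ 6 × InChunk L q i) ⊎ (k ≡ 7 × OwnCounters q i)

        disjoint : ∀ {q q′ k i} → q < p → q′ < p → i < U → Own q k i → Own q′ k i → q ≡ q′
        disjoint _ _ _ (inj₁ (_ , o)) (inj₁ (_ , o′)) = chunk-unique o o′
        disjoint q< q′< _ (inj₂ (_ , o)) (inj₂ (_ , o′)) = counters-unique q< q′< o o′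
        disjoint _ _ _ (inj₁ (refl , _)) (inj₂ (() , _))
        disjoint _ _ _ (inj₂ (refl , _)) (inj₁ (() , _))

        open AccessIn p Kr Own (cells s)

        read-only : ∀ {k i} → k ≢ 6 → k ≢ 7 → Shared k i
        read-only k≢6 k≢7 _ = [ k≢6 ∘ proj₁ , k≢7 ∘ proj₁ ]′

        descent : ∀ {q c} m {z j i y r₀ r₁ r₂ r₃ r₄ r₅ r₆ M} → 2 ^ m * suc i ≤ 2 * 2 ^ d →
          ∃[ z′ ] ∃[ y′ ] Iter q m descendStep
            (z ∷ j ∷ c ∷ i ∷ y ∷ r₀ ∷ r₁ ∷ r₂ ∷ r₃ ∷ r₄ ∷ r₅ ∷ r₆ ∷ []) M
            (z′ ∷ j ∷ c ∷ descend t c m i ∷ y′ ∷ r₀ ∷ r₁ ∷ r₂ ∷ r₃ ∷ r₄ ∷ r₅ ∷ r₆ ∷ []) M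
        descent zero _ = _ , _ , []
        descent {q} {c} (suc m) {z} {j} {i} bound with descent {q} {c} m {4 * U + i} {j} {2 * i + [ does (t i <? c) ]ᵇ} bound′
          where
          bound′ : 2 ^ m * suc (2 * i + [ does (t i <? c) ]ᵇ) ≤ 2 * 2 ^ d
          bound′ = ≤-trans (*-monoʳ-≤ (2 ^ m) (s≤s (+-monoʳ-≤ (2 * i) ([]ᵇ≤1 (does (t i <? c))))))
            (≤-trans (≤-reflexive (arrange (2 ^ m) i)) bound)
            where
            arrange : ∀ w i → w * suc (2 * i + 1) ≡ 2 * w * suc i
            arrange = solve-∀
        ... | z′ , y′ , iter = z′ , y′ ,
          ( fetch-shared {k = 4} refl (≤ᵇ⇒≤ 4 14 _) refl i<U (read-only (λ ()) (λ ())) (t≡ i i<U) ⨾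
            ins (op refl refl refl (bit-fits _)) ⨾
            ins (op refl refl refl (fits₁ (≤-trans (m≤m+n (i + i) 1) 2i+1≤U))) ⨾
            ins (op refl refl refl (fits₁ 2i+1≤U)) ⨾
            ins (op refl refl (right-child (t i) c i) (fits₁ (≤-trans (≤-reflexive (sym (right-child (t i) c i)))
              (≤-trans (m∸n≤m (i + i + 1) [ does (c ≤? t i) ]ᵇ) 2i+1≤U)))) )
          ∷ iter
          where
          2i+2≤ : 2 * suc i ≤ 2 * 2 ^ d
          2i+2≤ = ≤-trans (*-monoˡ-≤ (suc i) (*-monoʳ-≤ 2 (m^n>0 2 m))) bound
          2i+1≤U : i + i + 1 ≤ U
          2i+1≤U = ≤-trans (≤-trans (n≤1+n _) (≤-trans (≤-reflexive (arrange i)) 2i+2≤)) (≤-trans 2*2^d≤A (<⇒≤ A<U))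
            where
            arrange : ∀ i → suc (i + i + 1) ≡ 2 * suc i
            arrange = solve-∀
          i<U : i < U
          i<U = <-≤-trans (<-≤-trans (n<1+n i) (≤-trans (m≤m+n (suc i) _) 2i+2≤)) (≤-trans 2*2^d≤A (<⇒≤ A<U))

        module _ {q : ℕ} (q<p : q < p) where

          data Inv (i : ℕ) : List ℕ → Mem → Set where
            inv : ∀ {z r₀ r₁ r₂ r₃ r₄ r₅ r₆ r₇ r₈ r₉ M} →
              (∀ i′ → i′ < i → M 6 (q * L + i′) ≡ bucketOf (q * L + i′)) →
              (∀ m → m < K → M 7 (m * p + q) ≡ rank (m * p + q) (q * L + i)) →
              Inv i (z ∷ (q * L + i) ∷ r₀ ∷ r₁ ∷ r₂ ∷ r₃ ∷ r₄ ∷ r₅ ∷ r₆ ∷ r₇ ∷ r₈ ∷ r₉ ∷ []) M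

          -- The two steps are bundled because the bit `u` selects the rule for `when`. Both cases
          -- end with `bucketOf j`, which spares `body` a case distinction.
          overrule : ∀ {z j c i y r₀ r₁ r₂ r₃ r₄ r₅ r₆ M} → c ≡ charWord j h → r₁ ≡ bucket x t d v c →
            ∃[ u ] Step q (op 5 leq (ctl rn) (loc 1))
              (z ∷ j ∷ c ∷ i ∷ y ∷ r₀ ∷ r₁ ∷ r₂ ∷ r₃ ∷ r₄ ∷ r₅ ∷ r₆ ∷ []) M
              (z ∷ j ∷ c ∷ i ∷ y ∷ u ∷ r₁ ∷ r₂ ∷ r₃ ∷ r₄ ∷ r₅ ∷ r₆ ∷ []) M ×
            Step q (when (loc 5) (op 6 sub (ctl rK) (ctl r1)))
              (z ∷ j ∷ c ∷ i ∷ y ∷ u ∷ r₁ ∷ r₂ ∷ r₃ ∷ r₄ ∷ r₅ ∷ r₆ ∷ []) M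
              (z ∷ j ∷ c ∷ i ∷ y ∷ u ∷ bucketOf j ∷ r₂ ∷ r₃ ∷ r₄ ∷ r₅ ∷ r₆ ∷ []) M
          overrule {j = j} refl refl with n ≤? j
          ... | yes n≤j = 1 , op refl refl (leq-yes n≤j) (fits₁ 0<U)
            , when-yes refl (op refl refl (sym (bucketOf-surplus n≤j))
                (fits₁ (≤-trans (<⇒≤ (bucketOf-< j)) (≤-trans (m≤m*n K p) (<⇒≤ K*p<U)))))
          ... | no n≰j = 0 , op refl refl (leq-no (≰⇒> n≰j)) (fits₁ z≤n)
            , subst (λ o → Step q _ _ _ (_ ∷ _ ∷ _ ∷ _ ∷ _ ∷ _ ∷ o ∷ _) _) (sym (bucketOf-string (≰⇒> n≰j))) (when-no refl)

          body : ∀ i σ M → i < L → Inv i σ M → ∃[ σ′ ] ∃[ M′ ] Exec q classifyString σ M σ′ M′ × Inv (suc i) σ′ M′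
          body i _ M i<L (inv {z} {r₀} {r₁} {r₂} {r₃} {r₄} {r₅} {r₆} {r₇} {r₈} {r₉} classified counted)
            with descent {q} {charWord (q * L + i) h} d {z} {q * L + i} {1} {r₂} {r₃} {r₄} {r₅} {r₆} {r₇} {r₈} {r₉} {M} (≤-reflexive (*-comm (2 ^ d) 2))
          ... | z′ , y′ , iter
            with overrule {3 * U + leaf} {q * L + i} {c} {leaf} {[ does (leaf <? v) ]ᵇ * [ does (c ≟ x leaf) ]ᵇ} {[ does (leaf <? v) ]ᵇ}
                   {M = M} refl refl
            where
            c = charWord (q * L + i) h
            leaf = descend t c d 1 ∸ (v + 1)
          ... | u , overrule₁ , overrule₂ = _ , _ ,
            ( ins (chars refl refl refl (word-fits (charWord-< I _ h))) ⨾
              ins (op refl refl refl (fits₁ 0<U)) ⨾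
              rep refl (fits₁ (<⇒≤ d<U)) iter ⨾
              ins (op refl refl refl (fits₁ (<⇒≤ leaf<U))) ⨾
              fetch-shared {k = 3} refl (≤ᵇ⇒≤ 3 14 _) refl leaf<U (read-only (λ ()) (λ ())) (x≡ leaf leaf<U) ⨾
              ins (op refl refl refl (bit-fits _)) ⨾
              ins (op refl refl (+-comm leaf 1) (fits₁ leaf<U)) ⨾
              ins (op refl refl refl (bit-fits (does (leaf <? v)))) ⨾
              ins (op refl refl refl (subst (_< 2 ^ B) (sym ([]ᵇ-∧ (does (leaf <? v)) (does (c ≟ x leaf)))) (bit-fits _))) ⨾
              ins (op refl refl refl (fits₁ 2leaf≤U)) ⨾
              ins (op refl refl bucket≡ (fits₁ bucket≤U)) ⨾
              ins overrule₁ ⨾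
              ins overrule₂ ⨾
              put-own {k = 6} refl (≤ᵇ⇒≤ 6 14 _) refl j<U (inj₁ (refl , chunk)) refl ⨾
              ins (op refl refl refl (fits₁ (<⇒≤ (≤-<-trans (m≤m+n (bucketOf j * p) q) cell<U)))) ⨾
              ins (op refl refl refl (fits₁ (<⇒≤ cell<U))) ⨾
              fetch-own {k = 7} refl (≤ᵇ⇒≤ 7 14 _) refl cell<U (inj₂ (refl , bucketOf j , refl))
                (trans (counted (bucketOf j) (bucketOf-< j)) (cong (λ k → rank k j) (sym key≡))) ⨾
              ins (op refl refl (trans (+-comm (rank (key j) j) 1) (sym (rank-hit j refl)))
                (fits₁ (≤-trans (rank-≤ (key j) (suc j)) j<U))) ⨾
              put-own {k = 7} refl (≤ᵇ⇒≤ 7 14 _) refl cell<U (inj₂ (refl , bucketOf j , refl)) refl ⨾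
              ins (op refl refl (trans (+-assoc (q * L) i 1) (cong (q * L +_) (+-comm i 1)))
                (fits₁ (≤-trans (≤-reflexive (+-suc (q * L) i)) j<U))) )
            , inv classified′ counted′
            where
            j = q * L + i
            c = charWord j h
            leaf = descend t c d 1 ∸ (v + 1)
            leaf≤v : leaf ≤ v
            leaf≤v = leaf-≤ t c d v (sym 2^d≡)
            leaf<U : leaf < U
            leaf<U = ≤-<-trans leaf≤v v<U
            2leaf≤U : leaf + leaf ≤ U
            2leaf≤U = ≤-trans (+-mono-≤ (≤-trans leaf≤v (<⇒≤ v<A)) (≤-trans leaf≤v (<⇒≤ v<A))) (<⇒≤ A+A<U)
            bucket≡ : leaf + leaf + [ does (leaf <? v) ]ᵇ * [ does (c ≟ x leaf) ]ᵇ ≡ bucket x t d v c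
            bucket≡ = cong₂ _+_ (cong (leaf +_) (sym (+-identityʳ leaf))) ([]ᵇ-∧ (does (leaf <? v)) (does (c ≟ x leaf)))
            bucket≤U : bucket x t d v c ≤ U
            bucket≤U = ≤-trans (≤-trans (<⇒≤ (bucket-< x t d v c (sym 2^d≡))) (≤-trans (n≤1+n _) (≤-reflexive (sym K≡suc))))
              (≤-trans (m≤m*n K p) (<⇒≤ K*p<U))
            j<Lp : j < L * p
            j<Lp = chunk-< q<p i<L
            j<U : j < U
            j<U = <-trans j<Lp L*p<U
            chunk : InChunk L q j
            chunk = m≤m+n (q * L) i , ≤-trans (+-monoʳ-< (q * L) i<L) (≤-reflexive (+-comm (q * L) L))
            key≡ : key j ≡ bucketOf j * p + q
            key≡ = cong (bucketOf j * p +_) (owner-chunk chunk)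
            cell<U : bucketOf j * p + q < U
            cell<U = <-trans (cell-< (bucketOf-< j) q<p) K*p<U
            rank-≤ : ∀ k x → rank k x ≤ x
            rank-≤ k zero    = z≤n
            rank-≤ k (suc x) = ≤-trans (+-mono-≤ (rank-≤ k x) ([]ᵇ≤1 _)) (≤-reflexive (+-comm x 1))
            classified′ : ∀ i′ → i′ < suc i → (M 6 [ j ↦ bucketOf j ]) (q * L + i′) ≡ bucketOf (q * L + i′)
            classified′ i′ i′< with i′ ≟ i
            ... | yes refl = updated-same (M 6) j
            ... | no i′≢i = trans (updated-other (M 6) (≢-sym (i′≢i ∘ +-cancelˡ-≡ (q * L) i′ i)))
                                  (classified i′ (≤∧≢⇒< (≤-pred i′<) i′≢i))
            counted′ : ∀ m → m < K → (M 7 [ bucketOf j * p + q ↦ rank (key j) (suc j) ]) (m * p + q)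
              ≡ rank (m * p + q) (q * L + suc i)
            counted′ m m<K rewrite +-suc (q * L) i with m ≟ bucketOf j
            ... | yes refl = trans (updated-same (M 7) (m * p + q)) (cong (λ k → rank k (suc j)) key≡)
            ... | no m≢ = trans (updated-other (M 7) (m≢ ∘ sym ∘ same))
              (trans (counted m m<K) (sym (rank-miss j λ eq → m≢ (sym (same (trans (sym key≡) eq))))))
              where
              same : bucketOf j * p + q ≡ m * p + q → bucketOf j ≡ m
              same eq = proj₁ (cell-injective {p} {bucketOf j} {q} {m} {q} q<p q<p eq)

          Post : Mem → Set
          Post M = (∀ i → i < L → M 6 (q * L + i) ≡ bucketOf (q * L + i)) ×
                   (∀ m → m < K → M 7 (m * p + q) ≡ rank (m * p + q) (L * p))

          run : ∀ f → ∃[ σ′ ] ∃[ M′ ] Exec q classifyCode (file f) (cells s) σ′ M′ × Post M′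
          run f with iterate L Inv body {M = cells s}
            (inv {z = f 0} {f 2} {f 3} {f 4} {f 5} {f 6} {f 7} {f 8} {f 9} {f 10} {f 11} (λ _ ())
              (λ m m<K → trans (no-strings _ (<-trans (cell-< m<K q<p) K*p<U))
                 (sym (trans (cong (rank (m * p + q)) (+-identityʳ (q * L))) (rank-before {m} q<p)))))
          ... | _ , _ , iter , inv classified counted = _ , _ ,
            ( ins (op refl refl (sym (+-identityʳ (q * L))) (fits₁ (≤-trans (≤-reflexive (+-identityʳ (q * L)))
                (≤-trans (*-monoˡ-≤ L (<⇒≤ q<p)) (≤-trans (≤-reflexive (*-comm p L)) (<⇒≤ L*p<U)))))) ⨾
              rep refl (fits₁ (≤-trans (m≤m*n L p) (<⇒≤ L*p<U))) iter )
            , classified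
            , λ m m<K → trans (counted m m<K) (trans (cong (rank (m * p + q)) (+-comm (q * L) L)) (sym (rank-after {m} q<p)))

      run-classify : ∀ s → s ⊨ Kr → (∀ i → i < U → cells s 3 i ≡ x i) → (∀ i → i < U → cells s 4 i ≡ t i) →
        (∀ i → i < U → cells s 7 i ≡ 0) →
        Out (compile rp 0 classifyCode) s (duration Kr classifyCode) (p * duration Kr classifyCode)
        λ s′ → s′ ⊨ Kr × (∀ j → j < L * p → cells s′ 6 j ≡ bucketOf j) ×
          (∀ k → k < K * p → cells s′ 7 k ≡ rank k (L * p)) ×
          (∀ k i → i < U → k ≢ 6 → k ≢ 7 → cells s′ k i ≡ cells s k i)
      run-classify s h′ x≡ t≡ empty = weaken ≤-refl ≤-refl
        (λ s′ (h″ , own , frame) → h″ , classified s′ own , counted s′ own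
          , λ k i i<U k≢6 k≢7 → frame k i i<U (read-only k≢6 k≢7))
        (run-parallel {Own = Own} (everyone refl refl (≤ᵇ⇒≤ 45 50 _) disjoint) h′ refl
          Post′ (λ q q<p f → let σ′ , M′ , ex , post = run q<p f in σ′ , M′ , ex , post))
        where
        open Classifying s x≡ t≡ empty
        Post′ : ℕ → Mem → Set
        Post′ q M = (∀ i → i < L → M 6 (q * L + i) ≡ bucketOf (q * L + i)) ×
                    (∀ m → m < K → M 7 (m * p + q) ≡ rank (m * p + q) (L * p))
        module _ (s′ : State) (own : ∀ {q} → q < p → ∃[ M′ ] Post′ q M′ ×
                  (∀ k i → i < U → Own q k i → cells s′ k i ≡ M′ k i)) where
          classified : ∀ j → j < L * p → cells s′ 6 j ≡ bucketOf j
          classified j j< with own (owner-< j<)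
          ... | M′ , (done , _) , agrees = trans (agrees 6 j (<-trans j< L*p<U) (inj₁ (refl , chunk-owner j)))
            (subst (λ j → M′ 6 j ≡ bucketOf j) (m+[n∸m]≡n (proj₁ (chunk-owner j)))
              (done (j ∸ owner j * L) (+-cancelˡ-< (owner j * L) _ _
                (≤-trans (≤-reflexive (cong suc (m+[n∸m]≡n (proj₁ (chunk-owner j)))))
                  (≤-trans (proj₂ (chunk-owner j)) (≤-reflexive (+-comm L (owner j * L))))))))
          counted : ∀ k → k < K * p → cells s′ 7 k ≡ rank k (L * p)
          counted k k< with own (m%n<n k p)
          ... | M′ , (_ , done) , agrees = trans (agrees 7 k (<-trans k< K*p<U) (inj₂ (refl , k / p , k≡)))
            (subst (λ k → M′ 7 k ≡ rank k (L * p)) (sym k≡) (done (k / p) (m<n*o⇒m/o<n {k} {K} {p} k<)))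
            where
            k≡ : k ≡ k / p * p + k % p
            k≡ = trans (m≡m%n+[m/n]*n k p) (+-comm (k % p) _)

    -- Redistribution

    module _ (src dst W rounds W2 tmp cnt k′ sample : ℕ) where
      private Kr = registers src dst W rounds W2 tmp cnt k′ sample

      module Moving (s : State) (classified : ∀ j → j < total → cells s 6 j ≡ bucketOf j)
        (cursors : ∀ k → k < K * p → cells s 11 k ≡ start total k) where

        -- An output cell belongs to the processor whose key's segment contains it. The segments are
        -- disjoint, so the scattered writes are exclusive although their addresses depend on the
        -- data.
        Own : ℕ → ℕ → ℕ → Set
        Own q k i = (k ≡ 11 × OwnCounters q i) ⊎
          (k ≡ 12 × ∃[ m ] start total (m * p + q) ≤ i × i < start total (suc (m * p + q)))

        disjoint : ∀ {q q′ k i} → q < p → q′ < p → i < U → Own q k i → Own q′ k i → q ≡ q′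
        disjoint q< q′< _ (inj₁ (_ , o)) (inj₁ (_ , o′)) = counters-unique q< q′< o o′
        disjoint _ _ _ (inj₁ (refl , _)) (inj₂ (() , _))
        disjoint _ _ _ (inj₂ (refl , _)) (inj₁ (() , _))
        disjoint {q} {q′} q< q′< _ (inj₂ (_ , m , l , u)) (inj₂ (_ , m′ , l′ , u′)) =
          proj₂ (cell-injective {p} {m} {q} {m′} {q′} q< q′< (start-unique {total} l u l′ u′))

        open AccessIn p Kr Own (cells s)

        read-only : ∀ {k i} → k ≢ 11 → k ≢ 12 → Shared k i
        read-only k≢11 k≢12 _ = [ k≢11 ∘ proj₁ , k≢12 ∘ proj₁ ]′

        module _ {q : ℕ} (q<p : q < p) where

          data Inv (i : ℕ) : List ℕ → Mem → Set where
            inv : ∀ {z r₀ r₁ r₂ r₃ r₄ r₅ r₆ r₇ r₈ r₉ M} →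
              (∀ i′ → i′ < i → M 12 (position (q * L + i′)) ≡ q * L + i′) →
              (∀ m → m < K → M 11 (m * p + q) ≡ start total (m * p + q) + rank (m * p + q) (q * L + i)) →
              Inv i (z ∷ (q * L + i) ∷ r₀ ∷ r₁ ∷ r₂ ∷ r₃ ∷ r₄ ∷ r₅ ∷ r₆ ∷ r₇ ∷ r₈ ∷ r₉ ∷ []) M

          body : ∀ i σ M → i < L → Inv i σ M → ∃[ σ′ ] ∃[ M′ ] Exec q redistributeStep σ M σ′ M′ × Inv (suc i) σ′ M′
          body i _ M i<L (inv moved advanced) = _ , _ ,
            ( fetch-shared {k = 6} refl (≤ᵇ⇒≤ 6 14 _) refl j<U (read-only (λ ()) (λ ())) (classified j j<) ⨾
              ins (op refl refl refl (fits₁ (<⇒≤ (≤-<-trans (m≤m+n (bucketOf j * p) q) cell<U)))) ⨾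
              ins (op refl refl refl (fits₁ (<⇒≤ cell<U))) ⨾
              fetch-own {k = 11} refl (≤ᵇ⇒≤ 11 14 _) refl cell<U (inj₁ (refl , bucketOf j , refl))
                (trans (advanced (bucketOf j) (bucketOf-< j)) (cong (λ k → start total k + rank k j) (sym key≡))) ⨾
              put-own {k = 12} refl (≤ᵇ⇒≤ 12 14 _) refl (position<U j<) own-position refl ⨾
              ins (op refl refl refl (fits₁ (≤-trans (≤-reflexive (+-comm (position j) 1)) (position<U j<)))) ⨾
              put-own {k = 11} refl (≤ᵇ⇒≤ 11 14 _) refl cell<U (inj₁ (refl , bucketOf j , refl)) refl ⨾
              ins (op refl refl (trans (+-assoc (q * L) i 1) (cong (q * L +_) (+-comm i 1)))
                (fits₁ (≤-trans (≤-reflexive (+-suc (q * L) i)) j<U))) )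
            , inv moved′ advanced′
            where
            j = q * L + i
            j< : j < total
            j< = chunk-< q<p i<L
            j<U : j < U
            j<U = <-trans j< L*p<U
            chunk : InChunk L q j
            chunk = m≤m+n (q * L) i , ≤-trans (+-monoʳ-< (q * L) i<L) (≤-reflexive (+-comm (q * L) L))
            key≡ : key j ≡ bucketOf j * p + q
            key≡ = cong (bucketOf j * p +_) (owner-chunk chunk)
            cell<U : bucketOf j * p + q < U
            cell<U = <-trans (cell-< (bucketOf-< j) q<p) K*p<U
            own-position : Own q 12 (position j)
            own-position = inj₂ (refl , bucketOf j , subst (λ k → start total k ≤ position j) key≡ (m≤m+n _ _)
              , subst (λ k → position j < start total (suc k)) key≡ (position-< j<))
            moved′ : ∀ i′ → i′ < suc i → (M 12 [ position j ↦ j ]) (position (q * L + i′)) ≡ q * L + i′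
            moved′ i′ i′< with i′ ≟ i
            ... | yes refl = updated-same (M 12) (position j)
            ... | no i′≢i = trans (updated-other (M 12) (≢-sym (position-≢ (+-monoʳ-< (q * L) i′<i) j<))) (moved i′ i′<i)
              where
              i′<i : i′ < i
              i′<i = ≤∧≢⇒< (≤-pred i′<) i′≢i
            advanced′ : ∀ m → m < K → (M 11 [ bucketOf j * p + q ↦ position j + 1 ]) (m * p + q)
              ≡ start total (m * p + q) + rank (m * p + q) (q * L + suc i)
            advanced′ m m<K rewrite +-suc (q * L) i with m ≟ bucketOf j
            ... | yes refl = trans (updated-same (M 11) (m * p + q)) (trans (+-assoc (start total (key j)) (rank (key j) j) 1)
              (trans (cong (start total (key j) +_) (trans (+-comm (rank (key j) j) 1) (sym (rank-hit j refl))))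
                     (cong (λ k → start total k + rank k (suc j)) key≡)))
            ... | no m≢ = trans (updated-other (M 11) (m≢ ∘ sym ∘ same))
              (trans (advanced m m<K) (cong (start total (m * p + q) +_) (sym (rank-miss j λ eq → m≢ (sym (same (trans (sym key≡) eq)))))))
              where
              same : bucketOf j * p + q ≡ m * p + q → bucketOf j ≡ m
              same eq = proj₁ (cell-injective {p} {bucketOf j} {q} {m} {q} q<p q<p eq)

          run : ∀ f → ∃[ σ′ ] ∃[ M′ ] Exec q redistributeCode (file f) (cells s) σ′ M′ ×
            (∀ i → i < L → M′ 12 (position (q * L + i)) ≡ q * L + i)
          run f with iterate L Inv body {M = cells s}
            (inv {z = f 0} {f 2} {f 3} {f 4} {f 5} {f 6} {f 7} {f 8} {f 9} {f 10} {f 11} (λ _ ())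
              (λ m m<K → trans (cursors _ (cell-< m<K q<p)) (trans (sym (+-identityʳ _))
                 (cong (start total (m * p + q) +_) (sym (trans (cong (rank (m * p + q)) (+-identityʳ (q * L))) (rank-before {m} q<p)))))))
          ... | _ , _ , iter , inv moved advanced = _ , _ ,
            ( ins (op refl refl (sym (+-identityʳ (q * L))) (fits₁ (≤-trans (≤-reflexive (+-identityʳ (q * L)))
                (≤-trans (*-monoˡ-≤ L (<⇒≤ q<p)) (≤-trans (≤-reflexive (*-comm p L)) (<⇒≤ L*p<U)))))) ⨾
              rep refl (fits₁ (≤-trans (m≤m*n L p) (<⇒≤ L*p<U))) iter )
            , moved

      run-redistribute : ∀ s → s ⊨ Kr → (∀ j → j < total → cells s 6 j ≡ bucketOf j) →
        (∀ k → k < K * p → cells s 11 k ≡ start total k) →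
        Out (compile rp 0 redistributeCode) s (duration Kr redistributeCode) (p * duration Kr redistributeCode)
        λ s′ → s′ ⊨ Kr × (∀ j → j < total → cells s′ 12 (position j) ≡ j) ×
          (∀ k i → i < U → k ≢ 11 → k ≢ 12 → cells s′ k i ≡ cells s k i)
      run-redistribute s h′ classified cursors = weaken ≤-refl ≤-refl
        (λ s′ (h″ , own , frame) → h″ , moved s′ own
          , λ k i i<U k≢11 k≢12 → frame k i i<U (read-only k≢11 k≢12))
        (run-parallel {Own = Own} (everyone refl refl (≤ᵇ⇒≤ 45 50 _) disjoint) h′ refl
          Post (λ q q<p f → run q<p f))
        where
        open Moving s classified cursors
        Post : ℕ → Mem → Set
        Post q M = ∀ i → i < L → M 12 (position (q * L + i)) ≡ q * L + i
        moved : ∀ s′ → (∀ {q} → q < p → ∃[ M′ ] Post q M′ × (∀ k i → i < U → Own q k i → cells s′ k i ≡ M′ k i)) →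
          ∀ j → j < total → cells s′ 12 (position j) ≡ j
        moved s′ own j j< with own (owner-< j<)
        ... | M′ , done , agrees = trans (agrees 12 (position j) (position<U j<) (inj₂ (refl , bucketOf j , m≤m+n _ _ , position-< j<)))
          (subst (λ j → M′ 12 (position j) ≡ j) (m+[n∸m]≡n (proj₁ (chunk-owner j)))
            (done (j ∸ owner j * L) (+-cancelˡ-< (owner j * L) _ _
              (≤-trans (≤-reflexive (cong suc (m+[n∸m]≡n (proj₁ (chunk-owner j)))))
                (≤-trans (proj₂ (chunk-owner j)) (≤-reflexive (+-comm L (owner j * L))))))))

  -- Prefix sums of the counters

  leaf<U : ∀ {q} → q < Λ → Λ + q < U
  leaf<U {q} q<Λ = <-trans (+-monoʳ-< Λ q<Λ) (≤-<-trans (≤-reflexive (cong (Λ +_) (sym (+-identityʳ Λ)))) 2Λ<U)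

  1<U : 1 < U
  1<U = ≤-<-trans 1≤v v<U

  apart : ∀ {k l} m {_ : IsTrue (l ≤ᵇ m)} → k < l → k ≢ m
  apart {l = l} m {l≤m} k<l refl = <⇒≱ k<l (≤ᵇ⇒≤ l m l≤m)

  -- Apart from the merges and the levels of the sweeps, every block takes its loop counts from the
  -- fixed registers, so zeros may stand for the variable ones.
  D : Code → ℕ
  D = duration (registers 0 0 0 0 0 0 0 0 0)

  sweepTime sweepWork scanTime scanWork splitTime splitWork restTime restWork : ℕ
  sweepTime = 1 + ((2 + sumTo (λ _ → 11 + 2) lam) + (1 + (2 + sumTo (λ _ → 13 + 2) lam)))
  sweepWork = 1 + ((2 + sumTo (λ i → 1 + 2 ^ (lam ∸ suc i) * 10 + 2) lam) +
    (1 + (2 + sumTo (λ i → 2 ^ i * 12 + 1 + 2) lam)))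
  scanTime = D chunkSumCode + (sweepTime + D prefixCode)
  scanWork = p * D chunkSumCode + (sweepWork + p * D prefixCode)
  splitTime = 1 + (D splitterCode + D treeCode)
  splitWork = 1 + (1 * D splitterCode + 1 * D treeCode)
  restTime = splitTime + (D classifyCode + (scanTime + (D redistributeCode + 8)))
  restWork = splitWork + (p * D classifyCode + (scanWork + (p * D redistributeCode + 8)))

  module Scans (c : ℕ → ℕ) (total : ∀ k → sumTo c k ≤ U) where
    0<K : 0 < K
    0<K = ≤-trans (≤-trans (≤-trans (s≤s z≤n) (≤-reflexive (+-comm 1 v))) (m≤m+n (v + 1) (v + 1))) (≤-reflexive (sym K≡))

    instance
      K≢0 : NonZero K
      K≢0 = >-nonZero 0<K

    K≤U : K ≤ U
    K≤U = ≤-trans (m≤m*n K p) (<⇒≤ K*p<U)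

    chunkStart≤U : ∀ {q} → q ≤ p → q * K ≤ U
    chunkStart≤U {q} q≤p = ≤-trans (*-monoˡ-≤ K q≤p) (≤-trans (≤-reflexive (*-comm p K)) (<⇒≤ K*p<U))

    chunk-cell : ∀ {q i} → q < p → i < K → q * K + i < K * p
    chunk-cell {q} {i} q<p i<K = <-≤-trans (+-monoʳ-< (q * K) i<K)
      (≤-trans (≤-reflexive (+-comm (q * K) K)) (≤-trans (*-monoˡ-≤ K q<p) (≤-reflexive (*-comm p K))))

    chunk-in : ∀ q {i} → i < K → InChunk K q (q * K + i)
    chunk-in q {i} i<K = m≤m+n (q * K) i , ≤-trans (+-monoʳ-< (q * K) i<K) (≤-reflexive (+-comm (q * K) K))

    module _ (src dst W rounds W2 tmp sample : ℕ) where
      private regs = λ cnt k → registers src dst W rounds W2 tmp cnt k sample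

      module Summing (cnt k′ : ℕ) (s : State) (c≡ : ∀ k → k < K * p → cells s 7 k ≡ c k) where
        private Kr = regs cnt k′

        Own : ℕ → ℕ → ℕ → Set
        Own q k i = k ≡ 8 × i ≡ Λ + q

        disjoint : ∀ {q q′ k i} → q < p → q′ < p → i < U → Own q k i → Own q′ k i → q ≡ q′
        disjoint _ _ _ (_ , refl) (_ , eq) = +-cancelˡ-≡ Λ _ _ eq

        open AccessIn p Kr Own (cells s)

        module _ {q : ℕ} (q<p : q < p) where

          data Inv (i : ℕ) : List ℕ → Mem → Set where
            -- The sum of a chunk is described additively, which avoids a difference of prefix sums.
            -- The bound `total` on the right-hand side also bounds `acc`.
            inv : ∀ {z acc r₁ r₂ r₃ r₄ r₅ r₆ r₇ r₈ r₉ M} → sumTo c (q * K) + acc ≡ sumTo c (q * K + i) →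
              Inv i (z ∷ (q * K + i) ∷ acc ∷ r₁ ∷ r₂ ∷ r₃ ∷ r₄ ∷ r₅ ∷ r₆ ∷ r₇ ∷ r₈ ∷ r₉ ∷ []) M

          body : ∀ i σ M → i < K → Inv i σ M → ∃[ σ′ ] ∃[ M′ ]
            Exec q chunkSumStep σ M σ′ M′ × Inv (suc i) σ′ M′
          body i _ M i<K (inv {acc = acc} eq) = _ , _ ,
            ( fetch-shared {k = 7} refl (≤ᵇ⇒≤ 7 14 _) refl k<U (λ { _ (() , _) }) (c≡ k (chunk-cell q<p i<K)) ⨾
              ins (op refl refl refl (fits₁ (≤-trans (m≤n+m (acc + c k) (sumTo c (q * K))) (≤-trans (≤-reflexive eq′) (total _))))) ⨾
              ins (op refl refl (trans (+-assoc (q * K) i 1) (cong (q * K +_) (+-comm i 1)))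
                (fits₁ (≤-trans (≤-reflexive (+-suc (q * K) i)) k<U))) )
            , inv (trans eq′ (cong (sumTo c) (sym (+-suc (q * K) i))))
            where
            k = q * K + i
            k<U : k < U
            k<U = <-trans (chunk-cell q<p i<K) K*p<U
            eq′ : sumTo c (q * K) + (acc + c k) ≡ sumTo c (suc k)
            eq′ = trans (sym (+-assoc (sumTo c (q * K)) acc (c k))) (cong (_+ c k) eq)

          Post : Mem → Set
          Post M = sumTo c (q * K) + M 8 (Λ + q) ≡ sumTo c (suc q * K)

          run : ∀ f → ∃[ σ′ ] ∃[ M′ ] Exec q chunkSumCode (file f) (cells s) σ′ M′ × Post M′
          run f with iterate K Inv body {M = cells s}
            (inv {z = f 0} {0} {f 3} {f 4} {f 5} {f 6} {f 7} {f 8} {f 9} {f 10} {f 11}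
              (trans (+-identityʳ _) (cong (sumTo c) (sym (+-identityʳ (q * K))))))
          ... | _ , M′ , iter , inv {acc = acc} eq = _ , _ ,
            ( ins (op refl refl (sym (+-identityʳ (q * K))) (fits₁ (≤-trans (≤-reflexive (+-identityʳ (q * K))) (chunkStart≤U (<⇒≤ q<p))))) ⨾
              ins (op refl refl refl (fits₁ z≤n)) ⨾
              rep refl (fits₁ K≤U) iter ⨾
              ins (op refl refl refl (fits₁ (<⇒≤ (leaf<U q<Λ)))) ⨾
              put-own {k = 8} refl (≤ᵇ⇒≤ 8 14 _) refl (leaf<U q<Λ) (refl , refl) refl )
            , trans (cong (sumTo c (q * K) +_) (updated-same (M′ 8) (Λ + q)))
                (trans eq (cong (sumTo c) (+-comm (q * K) K)))
            where
            q<Λ : q < Λ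
            q<Λ = <-≤-trans q<p p≤Λ

      -- Leaves from `p` on have no owner and keep their contents; this is recorded because
      -- `LeafSums` relies on their being 0.
      run-chunkSums : ∀ cnt k′ s → s ⊨ regs cnt k′ → (∀ k → k < K * p → cells s 7 k ≡ c k) →
        Out (compile rp 0 chunkSumCode) s (duration (regs cnt k′) chunkSumCode) (p * duration (regs cnt k′) chunkSumCode)
        λ s′ → s′ ⊨ regs cnt k′ × (∀ q → q < p → sumTo c (q * K) + cells s′ 8 (Λ + q) ≡ sumTo c (suc q * K)) ×
          (∀ q → p ≤ q → q < Λ → cells s′ 8 (Λ + q) ≡ cells s 8 (Λ + q)) ×
          (∀ k i → i < U → k ≢ 8 → cells s′ k i ≡ cells s k i)
      run-chunkSums cnt k′ s h′ c≡ = weaken ≤-refl ≤-refl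
        (λ s′ (h″ , own , frame) → h″
          , (λ q q<p → trans (cong (sumTo c (q * K) +_) (proj₂ (proj₂ (own q<p)) 8 (Λ + q) (leaf<U (<-≤-trans q<p p≤Λ)) (refl , refl)))
                             (proj₁ (proj₂ (own q<p))))
          , (λ q p≤q q<Λ → frame 8 (Λ + q) (leaf<U q<Λ) λ q′<p (_ , eq) → <⇒≢ (<-≤-trans q′<p p≤q) (+-cancelˡ-≡ Λ _ _ (sym eq)))
          , (λ k i i<U k≢8 → frame k i i<U λ _ → k≢8 ∘ proj₁))
        (run-parallel {Own = Own} (everyone refl refl (≤ᵇ⇒≤ 45 50 _) disjoint) h′ refl
          (λ q M → sumTo c (q * K) + M 8 (Λ + q) ≡ sumTo c (suc q * K)) (λ q q<p f → run q<p f))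
        where
        open Summing cnt k′ s c≡

      module Prefixing (cnt k′ : ℕ) (s : State) (c≡ : ∀ k → k < K * p → cells s 7 k ≡ c k)
        (starts : ∀ q → q < p → cells s 9 (Λ + q) ≡ sumTo c (q * K)) where
        private Kr = regs cnt k′

        Own : ℕ → ℕ → ℕ → Set
        Own q k i = (k ≡ 10 ⊎ k ≡ 11) × InChunk K q i

        disjoint : ∀ {q q′ k i} → q < p → q′ < p → i < U → Own q k i → Own q′ k i → q ≡ q′
        disjoint _ _ _ (_ , o) (_ , o′) = chunk-unique o o′

        open AccessIn p Kr Own (cells s)

        module _ {q : ℕ} (q<p : q < p) where

          data Inv (i : ℕ) : List ℕ → Mem → Set where
            inv : ∀ {z r₁ r₂ r₃ r₄ r₅ r₆ r₇ r₈ r₉ M} →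
              (∀ j → j < i → M 10 (q * K + j) ≡ sumTo c (q * K + j) × M 11 (q * K + j) ≡ sumTo c (q * K + j)) →
              Inv i (z ∷ (q * K + i) ∷ sumTo c (q * K + i) ∷ r₁ ∷ r₂ ∷ r₃ ∷ r₄ ∷ r₅ ∷ r₆ ∷ r₇ ∷ r₈ ∷ r₉ ∷ []) M

          body : ∀ i σ M → i < K → Inv i σ M → ∃[ σ′ ] ∃[ M′ ] Exec q prefixStep σ M σ′ M′ × Inv (suc i) σ′ M′
          body i _ M i<K (inv done) = _ , _ ,
            ( put-own {k = 10} refl (≤ᵇ⇒≤ 10 14 _) refl k<U (inj₁ refl , chunk-in q i<K) refl ⨾
              put-own {k = 11} refl (≤ᵇ⇒≤ 11 14 _) refl k<U (inj₂ refl , chunk-in q i<K) refl ⨾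
              fetch-shared {k = 7} refl (≤ᵇ⇒≤ 7 14 _) refl k<U (λ { _ (inj₁ () , _) ; _ (inj₂ () , _) }) (c≡ k (chunk-cell q<p i<K)) ⨾
              ins (op refl refl (cong (sumTo c) (sym (+-suc (q * K) i))) (fits₁ (total (q * K + suc i)))) ⨾
              ins (op refl refl (trans (+-assoc (q * K) i 1) (cong (q * K +_) (+-comm i 1)))
                (fits₁ (≤-trans (≤-reflexive (+-suc (q * K) i)) k<U))) )
            , inv done′
            where
            k = q * K + i
            k<U : k < U
            k<U = <-trans (chunk-cell q<p i<K) K*p<U
            done′ : ∀ j → j < suc i → (M 10 [ k ↦ sumTo c k ]) (q * K + j) ≡ sumTo c (q * K + j) ×
              (M 11 [ k ↦ sumTo c k ]) (q * K + j) ≡ sumTo c (q * K + j)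
            done′ j j< with j ≟ i
            ... | yes refl = updated-same (M 10) k , updated-same (M 11) k
            ... | no j≢i = trans (updated-other (M 10) k≢) (proj₁ old) , trans (updated-other (M 11) k≢) (proj₂ old)
              where
              old = done j (≤∧≢⇒< (≤-pred j<) j≢i)
              k≢ : k ≢ q * K + j
              k≢ = ≢-sym (j≢i ∘ +-cancelˡ-≡ (q * K) j i)

          run : ∀ f → ∃[ σ′ ] ∃[ M′ ] Exec q prefixCode (file f) (cells s) σ′ M′ ×
            (∀ j → j < K → M′ 10 (q * K + j) ≡ sumTo c (q * K + j) × M′ 11 (q * K + j) ≡ sumTo c (q * K + j))
          run f with iterate K Inv body {M = cells s} (inv {z = 9 * U + (Λ + q)} {f 3} {f 4} {f 5} {f 6} {f 7} {f 8} {f 9} {f 10} {f 11} (λ _ ()))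
          ... | _ , M′ , iter , inv done = _ , _ ,
            ( ins (op refl refl refl (fits₁ (<⇒≤ (leaf<U q<Λ)))) ⨾
              fetch-shared {k = 9} refl (≤ᵇ⇒≤ 9 14 _) refl (leaf<U q<Λ) (λ { _ (inj₁ () , _) ; _ (inj₂ () , _) })
                (trans (starts q q<p) (cong (sumTo c) (sym (+-identityʳ (q * K))))) ⨾
              ins (op refl refl (sym (+-identityʳ (q * K))) (fits₁ (≤-trans (≤-reflexive (+-identityʳ (q * K))) (chunkStart≤U (<⇒≤ q<p))))) ⨾
              rep refl (fits₁ K≤U) iter )
            , done
            where
            q<Λ : q < Λ
            q<Λ = <-≤-trans q<p p≤Λ

      run-prefix : ∀ cnt k′ s → s ⊨ regs cnt k′ → (∀ k → k < K * p → cells s 7 k ≡ c k) →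
        (∀ q → q < p → cells s 9 (Λ + q) ≡ sumTo c (q * K)) →
        Out (compile rp 0 prefixCode) s (duration (regs cnt k′) prefixCode) (p * duration (regs cnt k′) prefixCode)
        λ s′ → s′ ⊨ regs cnt k′ × (∀ k → k < K * p → cells s′ 10 k ≡ sumTo c k × cells s′ 11 k ≡ sumTo c k) ×
          (∀ k i → i < U → k ≢ 10 → k ≢ 11 → cells s′ k i ≡ cells s k i)
      run-prefix cnt k′ s h′ c≡ starts = weaken ≤-refl ≤-refl
        (λ s′ (h″ , own , frame) → h″ , sums s′ own
          , (λ k i i<U ≢10 ≢11 → frame k i i<U λ _ → [ ≢10 , ≢11 ]′ ∘ proj₁))
        (run-parallel {Own = Own} (everyone refl refl (≤ᵇ⇒≤ 45 50 _) disjoint) h′ refl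
          Post (λ q q<p f → run q<p f))
        where
        open Prefixing cnt k′ s c≡ starts
        Post : ℕ → Mem → Set
        Post q M = ∀ j → j < K → M 10 (q * K + j) ≡ sumTo c (q * K + j) × M 11 (q * K + j) ≡ sumTo c (q * K + j)
        sums : ∀ s′ → (∀ {q} → q < p → ∃[ M′ ] Post q M′ × (∀ k i → i < U → Own q k i → cells s′ k i ≡ M′ k i)) →
          ∀ k → k < K * p → cells s′ 10 k ≡ sumTo c k × cells s′ 11 k ≡ sumTo c k
        sums s′ own k k< with own (m<n*o⇒m/o<n {k} {p} {K} (subst (k <_) (*-comm K p) k<))
        ... | M′ , done , agrees = trans (agrees 10 k k<U (inj₁ refl , chunk)) (proj₁ at-k) , trans (agrees 11 k k<U (inj₂ refl , chunk)) (proj₂ at-k)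
          where
          k<U : k < U
          k<U = <-trans k< K*p<U
          chunk : InChunk K (k / K) k
          chunk = m/n*n≤m k K , m<[1+m/n]*n k K
          at-k : M′ 10 k ≡ sumTo c k × M′ 11 k ≡ sumTo c k
          at-k = subst (λ k → M′ 10 k ≡ sumTo c k × M′ 11 k ≡ sumTo c k) (m+[n∸m]≡n (proj₁ chunk))
            (done (k ∸ k / K * K) (+-cancelˡ-< (k / K * K) _ _
              (≤-trans (≤-reflexive (cong suc (m+[n∸m]≡n (proj₁ chunk))))
                (≤-trans (proj₂ chunk) (≤-reflexive (+-comm K (k / K * K)))))))

  -- The processor tree, level by level

  module _ (src dst W rounds W2 tmp sample : ℕ) where
    private regs = λ cnt k → registers src dst W rounds W2 tmp cnt k sample

    -- Rounding p up to Λ at most doubles it, so an inner level, of width at most Λ / 2, never lacks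
    -- processors.
    width≤p : ∀ {l} → l < lam → 2 ^ l ≤ p
    width≤p {l} l<lam = *-cancelˡ-≤ 2 (≤-trans (^-monoʳ-≤ 2 l<lam) (≤-trans (≤-reflexive (sym Λ≡)) Λ≤2p))

    children<U : ∀ {l q} → l < lam → q < 2 ^ l → suc (2 * (2 ^ l + q)) < U
    children<U {l} {q} l<lam q< = ≤-<-trans (≤-trans (≤-trans (≤-trans (n≤1+n _) (≤-reflexive (sym (*-suc 2 (2 ^ l + q)))))
        (*-monoʳ-≤ 2 (+-monoʳ-< (2 ^ l) q<)))
        (≤-trans (≤-reflexive (cong (λ k → 2 * (2 ^ l + k)) (sym (+-identityʳ (2 ^ l)))))
          (*-monoʳ-≤ 2 (≤-trans (^-monoʳ-≤ 2 l<lam) (≤-reflexive (sym Λ≡)))))) 2Λ<U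

    level-setup : ∀ {l K Own} → l < lam → get K 9 ≡ just 0 → get K 10 ≡ just 1 → length K ≤ 50 →
      (∀ {q q′ k i} → q < 2 ^ l → q′ < 2 ^ l → i < U → Own q k i → Own q′ k i → q ≡ q′) → ParallelSetup (2 ^ l) K Own
    level-setup {l} l<lam gz go len dis = record
      { N≤procs = width≤p l<lam ; N≤2^width = <⇒≤ (fits₁ (≤-trans (width≤p l<lam) p≤U)) ; 0<N = m^n>0 2 l
      ; 1<2^width = fits₁ 0<U ; zero-reg = gz ; one-reg = go ; length-K = len ; disjoint = dis }

    module Up (cnt l : ℕ) (l<lam : l < lam) (s : State)
      (bound : ∀ q → q < 2 ^ l → cells s 8 (2 * (2 ^ l + q)) + cells s 8 (suc (2 * (2 ^ l + q))) ≤ U) where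
      private Kr = regs cnt (2 ^ l)

      Own : ℕ → ℕ → ℕ → Set
      Own q k i = k ≡ 8 × i ≡ 2 ^ l + q

      disjoint : ∀ {q q′ k i} → q < 2 ^ l → q′ < 2 ^ l → i < U → Own q k i → Own q′ k i → q ≡ q′
      disjoint _ _ _ (_ , refl) (_ , eq) = +-cancelˡ-≡ (2 ^ l) _ _ eq

      open AccessIn (2 ^ l) Kr Own (cells s)

      -- A step writes the nodes of one level only; children belong to the next level and are
      -- read-only.
      child-shared : ∀ {q i} → 2 * (2 ^ l + q) ≤ i → Shared 8 i
      child-shared {q} {i} ≤i {q′} q′< (_ , eq) = <⇒≱ (subst (_< 2 * 2 ^ l) (sym eq)
        (≤-trans (+-monoʳ-< (2 ^ l) q′<) (≤-reflexive (cong (2 ^ l +_) (sym (+-identityʳ (2 ^ l)))))))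
        (≤-trans (*-monoʳ-≤ 2 (m≤m+n (2 ^ l) q)) ≤i)

      run : ∀ q → q < 2 ^ l → ∀ f → ∃[ σ′ ] ∃[ M′ ] Exec q upCode (file f) (cells s) σ′ M′ ×
        M′ 8 (2 ^ l + q) ≡ cells s 8 (2 * (2 ^ l + q)) + cells s 8 (suc (2 * (2 ^ l + q)))
      run q q< f = _ , _ ,
        ( ins (op refl refl refl (fits₁ (<⇒≤ i<U))) ⨾
          ins (op refl refl (cong (i +_) (sym (+-identityʳ i))) (fits₁ (<⇒≤ 2i<U))) ⨾
          fetch-shared {k = 8} refl (≤ᵇ⇒≤ 8 14 _) refl 2i<U (child-shared ≤-refl) refl ⨾
          ins (op refl refl (+-comm (2 * i) 1) (fits₁ 2i<U)) ⨾
          fetch-shared {k = 8} refl (≤ᵇ⇒≤ 8 14 _) refl (children<U l<lam q<) (child-shared (n≤1+n (2 * i))) refl ⨾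
          ins (op refl refl refl (fits₁ (bound q q<))) ⨾
          put-own {k = 8} refl (≤ᵇ⇒≤ 8 14 _) refl i<U (refl , refl) refl )
        , updated-same (cells s 8) i
        where
        i = 2 ^ l + q
        2i<U : 2 * i < U
        2i<U = <-trans (n<1+n _) (children<U l<lam q<)
        i<U : i < U
        i<U = ≤-<-trans (m≤m+n i (i + 0)) 2i<U

    run-up : ∀ cnt l s → l < lam → s ⊨ regs cnt (2 ^ l) →
      (∀ q → q < 2 ^ l → cells s 8 (2 * (2 ^ l + q)) + cells s 8 (suc (2 * (2 ^ l + q))) ≤ U) →
      Out (compile rk 0 upCode) s (duration (regs cnt (2 ^ l)) upCode) (2 ^ l * duration (regs cnt (2 ^ l)) upCode)
      λ s′ → s′ ⊨ regs cnt (2 ^ l) ×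
        (∀ q → q < 2 ^ l → cells s′ 8 (2 ^ l + q) ≡ cells s 8 (2 * (2 ^ l + q)) + cells s 8 (suc (2 * (2 ^ l + q)))) ×
        (∀ i → 2 * 2 ^ l ≤ i → i < U → cells s′ 8 i ≡ cells s 8 i) ×
        (∀ k i → i < U → k ≢ 8 → cells s′ k i ≡ cells s k i)
    run-up cnt l s l<lam h′ bound = weaken ≤-refl ≤-refl
      (λ s′ (h″ , own , frame) → h″
        , (λ q q< → trans (proj₂ (proj₂ (own q<)) 8 (2 ^ l + q)
             (≤-<-trans (m≤m+n (2 ^ l + q) (2 ^ l + q + 0)) (<-trans (n<1+n _) (children<U l<lam q<))) (refl , refl)) (proj₁ (proj₂ (own q<))))
        , (λ i ≤i i<U → frame 8 i i<U λ q< → child-shared {0} (≤-trans (≤-reflexive (cong (2 *_) (+-identityʳ (2 ^ l)))) ≤i) q<)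
        , (λ k i i<U k≢8 → frame k i i<U λ _ → k≢8 ∘ proj₁))
      (run-parallel {Own = Own} (level-setup l<lam refl refl (≤ᵇ⇒≤ 45 50 _) disjoint) h′ refl
        (λ q M → M 8 (2 ^ l + q) ≡ cells s 8 (2 * (2 ^ l + q)) + cells s 8 (suc (2 * (2 ^ l + q)))) run)
      where
      open Up cnt l l<lam s bound

    module Down (cnt l : ℕ) (l<lam : l < lam) (s : State)
      (bound : ∀ q → q < 2 ^ l → cells s 9 (2 ^ l + q) + cells s 8 (2 * (2 ^ l + q)) ≤ U) where
      private Kr = regs cnt (2 ^ l)

      Own : ℕ → ℕ → ℕ → Set
      Own q k i = k ≡ 9 × InChunk 2 (2 ^ l + q) i

      disjoint : ∀ {q q′ k i} → q < 2 ^ l → q′ < 2 ^ l → i < U → Own q k i → Own q′ k i → q ≡ q′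
      disjoint _ _ _ (_ , o) (_ , o′) = +-cancelˡ-≡ (2 ^ l) _ _ (chunk-unique {2} o o′)

      open AccessIn (2 ^ l) Kr Own (cells s)

      even-child : ∀ i → InChunk 2 i (2 * i)
      even-child i = ≤-reflexive (*-comm i 2) , ≤-trans (n≤1+n _) (≤-reflexive (cong (2 +_) (*-comm 2 i)))

      odd-child : ∀ i → InChunk 2 i (suc (2 * i))
      odd-child i = ≤-trans (≤-reflexive (*-comm i 2)) (n≤1+n _) , ≤-reflexive (cong (2 +_) (*-comm 2 i))

      node-shared : ∀ {q} → q < 2 ^ l → Shared 9 (2 ^ l + q)
      node-shared {q} q< {q′} _ (_ , ≤i , _) = <⇒≱ (≤-trans (+-monoʳ-< (2 ^ l) q<)
        (≤-reflexive (trans (cong (2 ^ l +_) (sym (+-identityʳ (2 ^ l)))) (*-comm 2 (2 ^ l)))))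
        (≤-trans (*-monoˡ-≤ 2 (m≤m+n (2 ^ l) q′)) ≤i)

      run : ∀ q → q < 2 ^ l → ∀ f → ∃[ σ′ ] ∃[ M′ ] Exec q downCode (file f) (cells s) σ′ M′ ×
        M′ 9 (2 * (2 ^ l + q)) ≡ cells s 9 (2 ^ l + q) ×
        M′ 9 (suc (2 * (2 ^ l + q))) ≡ cells s 9 (2 ^ l + q) + cells s 8 (2 * (2 ^ l + q))
      run q q< f = _ , _ ,
        ( ins (op refl refl refl (fits₁ (<⇒≤ i<U))) ⨾
          fetch-shared {k = 9} refl (≤ᵇ⇒≤ 9 14 _) refl i<U (node-shared q<) refl ⨾
          ins (op refl refl (cong (i +_) (sym (+-identityʳ i))) (fits₁ (<⇒≤ 2i<U))) ⨾
          put-own {k = 9} refl (≤ᵇ⇒≤ 9 14 _) refl 2i<U (refl , even-child i) refl ⨾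
          fetch-shared {k = 8} refl (≤ᵇ⇒≤ 8 14 _) refl 2i<U (λ { _ (() , _) }) refl ⨾
          ins (op refl refl refl (fits₁ (bound q q<))) ⨾
          ins (op refl refl (+-comm (2 * i) 1) (fits₁ 2i<U)) ⨾
          put-own {k = 9} refl (≤ᵇ⇒≤ 9 14 _) refl (children<U l<lam q<) (refl , odd-child i) refl )
        , trans (updated-other (cells s 9 [ 2 * i ↦ cells s 9 i ]) (1+n≢n {2 * i})) (updated-same (cells s 9) (2 * i))
        , updated-same (cells s 9 [ 2 * i ↦ cells s 9 i ]) (suc (2 * i))
        where
        i = 2 ^ l + q
        2i<U : 2 * i < U
        2i<U = <-trans (n<1+n _) (children<U l<lam q<)
        i<U : i < U
        i<U = ≤-<-trans (m≤m+n i (i + 0)) 2i<U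

    run-down : ∀ cnt l s → l < lam → s ⊨ regs cnt (2 ^ l) →
      (∀ q → q < 2 ^ l → cells s 9 (2 ^ l + q) + cells s 8 (2 * (2 ^ l + q)) ≤ U) →
      Out (compile rk 0 downCode) s (duration (regs cnt (2 ^ l)) downCode) (2 ^ l * duration (regs cnt (2 ^ l)) downCode)
      λ s′ → s′ ⊨ regs cnt (2 ^ l) ×
        (∀ q → q < 2 ^ l → cells s′ 9 (2 * (2 ^ l + q)) ≡ cells s 9 (2 ^ l + q) ×
           cells s′ 9 (suc (2 * (2 ^ l + q))) ≡ cells s 9 (2 ^ l + q) + cells s 8 (2 * (2 ^ l + q))) ×
        (∀ k i → i < U → k ≢ 9 → cells s′ k i ≡ cells s k i)
    run-down cnt l s l<lam h′ bound = weaken ≤-refl ≤-refl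
      (λ s′ (h″ , own , frame) → h″
        , (λ q q< → trans (proj₂ (proj₂ (own q<)) 9 _ (<-trans (n<1+n _) (children<U l<lam q<)) (refl , even-child (2 ^ l + q))) (proj₁ (proj₁ (proj₂ (own q<))))
                  , trans (proj₂ (proj₂ (own q<)) 9 _ (children<U l<lam q<) (refl , odd-child (2 ^ l + q))) (proj₂ (proj₁ (proj₂ (own q<)))))
        , (λ k i i<U k≢9 → frame k i i<U λ _ → k≢9 ∘ proj₁))
      (run-parallel {Own = Own} (level-setup l<lam refl refl (≤ᵇ⇒≤ 45 50 _) disjoint) h′ refl
        (λ q M → M 9 (2 * (2 ^ l + q)) ≡ cells s 9 (2 ^ l + q) ×
          M 9 (suc (2 * (2 ^ l + q))) ≡ cells s 9 (2 ^ l + q) + cells s 8 (2 * (2 ^ l + q))) run)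
      where
      open Down cnt l l<lam s bound

  -- Up-sweep and down-sweep

  module SweepLoops (Z : ℕ → ℕ) (Z≤U : ∀ r → r ≤ Λ → Z r ≤ U)
    (src dst W rounds W2 tmp sample : ℕ) where

    private regs = λ cnt k → registers src dst W rounds W2 tmp cnt k sample

    lam≤U : lam ≤ U
    lam≤U = ≤-trans (<⇒≤ (n<2^n lam)) (≤-trans (≤-reflexive (sym Λ≡)) (≤-trans (m≤m+n Λ (Λ + 0)) (<⇒≤ 2Λ<U)))

    level-<  : ∀ {i r} → i + suc r ≡ lam → r < lam
    level-< {i} {r} eq = ≤-trans (m≤n+m (suc r) i) (≤-reflexive eq)

    remaining : ∀ {i r} → i + suc r ≡ lam → lam ∸ i ≡ suc r
    remaining {i} {r} eq = trans (cong (_∸ i) (sym eq)) (m+n∸m≡n i (suc r))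

    remaining′ : ∀ {i r} → i + suc r ≡ lam → lam ∸ suc i ≡ r
    remaining′ {i} {r} eq = trans (cong (_∸ suc i) (trans (sym eq) (+-suc i r))) (m+n∸m≡n i r)

    -- Node r of depth l, above the leaves r 2^h, …, (r + 1) 2^h - 1, holds their sum.
    Sums : Mem → (l h r : ℕ) → Set
    Sums M l h r = Z (r * 2 ^ h) + M 8 (2 ^ l + r) ≡ Z (suc r * 2 ^ h)

    within : ∀ {l h r} → l + h ≡ lam → r ≤ 2 ^ l → r * 2 ^ h ≤ Λ
    within {l} {h} eq r≤ = ≤-trans (*-monoˡ-≤ (2 ^ h) r≤)
      (≤-reflexive (trans (sym (^-distribˡ-+-* 2 l h)) (trans (cong (2 ^_) eq) (sym Λ≡))))

    even-start : ∀ q w → 2 * q * w ≡ q * (2 * w)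
    even-start = solve-∀

    odd-end : ∀ q w → suc (suc (2 * q)) * w ≡ suc q * (2 * w)
    odd-end = solve-∀

    left-child : ∀ w q → 2 * (w + q) ≡ 2 * w + 2 * q
    left-child = solve-∀

    right-child′ : ∀ w q → suc (2 * (w + q)) ≡ 2 * w + suc (2 * q)
    right-child′ = solve-∀

    double-sums : ∀ {M l h q} → Sums M (suc l) h (2 * q) → Sums M (suc l) h (suc (2 * q)) →
      Z (q * 2 ^ suc h) + (M 8 (2 * (2 ^ l + q)) + M 8 (suc (2 * (2 ^ l + q)))) ≡ Z (suc q * 2 ^ suc h)
    double-sums {M} {l} {h} {q} left right = begin
      Z (q * 2 ^ suc h) + (M 8 (2 * (2 ^ l + q)) + M 8 (suc (2 * (2 ^ l + q))))
        ≡⟨ cong₂ _+_ (cong Z (sym (even-start q (2 ^ h))))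
             (cong₂ (λ i j → M 8 i + M 8 j) (left-child (2 ^ l) q) (right-child′ (2 ^ l) q)) ⟩
      Z (2 * q * 2 ^ h) + (M 8 (2 ^ suc l + 2 * q) + M 8 (2 ^ suc l + suc (2 * q)))
        ≡⟨ +-assoc (Z (2 * q * 2 ^ h)) _ _ ⟨
      Z (2 * q * 2 ^ h) + M 8 (2 ^ suc l + 2 * q) + M 8 (2 ^ suc l + suc (2 * q))
        ≡⟨ cong (_+ M 8 (2 ^ suc l + suc (2 * q))) left ⟩
      Z (suc (2 * q) * 2 ^ h) + M 8 (2 ^ suc l + suc (2 * q))
        ≡⟨ right ⟩
      Z (suc (suc (2 * q)) * 2 ^ h)
        ≡⟨ cong Z (odd-end q (2 ^ h)) ⟩
      Z (suc q * 2 ^ suc h) ∎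
      where open ≡-Reasoning

    odd-< : ∀ {q w} → q < w → suc (2 * q) < 2 * w
    odd-< {q} q<w = ≤-trans (≤-reflexive (sym (*-suc 2 q))) (*-monoʳ-≤ 2 q<w)

    module UpLoop (M₀ : Mem) where
      Inv : ℕ → Mem → Set
      Inv i M = (∀ l h r → l + h ≡ lam → h ≤ i → r < 2 ^ l → Sums M l h r) ×
              (∀ k j → j < U → k ≢ 8 → M k j ≡ M₀ k j)

      Kf : ℕ → ℕ → List ℕ
      Kf i cnt = regs cnt (2 ^ (lam ∸ i))

      body : ∀ {s} i r → i + suc r ≡ lam → s ⊨ Kf i (suc r) → Inv i (cells s) →
        Out upLevel s 11 (1 + 2 ^ (lam ∸ suc i) * 10) (λ s′ → s′ ⊨ Kf (suc i) (suc r) × Inv (suc i) (cells s′))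
      body {s} i r eq h₀ (sums , same) rewrite remaining {i} {r} eq | remaining′ {i} {r} eq =
        run-block h₀ (op refl refl (quotient-2^ r) (fits₁ (≤-trans (≤-trans (^-monoʳ-≤ 2 (<⇒≤ r<lam)) (≤-reflexive (sym Λ≡)))
          (≤-trans (m≤m+n Λ (Λ + 0)) (<⇒≤ 2Λ<U)))) ∷ [])
        then λ s₁ (h₁ , eq₁) → weaken ≤-refl ≤-refl
          (λ s′ (h′ , new , old , frame) → h′ , sums′ s₁ eq₁ s′ new old , λ k j j<U k≢8 →
             trans (frame k j j<U k≢8) (trans (cong (λ M → M k j) eq₁) (same k j j<U k≢8)))
          (run-up src dst W rounds W2 tmp sample (suc r) r s₁ r<lam h₁
            (λ q q< → subst (λ M → M 8 (2 * (2 ^ r + q)) + M 8 (suc (2 * (2 ^ r + q))) ≤ U) (sym eq₁) (bound q q<)))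
        where
        r<lam : r < lam
        r<lam = level-< {i} eq
        height : suc r + i ≡ lam
        height = trans (+-comm (suc r) i) eq
        height′ : r + suc i ≡ lam
        height′ = trans (+-suc r i) height
        parent : ∀ q → q < 2 ^ r → Z (q * 2 ^ suc i) + (cells s 8 (2 * (2 ^ r + q)) + cells s 8 (suc (2 * (2 ^ r + q))))
          ≡ Z (suc q * 2 ^ suc i)
        parent q q< = double-sums {cells s} {r} {i} {q}
          (sums (suc r) i (2 * q) height ≤-refl (*-monoʳ-< 2 q<))
          (sums (suc r) i (suc (2 * q)) height ≤-refl (odd-< q<))
        bound : ∀ q → q < 2 ^ r → cells s 8 (2 * (2 ^ r + q)) + cells s 8 (suc (2 * (2 ^ r + q))) ≤ U
        bound q q< = ≤-trans (m≤n+m _ (Z (q * 2 ^ suc i))) (≤-trans (≤-reflexive (parent q q<))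
          (Z≤U _ (within {r} {suc i} height′ q<)))
        sums′ : ∀ s₁ → cells s₁ ≡ cells s → ∀ s′ →
          (∀ q → q < 2 ^ r → cells s′ 8 (2 ^ r + q) ≡ cells s₁ 8 (2 * (2 ^ r + q)) + cells s₁ 8 (suc (2 * (2 ^ r + q)))) →
          (∀ j → 2 * 2 ^ r ≤ j → j < U → cells s′ 8 j ≡ cells s₁ 8 j) →
          ∀ l h q → l + h ≡ lam → h ≤ suc i → q < 2 ^ l → Sums (cells s′) l h q
        -- Nodes of height `suc i` are exactly the level just written; lower nodes lie in later
        -- cells, which that step leaves alone.
        sums′ s₁ eq₁ s′ new old l h q eq′ h≤ q< with h ≟ suc i
        ... | yes refl with +-cancelʳ-≡ (suc i) l r (trans eq′ (sym height′))
        ... | refl = trans (cong (Z (q * 2 ^ suc i) +_) (trans (new q q<)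
              (cong (λ M → M 8 (2 * (2 ^ r + q)) + M 8 (suc (2 * (2 ^ r + q)))) eq₁))) (parent q q<)
        sums′ s₁ eq₁ s′ new old l h q eq′ h≤ q< | no h≢ =
          trans (cong (Z (q * 2 ^ h) +_) (trans (old (2 ^ l + q) low high) (cong (λ M → M 8 (2 ^ l + q)) eq₁)))
                (sums l h q eq′ h≤i q<)
          where
          h≤i : h ≤ i
          h≤i = ≤-pred (≤∧≢⇒< h≤ h≢)
          r<l : suc r ≤ l
          r<l = +-cancelʳ-≤ i (suc r) l (≤-trans (≤-reflexive (trans height (sym eq′))) (+-monoʳ-≤ l h≤i))
          low : 2 * 2 ^ r ≤ 2 ^ l + q
          low = ≤-trans (^-monoʳ-≤ 2 r<l) (m≤m+n (2 ^ l) q)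
          high : 2 ^ l + q < U
          high = <-trans (+-monoʳ-< (2 ^ l) q<) (≤-<-trans (≤-trans (≤-reflexive (cong (2 ^ l +_) (sym (+-identityʳ (2 ^ l)))))
            (*-monoʳ-≤ 2 (≤-trans (^-monoʳ-≤ 2 (≤-trans (m≤m+n l h) (≤-reflexive eq′))) (≤-reflexive (sym Λ≡))))) 2Λ<U)

    run-upSweep : ∀ {cnt} s → s ⊨ regs cnt Λ → (∀ r → r < Λ → Z r + cells s 8 (Λ + r) ≡ Z (suc r)) →
      Out (for rλ rcnt upLevel) s (2 + sumTo (λ _ → 11 + 2) lam) (2 + sumTo (λ i → 1 + 2 ^ (lam ∸ suc i) * 10 + 2) lam)
      λ s′ → s′ ⊨ regs 0 1 × (∀ l h r → l + h ≡ lam → r < 2 ^ l → Sums (cells s′) l h r) ×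
        (∀ k j → j < U → k ≢ 8 → cells s′ k j ≡ cells s k j)
    run-upSweep {cnt} s h₀ leaves = weaken ≤-refl ≤-refl
      (λ s′ (h′ , sums , same) → subst (λ k → s′ ⊨ regs 0 (2 ^ k)) (n∸n≡0 lam) h′
        , (λ l h r eq r< → sums l h r eq (≤-trans (m≤n+m h l) (≤-reflexive eq)) r<) , same)
      (run-for Kf Inv (λ _ → 11) (λ i → 1 + 2 ^ (lam ∸ suc i) * 10) refl refl refl refl (λ {s} → body {s})
        h₀ refl refl (cong (regs lam) Λ≡) (fits₁ lam≤U)
        ((λ { l zero r eq _ r< → base′ l r (trans (sym (+-identityʳ l)) eq) r< }) , λ _ _ _ _ → refl))
      where
      open UpLoop (cells s)
      base′ : ∀ l r → l ≡ lam → r < 2 ^ l → Sums (cells s) l 0 r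
      base′ l r refl r< = begin
        Z (r * 1) + cells s 8 (2 ^ lam + r) ≡⟨ cong₂ (λ i j → Z i + cells s 8 (j + r)) (*-identityʳ r) (sym Λ≡) ⟩
        Z r + cells s 8 (Λ + r)             ≡⟨ leaves r (≤-trans r< (≤-reflexive (sym Λ≡))) ⟩
        Z (suc r)                           ≡⟨ cong Z (sym (*-identityʳ (suc r))) ⟩
        Z (suc r * 1)                       ∎
        where open ≡-Reasoning

    module DownLoop (M₀ : Mem) (sums : ∀ l h r → l + h ≡ lam → r < 2 ^ l → Sums M₀ l h r) where
      Inv : ℕ → Mem → Set
      Inv i M = (∀ r → r < 2 ^ i → M 9 (2 ^ i + r) ≡ Z (r * 2 ^ (lam ∸ i))) ×
              (∀ k j → j < U → k ≢ 9 → M k j ≡ M₀ k j)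

      Kf : ℕ → ℕ → List ℕ
      Kf i cnt = regs cnt (2 ^ i)

      body : ∀ {s} i r → i + suc r ≡ lam → s ⊨ Kf i (suc r) → Inv i (cells s) →
        Out downLevel s 13 (2 ^ i * 12 + 1) (λ s′ → s′ ⊨ Kf (suc i) (suc r) × Inv (suc i) (cells s′))
      body {s} i r eq h₀ (starts , same) rewrite remaining {i} {r} eq | remaining′ {i} {r} eq =
        run-down src dst W rounds W2 tmp sample (suc r) i s i<lam h₀ bound
        then λ s₁ (h₁ , new , frame) → weaken ≤-refl ≤-refl
          (λ s′ (h′ , eq′) → h′ ,
             ( (λ q q< → trans (cong (λ M → M 9 (2 ^ suc i + q)) eq′) (starts′ s₁ new q q<))
             , (λ k j j<U k≢9 → trans (cong (λ M → M k j) eq′) (trans (frame k j j<U k≢9) (same k j j<U k≢9)))))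
          (run-block h₁ (op refl refl (cong (2 ^ i +_) (sym (+-identityʳ (2 ^ i))))
            (fits₁ (≤-trans (≤-trans (^-monoʳ-≤ 2 i<lam) (≤-reflexive (sym Λ≡))) (≤-trans (m≤m+n Λ (Λ + 0)) (<⇒≤ 2Λ<U)))) ∷ []))
        where
        i<lam : i < lam
        i<lam = ≤-trans (≤-trans (m≤m+n (suc i) r) (≤-reflexive (sym (+-suc i r)))) (≤-reflexive eq)
        height : suc i + r ≡ lam
        height = trans (sym (+-suc i r)) eq
        child : ∀ q → q < 2 ^ i → cells s 9 (2 ^ i + q) + cells s 8 (2 * (2 ^ i + q)) ≡ Z (suc (2 * q) * 2 ^ r)
        child q q< = trans (cong₂ _+_ (trans (starts q q<) (cong Z (sym (even-start q (2 ^ r)))))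
            (trans (same 8 (2 * (2 ^ i + q)) (<-trans (n<1+n _) (children<U src dst W rounds W2 tmp sample i<lam q<)) λ ())
                   (cong (M₀ 8) (left-child (2 ^ i) q))))
          (sums (suc i) r (2 * q) height (*-monoʳ-< 2 q<))
        bound : ∀ q → q < 2 ^ i → cells s 9 (2 ^ i + q) + cells s 8 (2 * (2 ^ i + q)) ≤ U
        bound q q< = ≤-trans (≤-reflexive (child q q<)) (Z≤U _ (within {suc i} {r} height (<⇒≤ (odd-< q<))))
        starts′ : ∀ s₁ → (∀ q → q < 2 ^ i → cells s₁ 9 (2 * (2 ^ i + q)) ≡ cells s 9 (2 ^ i + q) ×
             cells s₁ 9 (suc (2 * (2 ^ i + q))) ≡ cells s 9 (2 ^ i + q) + cells s 8 (2 * (2 ^ i + q))) →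
          ∀ q → q < 2 ^ suc i → cells s₁ 9 (2 ^ suc i + q) ≡ Z (q * 2 ^ r)
        -- An even child starts where its parent starts; an odd one starts where its sibling ends,
        -- hence the addition of the sibling's sum.
        starts′ s₁ new q q< with halve q
        ... | k , inj₁ refl = trans (cong (cells s₁ 9) (sym (left-child (2 ^ i) k)))
          (trans (proj₁ (new k k<)) (trans (starts k k<) (cong Z (sym (even-start k (2 ^ r))))))
          where
          k< : k < 2 ^ i
          k< = *-cancelˡ-< 2 k (2 ^ i) q<
        ... | k , inj₂ refl = trans (cong (cells s₁ 9) (sym (right-child′ (2 ^ i) k))) (trans (proj₂ (new k k<)) (child k k<))
          where
          k< : k < 2 ^ i
          k< = *-cancelˡ-< 2 k (2 ^ i) (<-trans (n<1+n _) q<)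

    run-downSweep : ∀ {cnt} s → s ⊨ regs cnt 1 → (∀ l h r → l + h ≡ lam → r < 2 ^ l → Sums (cells s) l h r) →
      cells s 9 1 ≡ Z 0 →
      Out (for rλ rcnt downLevel) s (2 + sumTo (λ _ → 13 + 2) lam) (2 + sumTo (λ i → 2 ^ i * 12 + 1 + 2) lam)
      λ s′ → s′ ⊨ regs 0 Λ × (∀ r → r < Λ → cells s′ 9 (Λ + r) ≡ Z r) × (∀ k j → j < U → k ≢ 9 → cells s′ k j ≡ cells s k j)
    run-downSweep {cnt} s h₀ sums root = weaken ≤-refl ≤-refl
      (λ s′ (h′ , starts , same) → subst (λ k → s′ ⊨ regs 0 k) (sym Λ≡) h′
        , (λ r r< → trans (cong (λ k → cells s′ 9 (k + r)) Λ≡) (trans (starts r (≤-trans r< (≤-reflexive Λ≡)))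
            (cong Z (trans (cong (λ k → r * 2 ^ k) (n∸n≡0 lam)) (*-identityʳ r))))) , same)
      (run-for Kf Inv (λ _ → 13) (λ i → 2 ^ i * 12 + 1) refl refl refl refl (λ {s} → body {s})
        h₀ refl refl refl (fits₁ lam≤U)
        ((λ { zero _ → root ; (suc r) (s≤s ()) }) , λ _ _ _ _ → refl))
      where open DownLoop (cells s) sums

    run-sweeps : ∀ s → s ⊨ regs 0 0 → (∀ r → r < Λ → Z r + cells s 8 (Λ + r) ≡ Z (suc r)) → cells s 9 1 ≡ Z 0 →
      Out sweepPhase s sweepTime sweepWork λ s′ → s′ ⊨ regs 0 Λ × (∀ r → r < Λ → cells s′ 9 (Λ + r) ≡ Z r) ×
        (∀ k j → j < U → k ≢ 8 → k ≢ 9 → cells s′ k j ≡ cells s k j)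
    run-sweeps s h₀ leaves root =
      run-block h₀ (op refl refl (+-identityʳ Λ) (fits₁ Λ≤U) ∷ [])
      then λ s₁ (h₁ , eq₁) →
      run-upSweep s₁ h₁ (λ r r< → subst (λ M → Z r + M 8 (Λ + r) ≡ Z (suc r)) (sym eq₁) (leaves r r<))
      then λ s₂ (h₂ , sums₂ , frame₂) →
      run-block h₂ (op refl refl refl (fits₁ 0<U) ∷ [])
      then λ s₃ (h₃ , eq₃) → weaken ≤-refl ≤-refl
        (λ s′ (h′ , starts′ , frame′) → h′ , starts′ , λ k j j<U k≢8 k≢9 →
          trans (frame′ k j j<U k≢9) (trans (cong (λ M → M k j) eq₃)
            (trans (frame₂ k j j<U k≢8) (cong (λ M → M k j) eq₁))))
        (run-downSweep s₃ h₃ (λ l h r eq r< → subst (λ M → Sums M l h r) (sym eq₃) (sums₂ l h r eq r<))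
          (trans (cong (λ M → M 9 1) eq₃) (trans (frame₂ 9 1 1<U λ ()) (trans (cong (λ M → M 9 1) eq₁) root))))

  -- Since n ≤ U, the input lies within array 0. The zeros beyond it provide the empty counters, the
  -- padding in front of the sample, the padded leaves, and the prefix sum 0 at the root of the
  -- down-sweep.
  initial-zero : ∀ k i → 1 ≤ k → i < U → cells initial k i ≡ 0
  initial-zero (suc k) i _ _ rewrite dec-false (suc k * U + i <? n)
    (≤⇒≯ (≤-trans n≤U (≤-trans (m≤m+n U (k * U)) (m≤m+n (suc k * U) i)))) = refl

  -- Composition of the phases

  finalRegisters : ℕ → (dst W rounds W2 tmp k : ℕ) → List ℕ
  finalRegisters σ dst W rounds W2 tmp k =
    (σ * U + off) ∷ (3 * U) ∷ (4 * U) ∷ (5 * U) ∷ (6 * U) ∷ (7 * U) ∷ (10 * U) ∷ (12 * U) ∷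
    drop 8 (registers (σ * U) dst W rounds W2 tmp 0 k (σ * U + off))

  -- `home` is the sort buffer that holds the sample in the end, 1 or 2 according to the parity of
  -- the number of levels.
  record SplitDone (home : ℕ) (M : Mem) : Set where
    field
      sample-sorted : Sorted (read (M home) off a)
      sample-drawn  : read (M home) off a ↭ read (sampled I) 0 a
      splitters : ∀ j → j < v → M 3 j ≡ M home (off + splitterIndex j)
      tree : ∀ l m r → l + suc m ≡ d → r < 2 ^ l → M 4 (2 ^ l + r) ≡ M 3 ((2 * r + 1) * 2 ^ m ∸ 1)
      lcps : ∀ j → suc j < v → M 5 (suc j) ≡ lcp (unpack b w (M 3 j)) (unpack b w (M 3 (suc j)))

  -- The classes are defined from `x` and `t`, the arrays at the time of classification. `x≡` and
  -- `t≡` cover whole arrays rather than the splitters alone, since the search also reads the cell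
  -- behind the last splitter.
  record Contents (home : ℕ) (M : Mem) : Set where
    field
      split : SplitDone home M
      x t : ℕ → ℕ
      x≡ : ∀ i → i < U → M 3 i ≡ x i
      t≡ : ∀ i → i < U → M 4 i ≡ t i
      classified : ∀ j → j < L * p → M 6 j ≡ Classes.bucketOf x t j
      counted : ∀ k → k < K * p → M 7 k ≡ Classes.rank x t k (L * p)
      prefixes : ∀ k → k < K * p → M 10 k ≡ Classes.start x t (L * p) k
      placed : ∀ j → j < L * p → M 12 (Classes.position x t j) ≡ j

  record Final (s : State) : Set where
    field
      home dst W rounds W2 tmp k : ℕ
      regs : s ⊨ finalRegisters home dst W rounds W2 tmp k
      contents : Contents home (cells s)

  open SortLoop using (levels; mergeTime)

  totalTime : ℕ
  totalTime = 6 + ((2 + sumTo (λ _ → 1 + 2) (d + α)) + ((2 + sumTo (λ _ → 1 + 2) lam) + (14 + (12 + (4 + (D drawCode +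
    ((2 + sumTo (λ i → 4 + (mergeTime i + 4) + 2) levels) + restTime)))))))

  totalWork : ℕ
  totalWork = 6 + ((2 + sumTo (λ _ → 1 + 2) (d + α)) + ((2 + sumTo (λ _ → 1 + 2) lam) + (14 + (12 + (4 + (1 * D drawCode +
    ((2 + sumTo (λ i → 4 + (p * mergeTime i + 4) + 2) levels) + restWork)))))))

  -- Connects prefix sums over leaves with prefix sums over counters: leaf `q` advances the latter
  -- from `q * K` to `suc q * K`, and the padding adds nothing.
  module LeafSums (c z : ℕ → ℕ) (filled : ∀ q → q < p → sumTo c (q * K) + z q ≡ sumTo c (suc q * K))
    (padded : ∀ q → p ≤ q → q < Λ → z q ≡ 0) where

    chunks : ∀ r → r ≤ p → sumTo z r ≡ sumTo c (r * K)
    chunks zero    _   = refl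
    chunks (suc r) r<p = trans (cong (_+ z r) (chunks r (<⇒≤ r<p))) (filled r r<p)

    padding : ∀ e → p + e ≤ Λ → sumTo z (p + e) ≡ sumTo c (p * K)
    padding zero    _ rewrite +-identityʳ p = chunks p ≤-refl
    padding (suc e) ≤Λ rewrite +-suc p e = trans (cong₂ _+_ (padding e (<⇒≤ ≤Λ)) (padded (p + e) (m≤m+n p e) ≤Λ)) (+-identityʳ _)

    bounded : (∀ k → sumTo c k ≤ U) → ∀ r → r ≤ Λ → sumTo z r ≤ U
    bounded total r r≤Λ with ≤-total r p
    ... | inj₁ r≤p = ≤-trans (≤-reflexive (chunks r r≤p)) (total (r * K))
    ... | inj₂ p≤r = ≤-trans (≤-reflexive (trans (cong (sumTo z) (sym (m+[n∸m]≡n p≤r)))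
      (padding (r ∸ p) (≤-trans (≤-reflexive (m+[n∸m]≡n p≤r)) r≤Λ)))) (total (p * K))

  leafAt : State → ℕ → ℕ
  leafAt s r = cells s 8 (Λ + r)

  run-scan : ∀ c → (∀ k → sumTo c k ≤ U) → ∀ src dst W rounds W2 tmp sample s →
    s ⊨ registers src dst W rounds W2 tmp 0 0 sample → (∀ k → k < K * p → cells s 7 k ≡ c k) →
    (∀ k i → 8 ≤ k → i < U → cells s k i ≡ 0) →
    Out scanPhase s scanTime scanWork λ s′ → s′ ⊨ registers src dst W rounds W2 tmp 0 Λ sample ×
      (∀ k → k < K * p → cells s′ 10 k ≡ sumTo c k × cells s′ 11 k ≡ sumTo c k) ×
      (∀ k i → i < U → k < 8 → cells s′ k i ≡ cells s k i)
  run-scan c total src dst W rounds W2 tmp sample s h₀ c≡ zero₀ =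
    Scans.run-chunkSums c total src dst W rounds W2 tmp sample 0 0 s h₀ c≡
    then λ s₁ (h₁ , sums₁ , pad₁ , frame₁) →
    SweepLoops.run-sweeps (sumTo (leafAt s₁))
      (LeafSums.bounded c (leafAt s₁) sums₁ (padded s₁ pad₁) total)
      src dst W rounds W2 tmp sample s₁ h₁ (λ _ _ → refl)
      (trans (frame₁ 9 1 1<U λ ()) (zero₀ 9 1 (≤ᵇ⇒≤ 8 9 _) 1<U))
    then λ s₂ (h₂ , starts₂ , frame₂) → weaken ≤-refl ≤-refl
      (λ s′ (h′ , pre′ , frame′) → h′ , pre′ , λ k i i<U k<8 →
        trans (frame′ k i i<U (apart 10 k<8) (apart 11 k<8))
          (trans (frame₂ k i i<U (apart 8 k<8) (apart 9 k<8)) (frame₁ k i i<U (apart 8 k<8))))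
      (Scans.run-prefix c total src dst W rounds W2 tmp sample 0 Λ s₂ h₂
        (λ k k< → trans (frame₂ 7 k (<-trans k< K*p<U) (λ ()) (λ ()))
          (trans (frame₁ 7 k (<-trans k< K*p<U) λ ()) (c≡ k k<)))
        (λ q q<p → trans (starts₂ q (<-≤-trans q<p p≤Λ))
          (LeafSums.chunks c (leafAt s₁) sums₁ (padded s₁ pad₁) q (<⇒≤ q<p))))
    where
    padded : ∀ s₁ → (∀ q → p ≤ q → q < Λ → cells s₁ 8 (Λ + q) ≡ cells s 8 (Λ + q)) →
      ∀ q → p ≤ q → q < Λ → leafAt s₁ q ≡ 0
    padded s₁ pad₁ q p≤q q<Λ = trans (pad₁ q p≤q q<Λ) (zero₀ 8 (Λ + q) ≤-refl (leaf<U q<Λ))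

  home<6 : ∀ {home} → home ≤ 2 → home < 6
  home<6 home≤2 = ≤-<-trans home≤2 (≤ᵇ⇒≤ 3 6 _)

  sample-cell<U : ∀ {i} → i < a → off + i < U
  sample-cell<U i<a = <-trans (<-≤-trans (+-monoʳ-< off i<a) (≤-reflexive off+a)) A<U

  depth< : ∀ l m → l + suc m ≡ d → suc l + m ≡ d
  depth< l m eq = trans (sym (+-suc l m)) eq

  node<U : ∀ l m r → l + suc m ≡ d → r < 2 ^ l → 2 ^ l + r < U
  node<U l m r eq r< = <-≤-trans (+-monoʳ-< (2 ^ l) r<) (≤-trans
    (≤-reflexive (cong (2 ^ l +_) (sym (+-identityʳ (2 ^ l)))))
    (≤-trans (^-monoʳ-≤ 2 (subst (suc l ≤_) (depth< l m eq) (m≤m+n (suc l) m)))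
      (≤-trans (≤-reflexive 2^d≡) v<U)))

  index<U : ∀ l m r → l + suc m ≡ d → r < 2 ^ l → (2 * r + 1) * 2 ^ m ∸ 1 < U
  index<U l m r eq r< = ≤-<-trans (∸-monoˡ-≤ 1 (≤-trans (*-monoˡ-≤ (2 ^ m)
      (≤-trans (≤-reflexive (+-comm (2 * r) 1)) (*-monoʳ-< 2 r<)))
      (≤-trans (≤-reflexive (trans (sym (^-distribˡ-+-* 2 (suc l) m)) (cong (2 ^_) (depth< l m eq)))) (≤-reflexive 2^d≡))))
    v<U

  split-transfer : ∀ {home M M′} → home ≤ 2 → (∀ k i → i < U → k < 6 → M′ k i ≡ M k i) →
    SplitDone home M → SplitDone home M′
  split-transfer {home} {M} {M′} home≤2 same done = record
    { sample-sorted = subst Sorted read≡ sample-sorted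
    ; sample-drawn = subst (_↭ read (sampled I) 0 a) read≡ sample-drawn
    ; splitters = λ j j<v → trans (at-3 j (<-trans j<v v<U)) (trans (splitters j j<v)
        (sym (same home _ (sample-cell<U (splitterIndex-< j<v)) (home<6 home≤2))))
    ; tree = λ l m r eq r< → trans (same 4 _ (node<U l m r eq r<) (≤ᵇ⇒≤ 5 6 _))
        (trans (tree l m r eq r<) (sym (at-3 _ (index<U l m r eq r<))))
    ; lcps = λ j j<v → trans (same 5 (suc j) (<-trans j<v v<U) ≤-refl) (trans (lcps j j<v)
        (cong₂ (λ y y′ → lcp (unpack b w y) (unpack b w y′))
          (sym (at-3 j (<-trans (n<1+n j) (<-trans j<v v<U)))) (sym (at-3 (suc j) (<-trans j<v v<U)))))
    }
    where
    open SplitDone done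
    at-3 : ∀ i → i < U → M′ 3 i ≡ M 3 i
    at-3 i i<U = same 3 i i<U (≤ᵇ⇒≤ 4 6 _)
    read≡ : read (M home) off a ≡ read (M′ home) off a
    read≡ = read-cong off a λ i _ i< → sym (same home i
      (<-trans (<-≤-trans i< (≤-reflexive off+a)) A<U) (home<6 home≤2))

  run-split : ∀ home dst W rounds W2 tmp s → home ≤ 2 →
    s ⊨ registers (home * U) dst W rounds W2 tmp 0 0 0 →
    Sorted (read (cells s home) off a) → read (cells s home) off a ↭ read (sampled I) 0 a →
    Out splitPhase s splitTime splitWork λ s′ →
      s′ ⊨ registers (home * U) dst W rounds W2 tmp 0 0 (home * U + off) × SplitDone home (cells s′) ×
      (∀ k i → i < U → k ≢ 3 → k ≢ 4 → k ≢ 5 → cells s′ k i ≡ cells s k i)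
  run-split home dst W rounds W2 tmp s home≤2 h₀ sorted drawn =
    run-block h₀ (op refl refl refl (fits-cell home≤14 (≤-<-trans off≤A A<U)) ∷ [])
    then λ s₁ (h₁ , eq₁) →
    run-splitters home dst W rounds W2 tmp 0 0 (home * U + off) s₁ smp home≤14
      (apart 3 (s≤s home≤2)) (apart 5 (s≤s home≤2)) h₁ (λ j _ → cong (λ M → M home (off + j)) eq₁) smp<
    then λ s₂ (h₂ , spl₂ , lcp₂ , frame₂) → weaken ≤-refl ≤-refl
      (λ s′ (h′ , tree′ , frame′) → h′
        , split-done s₁ eq₁ s₂ spl₂ lcp₂ frame₂ s′ tree′ frame′
        , λ k i i<U k≢3 k≢4 k≢5 → trans (frame′ k i i<U k≢4)
            (trans (frame₂ k i i<U [ k≢3 , k≢5 ]′) (cong (λ M → M k i) eq₁)))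
      (run-tree home dst W rounds W2 tmp 0 0 (home * U + off) s₂ h₂)
    where
    home≤14 : home ≤ 14
    home≤14 = ≤-trans home≤2 (≤ᵇ⇒≤ 2 14 _)
    smp : ℕ → ℕ
    smp j = cells s home (off + j)
    -- The bound holds for the drawn words and is carried along the permutation to the sorted ones.
    smp< : ∀ j → j < a → smp j < 2 ^ (w * b)
    smp< = All-read {_< 2 ^ (w * b)} off a (All-resp-↭ (↭-sym drawn)
      (read-All {_< 2 ^ (w * b)} 0 a λ j _ → charWord-< I (Env.random env j) h))
    split-done : ∀ s₁ → cells s₁ ≡ cells s → ∀ s₂ →
      (∀ j → j < v → cells s₂ 3 j ≡ smp (splitterIndex j)) →
      (∀ j → suc j < v → cells s₂ 5 (suc j) ≡
        lcp (unpack b w (smp (splitterIndex j))) (unpack b w (smp (splitterIndex (suc j))))) →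
      (∀ k i → i < U → ¬ (k ≡ 3 ⊎ k ≡ 5) → cells s₂ k i ≡ cells s₁ k i) → ∀ s′ →
      (∀ l m r → l + suc m ≡ d → r < 2 ^ l → cells s′ 4 (2 ^ l + r) ≡ cells s₂ 3 ((2 * r + 1) * 2 ^ m ∸ 1)) →
      (∀ k i → i < U → k ≢ 4 → cells s′ k i ≡ cells s₂ k i) → SplitDone home (cells s′)
    split-done s₁ eq₁ s₂ spl₂ lcp₂ frame₂ s′ tree′ frame′ = record
      { sample-sorted = subst Sorted read≡ sorted
      ; sample-drawn = subst (_↭ read (sampled I) 0 a) read≡ drawn
      ; splitters = λ j j<v → trans (spl j j<v) (sym (home≡ _ (sample-cell<U (splitterIndex-< j<v))))
      ; tree = λ l m r eq r< → trans (tree′ l m r eq r<) (sym (frame′ 3 _ (index<U l m r eq r<) λ ()))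
      ; lcps = λ j j<v → trans (frame′ 5 (suc j) (<-trans j<v v<U) λ ()) (trans (lcp₂ j j<v)
          (cong₂ (λ y y′ → lcp (unpack b w y) (unpack b w y′))
            (sym (spl j (<-trans (n<1+n j) j<v))) (sym (spl (suc j) j<v))))
      }
      where
      home≡ : ∀ i → i < U → cells s′ home i ≡ cells s home i
      home≡ i i<U = trans (frame′ home i i<U (apart 4 (s≤s home≤2)))
        (trans (frame₂ home i i<U [ apart 3 (s≤s home≤2) , apart 5 (s≤s home≤2) ]′) (cong (λ M → M home i) eq₁))
      read≡ : read (cells s home) off a ≡ read (cells s′ home) off a
      read≡ = read-cong off a λ i _ i< → sym (home≡ i (<-trans (<-≤-trans i< (≤-reflexive off+a)) A<U))
      spl : ∀ j → j < v → cells s′ 3 j ≡ smp (splitterIndex j)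
      spl j j<v = trans (frame′ 3 j (<-trans j<v v<U) λ ()) (spl₂ j j<v)

  run-rest : ∀ home dst W rounds W2 tmp s → home ≤ 2 →
    s ⊨ registers (home * U) dst W rounds W2 tmp 0 0 0 →
    Sorted (read (cells s home) off a) → read (cells s home) off a ↭ read (sampled I) 0 a →
    (∀ k i → 3 ≤ k → i < U → cells s k i ≡ 0) →
    Out (splitPhase ⨟ compile rp 0 classifyCode ⨟ scanPhase ⨟ compile rp 0 redistributeCode ⨟ block results) s
      restTime restWork Final
  run-rest home dst W rounds W2 tmp s home≤2 h₀ sorted drawn zero₀ =
    run-split home dst W rounds W2 tmp s home≤2 h₀ sorted drawn
    then λ s₁ (h₁ , split₁ , frame₁) →
    ClassRuns.run-classify (cells s₁ 3) (cells s₁ 4) (home * U) dst W rounds W2 tmp 0 0 (home * U + off) s₁ h₁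
      (λ _ _ → refl) (λ _ _ → refl)
      (λ i i<U → trans (frame₁ 7 i i<U (λ ()) (λ ()) (λ ())) (zero₀ 7 i (≤ᵇ⇒≤ 3 7 _) i<U))
    then λ s₂ (h₂ , orc₂ , cnt₂ , frame₂) →
    run-scan (λ k → Classes.rank (cells s₁ 3) (cells s₁ 4) k (L * p)) (Classes.ranks≤U (cells s₁ 3) (cells s₁ 4))
      (home * U) dst W rounds W2 tmp (home * U + off) s₂ h₂ cnt₂
      (λ k i 8≤k i<U → trans (frame₂ k i i<U (above 6 8≤k) (above 7 8≤k))
        (trans (frame₁ k i i<U (above 3 8≤k) (above 4 8≤k) (above 5 8≤k)) (zero₀ k i (≤-trans (≤ᵇ⇒≤ 3 8 _) 8≤k) i<U)))
    then λ s₃ (h₃ , pre₃ , frame₃) →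
    ClassRuns.run-redistribute (cells s₁ 3) (cells s₁ 4) (home * U) dst W rounds W2 tmp 0 Λ (home * U + off) s₃ h₃
      (λ j j< → trans (frame₃ 6 j (<-trans j< L*p<U) (≤ᵇ⇒≤ 7 8 _)) (orc₂ j j<))
      (λ k k< → proj₂ (pre₃ k k<))
    then λ s₄ (h₄ , placed₄ , frame₄) → weaken ≤-refl ≤-refl
      (λ s′ (h′ , eq′) → record
        { home = home ; dst = dst ; W = W ; rounds = rounds ; W2 = W2 ; tmp = tmp ; k = Λ ; regs = h′
        ; contents = subst (Contents home) (sym eq′) (contents (cells s₁) (cells s₄) split₁
            (λ k i i<U k<6 → trans (frame₄ k i i<U (apart 11 k<6) (apart 12 k<6))
              (trans (frame₃ k i i<U (<-trans k<6 (≤ᵇ⇒≤ 7 8 _))) (frame₂ k i i<U (apart 6 k<6) (apart 7 k<6))))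
            (λ j j< → trans (frame₄ 6 j (<-trans j< L*p<U) (λ ()) (λ ()))
              (trans (frame₃ 6 j (<-trans j< L*p<U) (≤ᵇ⇒≤ 7 8 _)) (orc₂ j j<)))
            (λ k k< → trans (frame₄ 7 k (<-trans k< K*p<U) (λ ()) (λ ()))
              (trans (frame₃ 7 k (<-trans k< K*p<U) ≤-refl) (cnt₂ k k<)))
            (λ k k< → trans (frame₄ 10 k (<-trans k< K*p<U) (λ ()) (λ ())) (proj₁ (pre₃ k k<)))
            placed₄)
        })
      (run-block h₄
        ( op refl refl (+-identityʳ (home * U + off)) (fits-cell (≤-trans home≤2 (≤ᵇ⇒≤ 2 14 _)) (≤-<-trans off≤A A<U)) ∷
          op refl refl (+-identityʳ (3 * U)) (multiple-fits 3 _) ∷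
          op refl refl (+-identityʳ (4 * U)) (multiple-fits 4 _) ∷
          op refl refl (+-identityʳ (5 * U)) (multiple-fits 5 _) ∷
          op refl refl (+-identityʳ (6 * U)) (multiple-fits 6 _) ∷
          op refl refl (+-identityʳ (7 * U)) (multiple-fits 7 _) ∷
          op refl refl (+-identityʳ (10 * U)) (multiple-fits 10 _) ∷
          op refl refl (+-identityʳ (12 * U)) (multiple-fits 12 _) ∷ [] ))
    where
    above : ∀ {k} m {_ : IsTrue (suc m ≤ᵇ 8)} → 8 ≤ k → k ≢ m
    above m {m<8} 8≤k refl = <⇒≱ (≤ᵇ⇒≤ (suc m) 8 m<8) 8≤k
    contents : ∀ M M′ → SplitDone home M → (∀ k i → i < U → k < 6 → M′ k i ≡ M k i) →
      (∀ j → j < L * p → M′ 6 j ≡ Classes.bucketOf (M 3) (M 4) j) →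
      (∀ k → k < K * p → M′ 7 k ≡ Classes.rank (M 3) (M 4) k (L * p)) →
      (∀ k → k < K * p → M′ 10 k ≡ Classes.start (M 3) (M 4) (L * p) k) →
      (∀ j → j < L * p → M′ 12 (Classes.position (M 3) (M 4) j) ≡ j) → Contents home M′
    contents M M′ done same classified counted prefixes placed = record
      { split = split-transfer home≤2 same done
      ; x = M 3 ; t = M 4
      ; x≡ = λ i i<U → same 3 i i<U (≤ᵇ⇒≤ 4 6 _)
      ; t≡ = λ i i<U → same 4 i i<U (≤ᵇ⇒≤ 5 6 _)
      ; classified = classified ; counted = counted ; prefixes = prefixes ; placed = placed
      }

  pipeline : Out program initial totalTime totalWork Final
  pipeline =
    run-setup₁
    then λ s₁ (h₁ , eq₁) → run-powerA (cells initial) s₁ h₁ eq₁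
    then λ s₂ (h₂ , eq₂) → run-powerΛ (cells initial) s₂ h₂ eq₂
    then λ s₃ (h₃ , eq₃) → run-setup₂ h₃
    then λ s₄ (h₄ , eq₄) → run-setup₃ h₄
    then λ s₅ (h₅ , eq₅) → run-setup₄ h₅
    then λ s₆ (h₆ , eq₆) → run-draw (1 * U) (2 * U) 1 0 0 0 0 0 0 s₆ h₆
    then λ s₇ (h₇ , drawn₇ , frame₇) → SortLoop.run-sort s₇ h₇
    then λ s₈ (h₈ , sorted₈ , frame₈) →
      let start : cells s₆ ≡ cells initial
          start = trans eq₆ (trans eq₅ (trans eq₄ eq₃))
          zero₇ : ∀ k i → 1 ≤ k → i < U → ¬ (k ≡ 1 × off ≤ i) → cells s₇ k i ≡ 0
          zero₇ k i 1≤k i<U ≢ = trans (frame₇ k i i<U ≢) (trans (cong (λ M → M k i) start) (initial-zero k i 1≤k i<U))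
          sorted , perm = SortLoop.sorted-sample {cells s₈} {cells s₇} {srcArray levels} sorted₈
            (λ j j<off → zero₇ 1 j ≤-refl (<-trans (<-≤-trans j<off off≤A) A<U) λ (_ , off≤j) → <⇒≱ j<off off≤j)
      in run-rest (srcArray levels) (dstArray levels * U) (2 ^ levels) (SortLoop.oldRounds levels) (SortLoop.oldW2 levels)
           (SortLoop.oldTmp levels) s₈ (src≤2 levels) h₈ sorted
           (↭-trans perm (↭-reflexive (read-shift (cells s₇ 1) (sampled I) off 0 a drawn₇)))
           (λ k i 3≤k i<U → trans (frame₈ k i i<U (λ { refl → <⇒≱ 3≤k (s≤s z≤n) }) (λ { refl → <⇒≱ 3≤k ≤-refl }))
             (zero₇ k i (≤-trans (s≤s z≤n) 3≤k) i<U λ { (refl , _) → <⇒≱ 3≤k (s≤s z≤n) }))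
    where
    read-shift : ∀ f g i j n → (∀ k → k < n → f (i + k) ≡ g (j + k)) → read f i n ≡ read g j n
    read-shift f g i j zero    eq = refl
    read-shift f g i j (suc n) eq = cong₂ _∷_
      (trans (cong f (sym (+-identityʳ i))) (trans (eq 0 z<s) (cong g (+-identityʳ j))))
      (read-shift f g (suc i) (suc j) n λ k k<n →
        trans (cong f (sym (+-suc i k))) (trans (eq (suc k) (s≤s k<n)) (cong g (+-suc j k))))

  -- The final state satisfies the specification

  module _ (s : State) (F : Final s) where
    open Final F
    open Contents contents
    open SplitDone split
    open Classes x t
    open Result I s using (array; StepDone; sample; splitter; counter; prefix; output; oracle)
      renaming (tree to treeArray; lcps to lcpArray)

    private
      -- The number of counters of genuine buckets, and at the same time the least key that padding
      -- can have.
      κ : ℕ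
      κ = (2 * v + 1) * p

      at-array : ∀ r k i → control-regs s r ≡ k * U → array r i ≡ cells s k i
      at-array r k i eq = cong (λ x → memory s (x + i)) eq

      sample≡ : ∀ i → sample i ≡ cells s home (off + i)
      sample≡ i = trans (cong (λ x → memory s (x + i)) (regs .at 0 refl))
                        (cong (memory s) (+-assoc (home * U) off i))

      splitter≡ : ∀ i → splitter i ≡ cells s 3 i
      splitter≡ i = at-array 1 3 i (regs .at 1 refl)
      tree≡ : ∀ i → treeArray i ≡ cells s 4 i
      tree≡ i = at-array 2 4 i (regs .at 2 refl)
      lcp≡ : ∀ i → lcpArray i ≡ cells s 5 i
      lcp≡ i = at-array 3 5 i (regs .at 3 refl)
      oracle≡ : ∀ i → oracle i ≡ cells s 6 i
      oracle≡ i = at-array 4 6 i (regs .at 4 refl)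
      counter≡ : ∀ i → counter i ≡ cells s 7 i
      counter≡ i = at-array 5 7 i (regs .at 5 refl)
      prefix≡ : ∀ i → prefix i ≡ cells s 10 i
      prefix≡ i = at-array 6 10 i (regs .at 6 refl)
      output≡ : ∀ i → output i ≡ cells s 12 i
      output≡ i = at-array 7 12 i (regs .at 7 refl)

      read-sample : map sample (upTo a) ≡ read (cells s home) off a
      read-sample = trans (map-cong sample≡ (upTo a)) (map-upTo≡read (cells s home) off a)

      κ≤ : κ ≤ K * p
      κ≤ = *-monoˡ-≤ p (≤-trans (n≤1+n _) (≤-reflexive (sym K≡suc)))

      string< : ∀ (j : Fin n) → toℕ j < total
      string< j = <-≤-trans (toℕ<n j) n≤L*p

      bucket-small : ∀ {j} → j < n → bucketOf j < 2 * v + 1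
      bucket-small j<n = ≤-trans (≤-reflexive (cong suc (bucketOf-string j<n))) (bucket-< x t d v _ (sym 2^d≡))

      key-small : ∀ j → j < n → key j < κ
      key-small j j<n = cell-< (bucket-small j<n) (owner-< (<-≤-trans j<n n≤L*p))

      key-large : ∀ j → n ≤ j → j < total → κ ≤ key j
      key-large j n≤j _ = ≤-trans (≤-reflexive (cong (_* p)
        (sym (trans (bucketOf-surplus n≤j) (cong (_∸ 1) K≡suc))))) (m≤m+n (bucketOf j * p) (owner j))

      key-string : ∀ {j m} {q : Fin p} → j < total → m < 2 * v + 1 → key j ≡ m * p + toℕ q →
        j < n × bucketOf j ≡ m × owner j ≡ toℕ q
      key-string {j} {m} {q} j< m< eq = j<n
        , cell-injective {p} {bucketOf j} {owner j} {m} {toℕ q} (owner-< j<) (toℕ<n q) eq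
        where
        j<n : j < n
        j<n = ≰⇒> λ n≤j → <⇒≱ (cell-< m< (toℕ<n q)) (≤-trans (key-large j n≤j j<) (≤-reflexive eq))

      counter-rank : ∀ {k} → k < κ → counter k ≡ rank k total
      counter-rank {k} k< = trans (counter≡ k) (counted k (<-≤-trans k< κ≤))

      prefix-start : ∀ {k} → k < κ → prefix k ≡ start total k
      prefix-start {k} k< = trans (prefix≡ k) (prefixes k (<-≤-trans k< κ≤))

      ownerOf : Fin n → Fin p
      ownerOf j = fromℕ< (owner-< (string< j))

      toℕ-owner : ∀ j → toℕ (ownerOf j) ≡ owner (toℕ j)
      toℕ-owner j = toℕ-fromℕ< (owner-< (string< j))

      oracle-bucket : ∀ j → oracle (toℕ j) ≡ bucketOf (toℕ j)
      oracle-bucket j = trans (oracle≡ (toℕ j)) (classified (toℕ j) (string< j))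

      -- Exactly the strings have keys below `κ`, so they occupy the first `n` output cells and the
      -- padding follows.
      start-n : start total κ ≡ n
      start-n = trans (sym (length-below total κ))
        (trans (cong length (below-prefix n total n≤L*p key-small key-large)) (length-numbers 0 n))

    done : StepDone
    done = record
      { sample-drawn = ↭-trans (↭-reflexive read-sample) (↭-trans sample-drawn
          (↭-reflexive (sym (map-allFin≡read _ (sampled I) λ k →
            trans (sym (charWord-string I h (draws k))) (cong (λ j → Env.charWord env j h) (sym (random-draw I k)))))))
      ; sample-sorted = subst Sorted (sym read-sample) sample-sorted
      ; splitters = λ {i} i<v → trans (splitter≡ i) (trans (splitters i i<v) (sym (sample≡ (splitterIndex i))))
      ; tree-inorder = trans (inorder-tree treeArray splitter d λ l m r eq r< →
            trans (tree≡ _) (trans (tree l m r eq r<) (sym (splitter≡ _))))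
          (sym (map-upTo≡read splitter 0 v))
      ; splitter-lcps = λ {i} i<v → trans (lcp≡ (suc i)) (trans (lcps i i<v)
          (cong₂ (λ y z → lcp (unpack b w y) (unpack b w z)) (sym (splitter≡ i)) (sym (splitter≡ (suc i)))))
      ; classified = λ j → trans (oracle-bucket j) (trans (bucketOf-string (toℕ<n j))
          (trans (cong (bucket x t d v) (charWord-string I h j))
            (bucket-cong d v _ (sym 2^d≡)
              (λ i i≤v → sym (trans (splitter≡ i) (x≡ i (≤-<-trans i≤v v<U))))
              (λ i i< → sym (trans (tree≡ i) (t≡ i (<-≤-trans i< (≤-trans 2*2^d≤A (<⇒≤ A<U)))))))))
      ; owner = ownerOf
      -- Here the classification is by `owner` alone; each of its classes lies in one chunk of width
      -- `L`.
      ; balanced = λ q → ≤-trans (≤-reflexive (Ranks.length-filter-allFin owner {k = toℕ q} (λ j → ownerOf j Fin.≟ q)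
            (λ j eq → trans (sym (toℕ-owner j)) (cong toℕ eq))
            (λ j eq → toℕ-injective (trans (toℕ-owner j) eq))))
          (≤-trans (Ranks.rank-chunk owner n λ j eq → subst (λ q → InChunk L q j) eq (chunk-owner j)) (≤-reflexive L≡))
      -- The counter ranges over all `L * p` positions, but those from `n` on have keys of at least
      -- `κ` and do not contribute.
      ; counted = λ {m} m< q → trans (counter-rank (cell-< m< (toℕ<n q)))
          (trans (rank-const n≤L*p λ j n≤j j< eq → <⇒≱ (proj₁ (key-string {q = q} j< m< eq)) n≤j)
            (sym (length-filter-allFin (λ j → (ownerOf j Fin.≟ q) ×-dec (oracle (toℕ j) ≟ m))
              (λ j (eq₁ , eq₂) → cong₂ (λ m q → m * p + q) (trans (sym (oracle-bucket j)) eq₂) (trans (sym (toℕ-owner j)) (cong toℕ eq₁)))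
              (λ j eq → let _ , eq₁ , eq₂ = key-string {q = q} (string< j) m< eq in
                toℕ-injective (trans (toℕ-owner j) eq₂) , trans (oracle-bucket j) eq₁))))
      ; prefix-sums = λ {k} k< → trans (prefix-start k<) (trans
          (sumTo-cong k λ i i<k → sym (counter-rank (<-trans i<k k<)))
          (trans (sym (sum-read counter k)) (cong sum (sym (map-upTo≡read counter 0 k)))))
      ; output-permutes = ↭-trans (↭-reflexive (trans (map-cong output≡ (upTo n))
            (trans (map-upTo≡read (cells s 12) 0 n) (cong (read (cells s 12) 0) (sym start-n)))))
          (↭-trans (placed-↭ total (cells s 12) placed κ)
            (↭-reflexive (trans (below-prefix n total n≤L*p key-small key-large)
              (trans (sym (map-upTo≡read id 0 n)) (map-id (upTo n))))))
      ; redistributed = λ {m} m< q {i} i< →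
          let k< = cell-< m< (toℕ<n q)
              j , j< , key≡ , rank≡ = rank-find total (subst (i <_) (counter-rank k<) i<)
              j<n , bucket≡ , owner≡ = key-string {q = q} j< m< key≡
              same = toℕ-fromℕ< j<n
          in fromℕ< j<n
           , trans (trans (output≡ _) (trans (cong (cells s 12) (cong₂ _+_
               (trans (prefix-start k<) (cong (start total) (sym key≡))) (trans (sym rank≡) (cong (λ k → rank k j) (sym key≡)))))
               (placed j j<))) (sym same)
           , toℕ-injective (trans (toℕ-owner (fromℕ< j<n)) (trans (cong owner same) owner≡))
           , trans (oracle-bucket (fromℕ< j<n)) (trans (cong bucketOf same) bucket≡)
      }

  performs : ∀ {time work} → totalTime ≤ time → totalWork ≤ work → PerformsStep I program time work
  performs time≤ work≤ = conclude pipeline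
    where
    conclude : Out program initial totalTime totalWork Final → PerformsStep I program _ _
    conclude (s , t , w , run , t≤ , w≤ , final) = s , t , w , run , done s final , ≤-trans t≤ time≤ , ≤-trans w≤ work≤

  -- Time and work

  module Costs (κ : ℕ) (v≤κn : v ≤ κ * n) where
    open SortLoop using (levels; mergeTime; rounds)

    -- `z` is the work bound, and `y` the time bound without its logarithm: only the loops over
    -- `lam` levels need the logarithmic term.
    u y z β : ℕ
    u = n * d / p
    y = u + v
    z = n * d + p * v
    β = 2 ^ α

    v≤y : v ≤ y
    v≤y = m≤n+m v u

    1≤y : 1 ≤ y
    1≤y = ≤-trans 1≤v v≤y

    d≤v : d ≤ v
    d≤v = n≤2^n∸1 d

    v≤ : v ≤[ y ] 1
    v≤ = once v≤y

    A-in-v : A ≤ 2 * β * v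
    A-in-v = begin
      A              ≡⟨ trans A≡ (^-distribˡ-+-* 2 d α) ⟩
      2 ^ d * β      ≡⟨ cong (_* β) 2^d≡ ⟩
      suc v * β      ≤⟨ *-monoˡ-≤ β (≤-trans (+-monoˡ-≤ v 1≤v) (≤-reflexive (cong (v +_) (sym (+-identityʳ v))))) ⟩
      2 * v * β      ≡⟨ arrange v β ⟩
      2 * β * v      ∎
      where
      open ≤-Reasoning
      arrange : ∀ v β → 2 * v * β ≡ 2 * β * v
      arrange = solve-∀

    A≤ : A ≤[ y ] 2 * β
    A≤ = multiple (≤-trans A-in-v (*-monoʳ-≤ (2 * β) v≤y))

    a≤ : a ≤[ y ] 2 * β
    a≤ = below a≤A A≤

    levels-in-d : levels ≤ (1 + α) * d
    levels-in-d = +-monoʳ-≤ d (m≤m*n α d {{>-nonZero 1≤d}})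

    levels≤ : levels ≤[ y ] 1 + α
    levels≤ = multiple (≤-trans levels-in-d (*-monoʳ-≤ (1 + α) (≤-trans d≤v v≤y)))

    n<[1+n/p]*p : n < (n / p + 1) * p
    n<[1+n/p]*p = subst (λ k → n < k * p) (+-comm 1 (n / p)) (m<[1+m/n]*n n p)

    -- Rounding up costs a further `d`, which `d ≤ 2 ^ d ∸ 1 = v` pays for; multiplying the rounded
    -- quotient `n / p` by `d` stays below `n * d / p`.
    d*[n/p] : (n / p + 1) * d ≤ y
    d*[n/p] = ≤-trans (≤-reflexive (trans (*-distribʳ-+ d (n / p) 1) (cong (n / p * d +_) (*-identityˡ d))))
      (+-mono-≤ (m*n≤o⇒m≤o/n (n / p * d) (≤-trans (≤-reflexive (arrange (n / p) d p)) (*-monoˡ-≤ d (m/n*n≤m n p)))) d≤v)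
      where
      arrange : ∀ x d p → x * d * p ≡ x * p * d
      arrange = solve-∀

    L≤n/p+1 : L ≤ n / p + 1
    L≤n/p+1 = ≤-pred (subst (L <_) (+-comm (n / p + 1) 1) (≤-trans (≤-reflexive (cong suc L≡))
      (m<n*o⇒m/o<n {n + (p ∸ 1)} {n / p + 1 + 1} {p} (begin-strict
        n + (p ∸ 1)               <⟨ +-mono-<-≤ n<[1+n/p]*p (m∸n≤m p 1) ⟩
        (n / p + 1) * p + p       ≡⟨ arrange (n / p + 1) p ⟩
        (n / p + 1 + 1) * p       ∎))))
      where
      open ≤-Reasoning
      arrange : ∀ x p → x * p + p ≡ (x + 1) * p
      arrange = solve-∀

    L*d≤ : L * d ≤[ y ] 1
    L*d≤ = once (≤-trans (*-monoˡ-≤ d L≤n/p+1) d*[n/p])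

    L≤ : L ≤[ y ] 1
    L≤ = below (m≤m*n L d {{>-nonZero 1≤d}}) L*d≤

    K≤ : K ≤[ y ] 4
    K≤ = multiple (≤-trans (≤-trans (≤-reflexive K≡) (≤-trans (+-mono-≤ v+1≤2v v+1≤2v) (≤-reflexive (arrange v)))) (*-monoʳ-≤ 4 v≤y))
      where
      v+1≤2v : v + 1 ≤ 2 * v
      v+1≤2v = +-monoʳ-≤ v (≤-trans 1≤v (≤-reflexive (sym (+-identityʳ v))))
      arrange : ∀ v → 2 * v + 2 * v ≡ 4 * v
      arrange = solve-∀

    constant-sum : ∀ c n → sumTo (λ _ → c) n ≡ n * c
    constant-sum c zero    = refl
    constant-sum c (suc n) = trans (cong (_+ c) (constant-sum c n)) (+-comm (n * c) c)

    power-time : 2 + sumTo (λ _ → 1 + 2) levels ≤[ y ] 2 + 3 * (1 + α)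
    power-time = fixed 1≤y 2 ⊕ below (≤-reflexive (constant-sum 3 levels)) (timesʳ 3 levels≤)

    draw-time : D drawCode ≤[ y ] 4 + 8 * (2 * β)
    draw-time = fixed 1≤y 4 ⊕ timesʳ 8 a≤

    -- Here v = O(n) enters: it turns A / p into a multiple of n / p + 1, and the factor d from the
    -- levels completes the term of the bound.
    levels*A/p : levels * (A / p) ≤[ y ] (1 + α) * (2 * β * κ)
    levels*A/p = multiple (begin
      levels * (A / p)                                ≤⟨ *-mono-≤ levels-in-d A/p≤ ⟩
      (1 + α) * d * (2 * β * κ * (n / p + 1))         ≡⟨ arrange (1 + α) d (2 * β * κ) (n / p + 1) ⟩
      (1 + α) * (2 * β * κ) * ((n / p + 1) * d)       ≤⟨ *-monoʳ-≤ ((1 + α) * (2 * β * κ)) d*[n/p] ⟩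
      (1 + α) * (2 * β * κ) * y                       ∎)
      where
      open ≤-Reasoning
      arrange : ∀ a d x m → a * d * (x * m) ≡ a * x * (m * d)
      arrange = solve-∀
      A/p≤ : A / p ≤ 2 * β * κ * (n / p + 1)
      A/p≤ = ≤-trans (/-monoˡ-≤ p (begin
        A                                   ≤⟨ A-in-v ⟩
        2 * β * v                           ≤⟨ *-monoʳ-≤ (2 * β) v≤κn ⟩
        2 * β * (κ * n)                     ≡⟨ *-assoc (2 * β) κ n ⟨
        2 * β * κ * n                       ≤⟨ *-monoʳ-≤ (2 * β * κ) (<⇒≤ n<[1+n/p]*p) ⟩
        2 * β * κ * ((n / p + 1) * p)       ≡⟨ *-assoc (2 * β * κ) (n / p + 1) p ⟨
        2 * β * κ * (n / p + 1) * p         ∎)) (≤-reflexive (m*n/n≡m (2 * β * κ * (n / p + 1)) p))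

    -- An output element costs 18 steps, 16 instructions and 2 for the loop, and a pair of runs
    -- costs 8 more, whence 26. As rounds times pair length is at most A / p plus one pair, a level
    -- splits into a uniform and a geometric part.
    level-time : ∀ i → i < levels → 4 + (mergeTime i + 4) + 2 ≤ (14 + 26 * (A / p)) + 52 * 2 ^ i
    level-time i i< = begin
      4 + (mergeTime i + 4) + 2                          ≡⟨⟩
      4 + (4 + rounds i * (6 + w₂ * 18 + 2) + 4) + 2     ≡⟨ arrange₁ (rounds i) w₂ ⟩
      14 + rounds i * (8 + 18 * w₂)                      ≤⟨ +-monoʳ-≤ 14 (*-monoʳ-≤ (rounds i) (+-monoˡ-≤ (18 * w₂) (m≤m*n 8 w₂))) ⟩
      14 + rounds i * (8 * w₂ + 18 * w₂)                 ≡⟨ arrange₂ (rounds i) w₂ ⟩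
      14 + 26 * (rounds i * w₂)                          ≤⟨ +-monoʳ-≤ 14 (*-monoʳ-≤ 26 rounds*w₂) ⟩
      14 + 26 * (A / p + w₂)                             ≡⟨ arrange₃ (A / p) (2 ^ i) ⟩
      (14 + 26 * (A / p)) + 52 * 2 ^ i                   ∎
      where
      open ≤-Reasoning
      w₂ = 2 ^ i + 2 ^ i
      instance
        w₂≢0 : NonZero w₂
        w₂≢0 = >-nonZero (≤-trans (m^n>0 2 i) (m≤m+n (2 ^ i) (2 ^ i)))
      arrange₁ : ∀ r w → 4 + (4 + r * (6 + w * 18 + 2) + 4) + 2 ≡ 14 + r * (8 + 18 * w)
      arrange₁ = solve-∀
      arrange₂ : ∀ r w → 14 + r * (8 * w + 18 * w) ≡ 14 + 26 * (r * w)
      arrange₂ = solve-∀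
      arrange₃ : ∀ x w → 14 + 26 * (x + (w + w)) ≡ (14 + 26 * x) + 52 * w
      arrange₃ = solve-∀
      q = A / w₂ / p
      rounds≡ : rounds i ≡ q + 1
      rounds≡ = cong (_+ 1) (trans (quotient≡/ (quotient A w₂) p) (cong (_/ p) (quotient≡/ A w₂)))
      q*w₂ : q * w₂ ≤ A / p
      q*w₂ = m*n≤o⇒m≤o/n (q * w₂) (≤-trans (≤-reflexive (swap q w₂ p)) (≤-trans (*-monoˡ-≤ w₂ (m/n*n≤m (A / w₂) p)) (m/n*n≤m A w₂)))
        where
        swap : ∀ q w p → q * w * p ≡ q * p * w
        swap = solve-∀
      rounds*w₂ : rounds i * w₂ ≤ A / p + w₂
      rounds*w₂ = ≤-trans (≤-reflexive (trans (cong (_* w₂) rounds≡) (expand q w₂))) (+-monoˡ-≤ w₂ q*w₂)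
        where
        expand : ∀ q w → (q + 1) * w ≡ q * w + w
        expand = solve-∀

    sort-time : 2 + sumTo (λ i → 4 + (mergeTime i + 4) + 2) levels ≤[ y ] sortFactor α κ
    sort-time = below (+-monoʳ-≤ 2 (begin
        sumTo (λ i → 4 + (mergeTime i + 4) + 2) levels
          ≤⟨ sumTo-linear {2 ^_} (14 + 26 * (A / p)) 52 levels level-time ⟩
        levels * (14 + 26 * (A / p)) + 52 * sumTo (2 ^_) levels
          ≤⟨ +-monoʳ-≤ (levels * (14 + 26 * (A / p))) (*-monoʳ-≤ 52 (≤-trans (powers-≤ levels) (≤-reflexive (sym A≡)))) ⟩
        levels * (14 + 26 * (A / p)) + 52 * A
          ≡⟨ arrange levels (A / p) A ⟩
        14 * levels + 26 * (levels * (A / p) + 2 * A) ∎))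
      (fixed 1≤y 2 ⊕ times 14 levels≤ ⊕ times 26 (levels*A/p ⊕ times 2 A≤))
      where
      open ≤-Reasoning
      arrange : ∀ e x A → e * (14 + 26 * x) + 52 * A ≡ 14 * e + 26 * (e * x + 2 * A)
      arrange = solve-∀

    splitter-time : D splitterCode ≤[ y ] 20
    splitter-time = fixed 1≤y 5 ⊕ timesʳ 15 v≤

    tree-time : D treeCode ≤[ y ] 19
    tree-time = fixed 1≤y 4 ⊕ timesʳ 15 v≤

    classify-time : D classifyCode ≤[ y ] 38
    classify-time = fixed 1≤y 3 ⊕ below (begin
      L * (4 + (d * 8 + 21) + 2)   ≡⟨ cong (L *_) (arrange d) ⟩
      L * (27 + 8 * d)             ≤⟨ *-monoʳ-≤ L (+-monoˡ-≤ (8 * d) (m≤m*n 27 d {{>-nonZero 1≤d}})) ⟩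
      L * (27 * d + 8 * d)         ≡⟨ collect L d ⟩
      35 * (L * d)                 ∎) (times 35 L*d≤)
      where
      open ≤-Reasoning
      arrange : ∀ d → 4 + (d * 8 + 21) + 2 ≡ 27 + 8 * d
      arrange = solve-∀
      collect : ∀ L d → L * (27 * d + 8 * d) ≡ 35 * (L * d)
      collect = solve-∀

    chunkSum-time : D chunkSumCode ≤[ y ] 31
    chunkSum-time = below (≤-reflexive (cong (4 +_) (+-comm (K * 6) 3))) (fixed 1≤y 7 ⊕ timesʳ 6 K≤)

    prefix-time : D prefixCode ≤[ y ] 46
    prefix-time = fixed 1≤y 6 ⊕ timesʳ 10 K≤

    redistribute-time : D redistributeCode ≤[ y ] 17
    redistribute-time = fixed 1≤y 3 ⊕ timesʳ 14 L≤

    lam≤log : lam ≤ suc ⌈log₂ (p * v) ⌉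
    lam≤log = ≤-trans (≤-reflexive lam≡) (s≤s (≤-trans (≤-reflexive (sym (⌈log₂2^n⌉≡n ⌊log₂ p ⌋)))
      (⌈log₂⌉-mono-≤ (≤-trans (proj₁ (log-bounds p)) (m≤m*n p v {{>-nonZero 1≤v}})))))

    time-bound : totalTime ≤[ u + ⌈log₂ (p * v) ⌉ + v ] timeFactor α κ
    time-bound = k 6 ⊕ lift power-time ⊕ sweep 2 3 ⊕ k 14 ⊕ k 12 ⊕ k 4 ⊕ lift draw-time ⊕ lift sort-time ⊕ rest-time
      where
      l = ⌈log₂ (p * v) ⌉
      y≤ : y ≤ u + l + v
      y≤ = +-monoˡ-≤ v (m≤m+n u l)
      k : ∀ k → k ≤[ u + l + v ] k
      k = fixed (≤-trans 1≤y y≤)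
      lift : ∀ {c x} → x ≤[ y ] c → x ≤[ u + l + v ] c
      lift = enlarge y≤
      sweep : ∀ c x → c + sumTo (λ _ → x) lam ≤[ u + l + v ] c + x * 1
      -- `lam` exceeds the logarithm by at most 1, and `1 ≤ v` pays for that.
      sweep c x = k c ⊕ below (≤-reflexive (constant-sum x lam)) (timesʳ x (once (≤-trans lam≤log
        (≤-trans (≤-reflexive (+-comm 1 l)) (+-mono-≤ (m≤n+m l u) 1≤v)))))
      scan-time : scanTime ≤[ u + l + v ] 31 + ((1 + (15 + (1 + 17))) + 46)
      scan-time = lift chunkSum-time ⊕ (k 1 ⊕ sweep 2 13 ⊕ k 1 ⊕ sweep 2 15) ⊕ lift prefix-time
      rest-time : restTime ≤[ u + l + v ]
        (1 + (20 + 19)) + (38 + ((31 + ((1 + (15 + (1 + 17))) + 46)) + (17 + 8)))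
      rest-time = (k 1 ⊕ lift splitter-time ⊕ lift tree-time) ⊕ lift classify-time ⊕ scan-time ⊕
        lift redistribute-time ⊕ k 8

    -- Makes time bounds reusable: a block of time O(y) on `p` processors does O(p y) = O(z) work.
    p*y≤z : p * y ≤ z
    p*y≤z = ≤-trans (≤-reflexive (*-distribˡ-+ p u v))
      (+-monoˡ-≤ (p * v) (≤-trans (≤-reflexive (*-comm p u)) (m/n*n≤m (n * d) p)))

    work-bound : totalWork ≤[ z ] workFactor α κ
    work-bound = k 6 ⊕ solo′ power-time ⊕ power-work ⊕ k 14 ⊕ k 12 ⊕ k 4 ⊕ one draw-time ⊕ sort-work ⊕ rest-work
      where
      pv≤z : p * v ≤ z
      pv≤z = m≤n+m (p * v) (n * d)
      k : ∀ k → k ≤[ z ] k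
      k = fixed (≤-trans (*-mono-≤ 0<p 1≤v) pv≤z)
      all : ∀ {c x} → x ≤[ y ] c → p * x ≤[ z ] c
      all {c} {x} (multiple x≤) = multiple (≤-trans (*-monoʳ-≤ p x≤) (≤-trans (≤-reflexive (swap p c y)) (*-monoʳ-≤ c p*y≤z)))
        where
        swap : ∀ p c y → p * (c * y) ≡ c * (p * y)
        swap = solve-∀
      solo′ : ∀ {c x} → x ≤[ y ] c → x ≤[ z ] c
      solo′ {c} {x} x≤ = below (m≤n*m x p) (all x≤)
      one : ∀ {c x} → x ≤[ y ] c → 1 * x ≤[ z ] c
      one {c} {x} x≤ = below (≤-reflexive (*-identityˡ x)) (solo′ x≤)
      Λ≤z : 2 ^ lam ≤[ z ] 2
      Λ≤z = multiple (≤-trans (≤-trans (≤-reflexive (sym Λ≡)) Λ≤2p) (*-monoʳ-≤ 2 (≤-trans (m≤m*n p v {{>-nonZero 1≤v}}) pv≤z)))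
      lam≤ : lam ≤[ z ] 2
      lam≤ = below (<⇒≤ (n<2^n lam)) Λ≤z
      power-work : 2 + sumTo (λ _ → 1 + 2) lam ≤[ z ] 8
      power-work = k 2 ⊕ below (≤-reflexive (constant-sum 3 lam)) (timesʳ 3 lam≤)
      -- `p` times the duration would give p log p. Only the processors of a level are active, and
      -- the widths of the levels add up to at most Λ ≤ 2 p.
      up-work : 2 + sumTo (λ i → 1 + 2 ^ (lam ∸ suc i) * 10 + 2) lam ≤[ z ] 28
      up-work = k 2 ⊕ below (sumTo-linear {λ i → 2 ^ (lam ∸ suc i)} 3 10 lam λ i _ → ≤-reflexive (arrange (2 ^ (lam ∸ suc i))))
        (timesʳ 3 lam≤ ⊕ times 10 (below (reversed-powers-≤ lam) Λ≤z))
        where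
        arrange : ∀ x → 1 + x * 10 + 2 ≡ 3 + 10 * x
        arrange = solve-∀
      down-work : 2 + sumTo (λ i → 2 ^ i * 12 + 1 + 2) lam ≤[ z ] 32
      down-work = k 2 ⊕ below (sumTo-linear {2 ^_} 3 12 lam λ i _ → ≤-reflexive (arrange (2 ^ i)))
        (timesʳ 3 lam≤ ⊕ times 12 (below (powers-≤ lam) Λ≤z))
        where
        arrange : ∀ x → x * 12 + 1 + 2 ≡ 3 + 12 * x
        arrange = solve-∀
      sort-work : 2 + sumTo (λ i → 4 + (p * mergeTime i + 4) + 2) levels ≤[ z ] sortFactor α κ
      sort-work = below (+-mono-≤ (m≤n*m 2 p) (sumTo-linear {λ i → 4 + (mergeTime i + 4) + 2} 0 p levels λ i _ → begin
          4 + (p * mergeTime i + 4) + 2      ≡⟨ arrange₁ (p * mergeTime i) ⟩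
          10 + p * mergeTime i               ≤⟨ +-monoˡ-≤ (p * mergeTime i) (m≤n*m 10 p) ⟩
          p * 10 + p * mergeTime i           ≡⟨ arrange₂ p (mergeTime i) ⟩
          p * (4 + (mergeTime i + 4) + 2)    ∎))
        (below (≤-reflexive (trans (cong (λ k → p * 2 + (k + p * sumTo (λ i → 4 + (mergeTime i + 4) + 2) levels)) (*-zeroʳ levels))
          (sym (*-distribˡ-+ p 2 (sumTo (λ i → 4 + (mergeTime i + 4) + 2) levels))))) (all sort-time))
        where
        open ≤-Reasoning
        arrange₁ : ∀ x → 4 + (x + 4) + 2 ≡ 10 + x
        arrange₁ = solve-∀
        arrange₂ : ∀ p x → p * 10 + p * x ≡ p * (4 + (x + 4) + 2)
        arrange₂ = solve-∀
      scan-work : scanWork ≤[ z ] 31 + ((1 + (28 + (1 + 32))) + 46)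
      scan-work = all chunkSum-time ⊕ (k 1 ⊕ up-work ⊕ k 1 ⊕ down-work) ⊕ all prefix-time
      rest-work : restWork ≤[ z ]
        (1 + (20 + 19)) + (38 + ((31 + ((1 + (28 + (1 + 32))) + 46)) + (17 + 8)))
      rest-work = (k 1 ⊕ one splitter-time ⊕ one tree-time) ⊕ all classify-time ⊕ scan-work ⊕
        all redistribute-time ⊕ k 8

-- One constant for all instances

factor : (α κ : ℕ) → ℕ
factor α κ = timeFactor α κ + workFactor α κ + 61 * 2 ^ α

enlarged : ∀ {t k} l x → k ≤ l → t ≤[ x ] k → t ≤ l * x
enlarged l x k≤l (multiple t≤) = ≤-trans t≤ (*-monoˡ-≤ x k≤l)

m≤[m+n]+o : ∀ m n o → m ≤ m + n + o
m≤[m+n]+o m n o = ≤-trans (m≤m+n m n) (m≤m+n (m + n) o)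

n≤[m+n]+o : ∀ m n o → n ≤ m + n + o
n≤[m+n]+o m n o = ≤-trans (m≤n+m n m) (m≤m+n (m + n) o)

module Main {α : ℕ} (I : Instance α) (1≤α : 1 ≤ α) (κ : ℕ) (v≤κn : Instance.v I ≤ κ * Instance.n I)
  (memory : factor α κ * (Instance.n I + Instance.p I * Instance.v I) ≤ 2 ^ Instance.B I) where
  open Instance I

  2^d≡suc : 2 ^ d ≡ suc v
  2^d≡suc = sym (m+[n∸m]≡n (m^n>0 2 d))

  1≤v : 1 ≤ v
  1≤v = ≤-pred (≤-trans (^-monoʳ-≤ 2 1≤d) (≤-reflexive 2^d≡suc))

  -- `1 ≤ d` forces `1 ≤ v`, so `v ≤ κ * n` excludes an empty set of strings.
  0<n : 0 < n
  0<n = n≢0⇒n>0 λ n≡0 → <⇒≱ 1≤v (≤-trans v≤κn (≤-reflexive (trans (cong (κ *_) n≡0) (*-zeroʳ κ))))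

  open Sizes I 1≤α 0<n using (A₀; U₀)

  -- Explains the summand `61 * 2 ^ α` of `factor`: 15 arrays of this size need 60 times
  -- `2 ^ α * (n + p * v)`, and one unit more makes the bound by `2 ^ B` strict.
  U-bound : U₀ ≤ 4 * 2 ^ α * (n + p * v)
  U-bound = begin
    n + (A₀ * p + A₀ * p)                              ≤⟨ +-mono-≤ (m≤n*m n (4 * 2 ^ α) {{4β≢0}}) (+-mono-≤ A*p≤ A*p≤) ⟩
    4 * 2 ^ α * n + (2 * v * 2 ^ α * p + 2 * v * 2 ^ α * p)  ≡⟨ arrange (2 ^ α) n v p ⟩
    4 * 2 ^ α * (n + p * v)                            ∎
    where
    open ≤-Reasoning
    4β≢0 : NonZero (4 * 2 ^ α)
    4β≢0 = >-nonZero (≤-trans (m^n>0 2 α) (m≤n*m (2 ^ α) 4))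
    A*p≤ : A₀ * p ≤ 2 * v * 2 ^ α * p
    A*p≤ = *-monoˡ-≤ p (≤-trans (≤-reflexive (trans (^-distribˡ-+-* 2 d α) (cong (_* 2 ^ α) 2^d≡suc)))
      (*-monoˡ-≤ (2 ^ α) (≤-trans (+-monoˡ-≤ v 1≤v) (≤-reflexive (cong (v +_) (sym (+-identityʳ v)))))))
    arrange : ∀ β n v p → 4 * β * n + (2 * v * β * p + 2 * v * β * p) ≡ 4 * β * (n + p * v)
    arrange = solve-∀

  fits : 15 * U₀ < 2 ^ B
  fits = begin-strict
    15 * U₀                          ≤⟨ *-monoʳ-≤ 15 U-bound ⟩
    15 * (4 * 2 ^ α * (n + p * v))   ≡⟨ arrange (2 ^ α) (n + p * v) ⟩
    60 * (2 ^ α * (n + p * v))       <⟨ *-monoˡ-< (2 ^ α * (n + p * v)) {{>-nonZero (*-mono-≤ (m^n>0 2 α) (≤-trans 0<n (m≤m+n n (p * v))))}} (n<1+n 60) ⟩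
    61 * (2 ^ α * (n + p * v))       ≡⟨ *-assoc 61 (2 ^ α) (n + p * v) ⟨
    61 * 2 ^ α * (n + p * v)         ≤⟨ *-monoˡ-≤ (n + p * v) (m≤n+m (61 * 2 ^ α) (timeFactor α κ + workFactor α κ)) ⟩
    factor α κ * (n + p * v)         ≤⟨ memory ⟩
    2 ^ B                            ∎
    where
    open ≤-Reasoning
    arrange : ∀ β x → 15 * (4 * β * x) ≡ 60 * (β * x)
    arrange = solve-∀

  S : Sized I
  S = Sizes.sized I 1≤α 0<n fits

  performs : PerformsStep I program (factor α κ * (n * d / p + ⌈log₂ (p * v) ⌉ + v)) (factor α κ * (n * d + p * v))
  performs = Step.performs I S
    (enlarged (factor α κ) _ (m≤[m+n]+o (timeFactor α κ) (workFactor α κ) (61 * 2 ^ α)) (Step.Costs.time-bound I S κ v≤κn))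
    (enlarged (factor α κ) _ (n≤[m+n]+o (timeFactor α κ) (workFactor α κ) (61 * 2 ^ α)) (Step.Costs.work-bound I S κ v≤κn))

mainTheorem7 : ∃[ program ] ∀ (α κ : ℕ) → 1 ≤ α → ∃[ C ]
    ∀ (I : Instance α) → let open Instance I in
    v ≤ κ * n →
    C * (n + p * v) ≤ 2 ^ B →
    PerformsStep I program
    (C * (n * d / p + ⌈log₂ (p * v) ⌉ + v))
    (C * (n * d + p * v))
mainTheorem7 = program , λ α κ 1≤α → factor α κ , λ I v≤κn fits → Main.performs I 1≤α κ v≤κn fits
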